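{- Let $A=\{a_k\}_{k\in\mathbb{Z}}$ be a sequence of complex numbers with $a_k=o(k^{\alpha})$ as $k\to\pm\infty$ for some $\alpha<1$. Let $p\ge 1$ and $n\ge 0$ be integers. If $|s-n|<1$ with $s\ne n$, then $$\frac{\Psi^{(p-1)}(-s;A)}{(p-1)!}=\frac{1}{(s-n)^p}\left\{a_n-\sum_{j=1}^\infty (-1)^j\binom{j+p-2}{p-1}M^{(A)}_n(j+p-1)(s-n)^{j+p-1}\right\}.$$
   Context: The growth condition $a_k=o(k^\alpha)$ is understood with $|k|^\alpha$ for negative $k$. Parametric digamma function: for $s\in\mathbb{C}\setminus\{0,1,2,\dots\}$, $$\Psi(-s;A):=\frac{a_0}{s}+\sum_{k=1}^\infty\left(\frac{a_k}{k}-\frac{a_k}{k-s}\right).$$ $\Psi^{(p-1)}(-s;A)$ denotes the $(p-1)$-th derivative of the function $z\mapsto\Psi(z;A)$ evaluated at $z=-s$. For integers $j\ge1$, $n\ge0$: $E^{(A)}_n(j):=\sum_{k=1}^n \frac{a_{n-k}}{k^j}$, $E^{(A)}_0(j):=0$; $F^{(A)}_n(1):=\sum_{k=1}^\infty\frac{a_{k+n}-a_k}{k}$ and $F^{(A)}_n(j):=\sum_{k=1}^\infty\frac{a_{k+n}}{k^j}$ for $j>1$; $M^{(A)}_n(j):=E^{(A)}_n(j)+(-1)^jF^{(A)}_n(j)$. -}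

module Defs where

open import Algebra.Apartness.Bundles using (HeytingField)
import Algebra.Apartness.Properties.HeytingCommutativeRing as HCRProperties
open import Algebra.Bundles using (CommutativeRing; Semiring)
open import Algebra.Bundles.Raw using (RawSemiring)
import Algebra.Definitions.RawSemiring as RawSemiringOps
import Algebra.Properties.Ring as RingProperties
open import Data.Empty using (⊥-elim)
open import Data.Fin.Base using (Fin; toℕ)
open import Data.Integer.Base as ℤ using (ℤ; +_; -[1+_])
open import Data.Nat.Base as ℕ using (ℕ; zero; suc; NonZero)
open import Data.Product.Base using (Σ; ∃; Σ-syntax; ∃-syntax; _×_; _,_; proj₁; proj₂)
open import Data.Rational.Unnormalised.Base using (ℚᵘ; ↥_; ↧ₙ_)
open import Data.Sum.Base using (_⊎_; inj₁; inj₂)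
open import Level using (0ℓ)
open import Relation.Binary.Core using (Rel)
open import Relation.Binary.Structures using (IsStrictPartialOrder)
open import Relation.Nullary.Negation using (¬_)

record OrderedField : Set₁ where
  field
    heytingField : HeytingField 0ℓ 0ℓ 0ℓ

  open HeytingField heytingField public

  infix 4 _<_ _≤_

  field
    _<_                  : Rel Carrier 0ℓ
    isStrictPartialOrder : IsStrictPartialOrder _≈_ _<_
    #⇒<⊎>                : ∀ {x y} → x # y → x < y ⊎ y < x
    <⇒#                  : ∀ {x y} → x < y → x # y
    +-monoˡ-<            : ∀ {x y} z → x < y → x + z < y + z
    *-pos                : ∀ {x y} → 0# < x → 0# < y → 0# < x * y

  commutativeRing : CommutativeRing 0ℓ 0ℓ
  commutativeRing = record { isCommutativeRing = isCommutativeRing }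

  open RawSemiringOps
    (Semiring.rawSemiring (CommutativeRing.semiring commutativeRing)) public
    using (_^_) renaming (_×_ to _·_)

  fromℕ : ℕ → Carrier
  fromℕ n = n · 1#

  fromℤ : ℤ → Carrier
  fromℤ (+ n)    = fromℕ n
  fromℤ -[1+ n ] = - fromℕ (suc n)

  _≤_ : Rel Carrier 0ℓ
  x ≤ y = ¬ (y < x)

  -- The bound is symmetric in m and n, so it bounds |u m - u n|.
  IsCauchy : (ℕ → Carrier) → Set
  IsCauchy u = ∀ ε → 0# < ε →
    ∃[ N ] ∀ m n → N ℕ.≤ m → N ℕ.≤ n → u m - u n < ε

  ConvergesTo : (ℕ → Carrier) → Carrier → Set
  ConvergesTo u l = ∀ ε → 0# < ε →
    ∃[ N ] ∀ n → N ℕ.≤ n → (u n - l < ε) × (l - u n < ε)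

-- The real numbers, given by their characterisation up to isomorphism: an
-- Archimedean ordered field in which every Cauchy sequence converges.  _#_ is
-- the constructive reading of ≠, and the axioms hold, for instance, of
-- Bishop's reals; classically they single out the complete ordered field.
record Reals : Set₁ where
  field
    orderedField : OrderedField

  open OrderedField orderedField public

  field
    archimedean : ∀ x → ∃[ n ] x < fromℕ n
    complete    : ∀ u → IsCauchy u → ∃[ l ] ConvergesTo u l

module RealFacts (R : Reals) where
  open Reals R
  open IsStrictPartialOrder isStrictPartialOrder public
    using (<-respʳ-≈; <-respˡ-≈)
    renaming (irrefl to <-irrefl; trans to <-trans)
  open HCRProperties (HeytingField.heytingCommutativeRing heytingField)
    using (1#0)
  open RingProperties (CommutativeRing.ring commutativeRing)
    using (-1*x≈-x; -‿involutive)

  0<1 : 0# < 1#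
  0<1 with #⇒<⊎> 1#0
  ... | inj₂ 0<1 = 0<1
  ... | inj₁ 1<0 = ⊥-elim (<-irrefl refl (<-trans 1<0 0<1′))
    where
    0<-1 : 0# < - 1#
    0<-1 = <-respˡ-≈ (-‿inverseʳ 1#)
             (<-respʳ-≈ (+-identityˡ (- 1#)) (+-monoˡ-< (- 1#) 1<0))
    0<1′ : 0# < 1#
    0<1′ = <-respʳ-≈ (trans (-1*x≈-x (- 1#)) (-‿involutive 1#))
             (*-pos 0<-1 0<-1)

  0<fromℕ-suc : ∀ n → 0# < fromℕ (suc n)
  0<fromℕ-suc zero    = <-respʳ-≈ (sym (+-identityʳ 1#)) 0<1
  0<fromℕ-suc (suc n) = <-trans (0<fromℕ-suc n)
    (<-respˡ-≈ (+-identityˡ _) (+-monoˡ-< (fromℕ (suc n)) 0<1))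

  0<fromℕ : ∀ n .{{_ : NonZero n}} → 0# < fromℕ n
  0<fromℕ (suc n) = 0<fromℕ-suc n

  inverse⁺ : ∀ x → 0# < x → Carrier
  inverse⁺ x 0<x = proj₁ (#⇒invertible (#-sym (<⇒# 0<x)))

  -- r = b ^ q for rational q, that is, the positive r with r ^ d = b ^ m
  -- where q = m / d.
  IsRationalPower : Carrier → ℚᵘ → Carrier → Set
  IsRationalPower b q r = 0# < r × powerEq (↥ q)
    where
    powerEq : ℤ → Set
    powerEq (+ m)    = r ^ (↧ₙ q) ≈ b ^ m
    powerEq -[1+ m ] = r ^ (↧ₙ q) * b ^ suc m ≈ 1#

  IsSup : (Carrier → Set) → Carrier → Set
  IsSup P y = (∀ x → P x → x ≤ y)
            × (∀ ε → 0# < ε → ∃[ x ] P x × y - ε < x)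

  -- y = b ^ α for real b ≥ 1 and real α, as the supremum of the powers b ^ q
  -- over the rationals q ≤ α.
  IsPower : Carrier → Carrier → Carrier → Set
  IsPower b α = IsSup λ r →
    Σ[ q ∈ ℚᵘ ] (fromℤ (↥ q) ≤ fromℕ (↧ₙ q) * α) × IsRationalPower b q r

module Complex (R : Reals) where
  open Reals R public
    using () renaming (Carrier to ℝ; 0# to 0ᴿ; 1# to 1ᴿ; _<_ to _<ᴿ_)
  private module ℝ = Reals R
  open RealFacts R

  infix 4 _+i_

  record ℂ : Set where
    constructor _+i_
    field
      re im : ℝ

  open ℂ public

  infix  4 _≈_ ∣_∣<_ ∣_∣≤_
  infix  8 -_
  infixl 7 _*_
  infixl 6 _+_ _-_

  _≈_ : Rel ℂ 0ℓ
  z ≈ w = (re z ℝ.≈ re w) × (im z ℝ.≈ im w)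

  0# 1# : ℂ
  0# = 0ᴿ +i 0ᴿ
  1# = 1ᴿ +i 0ᴿ

  _+_ _*_ : ℂ → ℂ → ℂ
  z + w = (re z ℝ.+ re w) +i (im z ℝ.+ im w)
  z * w = (re z ℝ.* re w ℝ.- im z ℝ.* im w)
       +i (re z ℝ.* im w ℝ.+ im z ℝ.* re w)

  -_ : ℂ → ℂ
  - z = (ℝ.- re z) +i (ℝ.- im z)

  _-_ : ℂ → ℂ → ℂ
  z - w = z + (- w)

  rawSemiring : RawSemiring 0ℓ 0ℓ
  rawSemiring = record
    { Carrier = ℂ ; _≈_ = _≈_ ; _+_ = _+_ ; _*_ = _*_ ; 0# = 0# ; 1# = 1# }

  open RawSemiringOps rawSemiring public using (_^_; sum)

  fromℕ : ℕ → ℂ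
  fromℕ n = ℝ.fromℕ n +i 0ᴿ

  -- |z|², so that comparisons of |z| with a real need no square root.
  ∣_∣² : ℂ → ℝ
  ∣ z ∣² = re z ℝ.* re z ℝ.+ im z ℝ.* im z

  ∣_∣<_ ∣_∣≤_ : ℂ → ℝ → Set
  ∣ z ∣< r = 0ᴿ <ᴿ r × ∣ z ∣² <ᴿ r ℝ.* r
  ∣ z ∣≤ r = 0ᴿ ℝ.≤ r × ∣ z ∣² ℝ.≤ r ℝ.* r

  -- z ≠ 0 in the positive sense |z| > 0.
  _≠0 : ℂ → Set
  z ≠0 = 0ᴿ <ᴿ ∣ z ∣²

  infix 9 _⁻¹[_]
  infixl 7 _÷_[_]

  _⁻¹[_] : ∀ z → z ≠0 → ℂ
  z ⁻¹[ z≠0 ] = (re z ℝ.* r) +i (ℝ.- im z ℝ.* r)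
    where
    r : ℝ
    r = inverse⁺ ∣ z ∣² z≠0

  _÷_[_] : ℂ → ∀ w → w ≠0 → ℂ
  z ÷ w [ w≠0 ] = z * w ⁻¹[ w≠0 ]

  fromℕ≠0 : ∀ n .{{_ : NonZero n}} → fromℕ n ≠0
  fromℕ≠0 n = <-respʳ-≈
    (ℝ.sym (ℝ.trans (ℝ.+-congˡ (ℝ.zeroˡ 0ᴿ)) (ℝ.+-identityʳ _)))
    (*-pos (0<fromℕ n) (0<fromℕ n))
    where open Reals R using (*-pos)

  infix 9 1/_

  1/_ : ∀ n .{{_ : NonZero n}} → ℂ
  1/ n = fromℕ n ⁻¹[ fromℕ≠0 n ]

  -- Sequences and series are indexed by k = 1, 2, 3, …
  Seq₁ : Set
  Seq₁ = ∀ k .{{_ : NonZero k}} → ℂ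

  ∑₁ : ℕ → Seq₁ → ℂ
  ∑₁ n f = sum {n} λ i → f (suc (toℕ i))

  -- Convergence is that of the partial sums; it need not be absolute.
  HasSum : Seq₁ → ℂ → Set
  HasSum f S = ∀ ε → 0ᴿ <ᴿ ε →
    ∃[ N ] ∀ n → N ℕ.≤ n → ∣ ∑₁ n f - S ∣< ε

  Fun : (ℂ → Set) → Set
  Fun U = ∀ z → U z → ℂ

  HasDerivative : ∀ {U} → Fun U → ∀ z → U z → ℂ → Set
  HasDerivative {U} f z z∈U w = ∀ ε → 0ᴿ <ᴿ ε →
    Σ[ δ ∈ ℝ ] (0ᴿ <ᴿ δ) ×
      (∀ z′ (z′∈U : U z′) (z′≠z : (z′ - z) ≠0) → ∣ z′ - z ∣< δ →
        ∣ (f z′ z′∈U - f z z∈U) ÷ (z′ - z) [ z′≠z ] - w ∣< ε)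

  -- g is the m-th derivative of f throughout U.
  IsDerivative : ∀ {U} → ℕ → Fun U → Fun U → Set
  IsDerivative zero    f g = ∀ z z∈U → g z z∈U ≈ f z z∈U
  IsDerivative {U} (suc m) f g = Σ[ h ∈ Fun U ]
    IsDerivative m f h × (∀ z z∈U → HasDerivative h z z∈U (g z z∈U))

  -- a k = o(|k|^α) as k → ±∞.
  IsLittleO : (ℤ → ℂ) → ℝ → Set
  IsLittleO a α = ∀ ε → 0ᴿ <ᴿ ε → ∃[ K ] ∀ k → K ℕ.< ℤ.∣ k ∣ →
    Σ[ y ∈ ℝ ] IsPower (ℝ.fromℕ ℤ.∣ k ∣) α y × (∣ a k ∣≤ (ε ℝ.* y))

module Digamma (R : Reals) (a : ℤ → Complex.ℂ R) where
  open Complex R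

  -- s ∈ ℂ ∖ {0, 1, 2, …}
  NotNatural : ℂ → Set
  NotNatural s = s ≠0 × (∀ k .{{_ : NonZero k}} → (fromℕ k - s) ≠0)

  ΨTerm : ∀ s → NotNatural s → Seq₁
  ΨTerm s (_ , k≠s) k = a (+ k) * 1/ k - a (+ k) ÷ (fromℕ k - s) [ k≠s k ]

  -- The arguments z = - s at which Ψ is defined.
  ΨDomain : ℂ → Set
  ΨDomain z = NotNatural (- z)

  IsΨ : Fun ΨDomain → Set
  IsΨ Ψ = ∀ z (z∈U : ΨDomain z) → let s = - z in
    Σ[ S ∈ ℂ ] HasSum (ΨTerm s z∈U) S
             × Ψ z z∈U ≈ a (+ 0) ÷ s [ proj₁ z∈U ] + S

  -- The m-th derivative of Ψ exists, and its value at z is w.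
  Ψ⁽_⁾⟨_⟩≈_ : ℕ → ℂ → ℂ → Set
  Ψ⁽ m ⁾⟨ z ⟩≈ w =
    Σ[ Ψ ∈ Fun ΨDomain ] Σ[ Ψ⁽ᵐ⁾ ∈ Fun ΨDomain ] Σ[ z∈U ∈ ΨDomain z ]
      IsΨ Ψ × IsDerivative m Ψ Ψ⁽ᵐ⁾ × w ≈ Ψ⁽ᵐ⁾ z z∈U

  E : ℕ → ℕ → ℂ
  E n j = ∑₁ n λ k → a (+ n ℤ.- + k) * 1/ k ^ j

  -- Only used for j ≥ 1.
  FTerm : ℕ → ℕ → Seq₁
  FTerm n 1 k = (a (+ (k ℕ.+ n)) - a (+ k)) * 1/ k
  FTerm n j k = a (+ (k ℕ.+ n)) * 1/ k ^ j

  -- The series F converges, and m is the value of M.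
  IsM : ℕ → ℕ → ℂ → Set
  IsM n j m = Σ[ F ∈ ℂ ] HasSum (FTerm n j) F × m ≈ E n j + (- 1#) ^ j * F

-- Put q_k = 1/(k - s) and x = s - n.  Up to the factor (-1)^(p+1) p!, the p-th
-- derivative of Ψ at -s is Y_p = ∑ a_k (q_k^(p+1) - reg_p(k)), where
-- reg_0(k) = 1/k and reg_p = 0 for p > 0.  The growth condition gives
-- |a_k| ≤ W_k with ∑ W_k/k² convergent, so all series are dominated by this
-- one.  Expanding q_k^(p+1) to second order in s, with an error O(1/k²), shows
-- that Y_p may be differentiated termwise.  Expanding it around s = n to order
-- J, with an error at most τ_J/k² where τ_J → 0, turns the difference between
-- Y_p and the J-th partial sum of the asserted series into O(τ_J), so that no
-- double series has to be rearranged.  The conditional convergence of F_n(1)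
-- follows from that of Y_0 by the same expansion with J = 1.
module Submission where

open import Algebra.Apartness.Bundles using (HeytingField)
import Algebra.Apartness.Properties.HeytingCommutativeRing as HCRProperties
open import Algebra.Bundles using (CommutativeRing; RawRing)
import Algebra.Properties.CommutativeSemiring.Exp as CommutativeExp
import Algebra.Properties.Monoid.Mult as MonoidMult
import Algebra.Properties.Monoid.Mult.TCOptimised as MonoidMult′
import Algebra.Properties.Ring as RingProperties
import Algebra.Properties.Semiring.Exp as SemiringExp
import Algebra.Properties.Semiring.Mult as SemiringMult
import Algebra.Properties.Semiring.Mult.TCOptimised as SemiringMult′
import Algebra.Solver.Ring
open import Algebra.Solver.Ring.AlmostCommutativeRing
  using (fromCommutativeRing; _-Raw-AlmostCommutative⟶_)
open import Data.Empty using (⊥; ⊥-elim)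
open import Data.Fin.Base using (toℕ)
open import Data.Integer.Base as ℤ using (ℤ; +_; -[1+_])
import Data.Integer.Properties as ℤ
open import Data.Maybe.Base using (Maybe; just; nothing)
open import Data.Nat.Base as ℕ using (ℕ; zero; suc; z≤n; s≤s; _∸_; _!)
open import Data.Nat.Combinatorics using (nCk+nC[k+1]≡[n+1]C[k+1]; nCn≡1; k>n⇒nCk≡0)
open import Data.Nat.Combinatorics.Base using (_C_)
import Data.Nat.Properties as ℕ
open import Data.Nat.Properties using (_!≢0)
open import Data.Product.Base using (∃-syntax; Σ-syntax; _×_; _,_; proj₁; proj₂)
open import Data.Rational.Unnormalised.Base using (ℚᵘ; mkℚᵘ)
open import Data.Sum.Base using (_⊎_; inj₁; inj₂; [_,_]′)
open import Defs
open import Function.Base using (_∘_)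
open import Level using (0ℓ)
open import Relation.Binary.Definitions using (tri<; tri≈; tri>)
open import Relation.Binary.PropositionalEquality.Core as ≡ using (_≡_)
import Relation.Binary.Reasoning.Base.Triple as TripleReasoning
import Relation.Binary.Reasoning.Setoid as ≈-Reasoning
open import Relation.Binary.Structures using (IsPreorder)
open import Relation.Nullary.Decidable.Core using (yes; no)
open import Relation.Nullary.Negation using (¬_)

-- The shape of the result comes from splitting the sum at `n`. For `k > n`, `k - s = (k - n) - x`,
-- and expanding in `x` gives the `F` part. For `k < n`, `- q_k = 1 / ((n - k) - (- x))`, and
-- expanding in `- x` gives the `E` part; the sign in `M` reconciles the two directions. The term
-- `k = n` is the pole and accounts for `a_n`. When `p = 0` the correction `a_k / k` must also be
-- moved from index `n + k` to index `k`; this leaves `n` boundary terms `a_k / k`, which vanish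
-- because the growth exponent is below 1. The constructive reals shape the estimates: order is not
-- decidable, and neither square roots nor real powers are constructed. Absolute values therefore
-- occur only through upper bounds, sums replace maxima, passing to a limit costs a strict slack,
-- and `k ^ α` is majorised by an explicit product. Internally `p` is the theorem's `p - 1`, and
-- indices start at 0.

-- Ring solver with integer coefficients.

module IntegerCoefficients (A : CommutativeRing 0ℓ 0ℓ) where
  open CommutativeRing A
  open RingProperties ring
    using (-‿distribˡ-*; -‿distribʳ-*; -0#≈0#; -‿involutive; -‿+-comm)
  open SemiringMult′ semiring using (1+×; ×1-homo-*) renaming (_×_ to _·_)
  open MonoidMult′ +-monoid using (×-homo-+)
  open ≈-Reasoning setoid

  -- The optimised multiple makes `con (+ 1)` and `con (+ 2)` denote `1#` and `1# + 1#`
  -- definitionally, so that solver goals match the terms as written.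
  ⟦_⟧ℤ : ℤ → Carrier
  ⟦ + n ⟧ℤ      = n · 1#
  ⟦ -[1+ n ] ⟧ℤ = - (suc n · 1#)

  private
    cancel : ∀ x y → (1# + x) - (1# + y) ≈ x - y
    cancel x y = begin
      (1# + x) - (1# + y)        ≈⟨ +-congˡ (-‿+-comm 1# y) ⟨
      (1# + x) + (- 1# + - y)    ≈⟨ +-congʳ (+-comm 1# x) ⟩
      (x + 1#) + (- 1# + - y)    ≈⟨ +-assoc x 1# _ ⟩
      x + (1# + (- 1# + - y))    ≈⟨ +-congˡ (+-assoc 1# (- 1#) (- y)) ⟨
      x + ((1# - 1#) + - y)      ≈⟨ +-congˡ (+-congʳ (-‿inverseʳ 1#)) ⟩
      x + (0# + - y)             ≈⟨ +-congˡ (+-identityˡ (- y)) ⟩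
      x - y                      ∎

    ⊖-homo : ∀ m n → ⟦ m ℤ.⊖ n ⟧ℤ ≈ m · 1# - n · 1#
    ⊖-homo zero    zero    = sym (-‿inverseʳ 0#)
    ⊖-homo zero    (suc n) = sym (+-identityˡ _)
    ⊖-homo (suc m) zero    = sym (trans (+-congˡ -0#≈0#) (+-identityʳ _))
    ⊖-homo (suc m) (suc n) = begin
      ⟦ suc m ℤ.⊖ suc n ⟧ℤ              ≡⟨ ≡.cong ⟦_⟧ℤ (ℤ.[1+m]⊖[1+n]≡m⊖n m n) ⟩
      ⟦ m ℤ.⊖ n ⟧ℤ                      ≈⟨ ⊖-homo m n ⟩
      m · 1# - n · 1#                   ≈⟨ cancel (m · 1#) (n · 1#) ⟨
      (1# + m · 1#) - (1# + n · 1#)     ≈⟨ +-cong (1+× m 1#) (-‿cong (1+× n 1#)) ⟨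
      suc m · 1# - suc n · 1#           ∎

    neg-homo : ∀ i → ⟦ ℤ.- i ⟧ℤ ≈ - ⟦ i ⟧ℤ
    neg-homo (+ zero)   = sym -0#≈0#
    neg-homo (+ suc n)  = refl
    neg-homo -[1+ n ]   = sym (-‿involutive _)

    +-homo : ∀ i j → ⟦ i ℤ.+ j ⟧ℤ ≈ ⟦ i ⟧ℤ + ⟦ j ⟧ℤ
    +-homo (+ m)    (+ n)    = ×-homo-+ 1# m n
    +-homo (+ m)    -[1+ n ] = ⊖-homo m (suc n)
    +-homo -[1+ m ] (+ n)    = trans (⊖-homo n (suc m)) (+-comm _ _)
    +-homo -[1+ m ] -[1+ n ] = begin
      - (suc (suc (m ℕ.+ n)) · 1#)       ≡⟨ ≡.cong (λ k → - (k · 1#)) (≡.cong suc (≡.sym (ℕ.+-suc m n))) ⟩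
      - ((suc m ℕ.+ suc n) · 1#)         ≈⟨ -‿cong (×-homo-+ 1# (suc m) (suc n)) ⟩
      - (suc m · 1# + suc n · 1#)        ≈⟨ -‿+-comm _ _ ⟨
      - (suc m · 1#) + - (suc n · 1#)    ∎

    *-homo⁺ : ∀ m j → ⟦ + m ℤ.* j ⟧ℤ ≈ ⟦ + m ⟧ℤ * ⟦ j ⟧ℤ
    *-homo⁺ m (+ n) = trans (reflexive (≡.cong ⟦_⟧ℤ (≡.sym (ℤ.pos-* m n)))) (×1-homo-* m n)
    *-homo⁺ m -[1+ n ] = begin
      ⟦ + m ℤ.* -[1+ n ] ⟧ℤ       ≡⟨ ≡.cong ⟦_⟧ℤ (ℤ.neg-distribʳ-* (+ m) (+ suc n)) ⟨
      ⟦ ℤ.- (+ m ℤ.* + suc n) ⟧ℤ  ≈⟨ neg-homo (+ m ℤ.* + suc n) ⟩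
      - ⟦ + m ℤ.* + suc n ⟧ℤ      ≈⟨ -‿cong (*-homo⁺ m (+ suc n)) ⟩
      - (⟦ + m ⟧ℤ * ⟦ + suc n ⟧ℤ) ≈⟨ -‿distribʳ-* _ _ ⟩
      ⟦ + m ⟧ℤ * ⟦ -[1+ n ] ⟧ℤ    ∎

    *-homo : ∀ i j → ⟦ i ℤ.* j ⟧ℤ ≈ ⟦ i ⟧ℤ * ⟦ j ⟧ℤ
    *-homo (+ m)    j = *-homo⁺ m j
    *-homo -[1+ m ] j = begin
      ⟦ -[1+ m ] ℤ.* j ⟧ℤ         ≡⟨ ≡.cong ⟦_⟧ℤ (ℤ.neg-distribˡ-* (+ suc m) j) ⟨
      ⟦ ℤ.- (+ suc m ℤ.* j) ⟧ℤ    ≈⟨ neg-homo (+ suc m ℤ.* j) ⟩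
      - ⟦ + suc m ℤ.* j ⟧ℤ        ≈⟨ -‿cong (*-homo⁺ (suc m) j) ⟩
      - (⟦ + suc m ⟧ℤ * ⟦ j ⟧ℤ)   ≈⟨ -‿distribˡ-* _ _ ⟩
      ⟦ -[1+ m ] ⟧ℤ * ⟦ j ⟧ℤ      ∎

    ℤ-ring : RawRing 0ℓ 0ℓ
    ℤ-ring = record
      { Carrier = ℤ ; _≈_ = _≡_ ; _+_ = ℤ._+_ ; _*_ = ℤ._*_ ; -_ = ℤ.-_
      ; 0# = + 0 ; 1# = + 1 }

    morphism : ℤ-ring -Raw-AlmostCommutative⟶ fromCommutativeRing A
    morphism = record
      { ⟦_⟧ = ⟦_⟧ℤ ; +-homo = +-homo ; *-homo = *-homo ; -‿homo = neg-homo
      ; 0-homo = refl ; 1-homo = refl }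

    _coeff≟_ : ∀ i j → Maybe (⟦ i ⟧ℤ ≈ ⟦ j ⟧ℤ)
    i coeff≟ j with i ℤ.≟ j
    ... | yes i≡j = just (reflexive (≡.cong ⟦_⟧ℤ i≡j))
    ... | no  _   = nothing

  open Algebra.Solver.Ring ℤ-ring (fromCommutativeRing A) morphism _coeff≟_ public
    using (solve; _:=_; _:+_; _:-_; _:*_; :-_; con)

-- Order in a constructive ordered field.

module RealOrder (R : Reals) where
  open Reals R public
  open RealFacts R public
    using (<-respʳ-≈; <-respˡ-≈; <-irrefl; <-trans; 0<1; 0<fromℕ-suc; inverse⁺)
  open CommutativeRing commutativeRing public using (semiring)
  open SemiringExp semiring public using (^-homo-*; ^-assocʳ; ^-congˡ)
  open CommutativeExp (CommutativeRing.commutativeSemiring commutativeRing) public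
    using (^-distrib-*)
  open IntegerCoefficients commutativeRing public
    using (solve; _:=_; _:+_; _:-_; _:*_; :-_; con)
  open HCRProperties (HeytingField.heytingCommutativeRing heytingField)
    using (invertibleˡ⇒#; x-0≈x)

  <-asym : ∀ {x y} → x < y → ¬ (y < x)
  <-asym x<y y<x = <-irrefl refl (<-trans x<y y<x)

  -- Apartness is cotransitive: `z` is apart from `x` or from `y`, and either case is settled by
  -- comparing there and using transitivity. This takes the place of trichotomy.
  <-cotrans : ∀ {x y} → x < y → ∀ z → x < z ⊎ z < y
  <-cotrans x<y z with #-cotrans (<⇒# x<y) z
  ... | inj₁ x#z = [ inj₁ , (λ z<x → inj₂ (<-trans z<x x<y)) ]′ (#⇒<⊎> x#z)
  ... | inj₂ z#y = [ inj₂ , (λ y<z → inj₁ (<-trans x<y y<z)) ]′ (#⇒<⊎> z#y)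

  <⇒≤ : ∀ {x y} → x < y → x ≤ y
  <⇒≤ = <-asym

  ≤-reflexive : ∀ {x y} → x ≈ y → x ≤ y
  ≤-reflexive x≈y = <-irrefl (sym x≈y)

  ≤-refl : ∀ {x} → x ≤ x
  ≤-refl = ≤-reflexive refl

  ≤-trans : ∀ {x y z} → x ≤ y → y ≤ z → x ≤ z
  ≤-trans {y = y} x≤y y≤z z<x = [ y≤z , x≤y ]′ (<-cotrans z<x y)

  <-≤-trans : ∀ {x y z} → x < y → y ≤ z → x < z
  <-≤-trans {z = z} x<y y≤z = [ (λ x<z → x<z) , (λ z<y → ⊥-elim (y≤z z<y)) ]′ (<-cotrans x<y z)

  ≤-<-trans : ∀ {x y z} → x ≤ y → y < z → x < z
  ≤-<-trans {x} x≤y y<z = [ (λ y<x → ⊥-elim (x≤y y<x)) , (λ x<z → x<z) ]′ (<-cotrans y<z x)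

  ≤-antisym : ∀ {x y} → x ≤ y → y ≤ x → x ≈ y
  ≤-antisym {x} {y} x≤y y≤x = proj₁ (tight x y) λ x#y → [ y≤x , x≤y ]′ (#⇒<⊎> x#y)

  ≤-isPreorder : IsPreorder _≈_ _≤_
  ≤-isPreorder = record
    { isEquivalence = isEquivalence ; reflexive = ≤-reflexive ; trans = ≤-trans }

  module ≤-Reasoning = TripleReasoning ≤-isPreorder <-asym <-trans
    ((λ y≈z → <-respʳ-≈ y≈z) , (λ x≈y → <-respˡ-≈ x≈y)) <⇒≤ <-≤-trans ≤-<-trans

  open ≤-Reasoning

  +-monoʳ-< : ∀ z {x y} → x < y → z + x < z + y
  +-monoʳ-< z {x} {y} x<y = <-respˡ-≈ (+-comm x z) (<-respʳ-≈ (+-comm y z) (+-monoˡ-< z x<y))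

  +-mono-< : ∀ {x y u v} → x < y → u < v → x + u < y + v
  +-mono-< {y = y} {u} x<y u<v = <-trans (+-monoˡ-< u x<y) (+-monoʳ-< y u<v)

  private
    +-cancelʳ-< : ∀ z {x y} → x + z < y + z → x < y
    +-cancelʳ-< z {x} {y} lt = <-respˡ-≈ (undo x) (<-respʳ-≈ (undo y) (+-monoˡ-< (- z) lt))
      where
      undo : ∀ w → w + z + - z ≈ w
      undo w = solve 2 (λ w z → w :+ z :+ :- z := w) refl w z

  +-monoˡ-≤ : ∀ z {x y} → x ≤ y → x + z ≤ y + z
  +-monoˡ-≤ z x≤y lt = x≤y (+-cancelʳ-< z lt)

  +-monoʳ-≤ : ∀ z {x y} → x ≤ y → z + x ≤ z + y
  +-monoʳ-≤ z {x} {y} x≤y = begin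
    z + x ≈⟨ +-comm z x ⟩
    x + z ≤⟨ +-monoˡ-≤ z x≤y ⟩
    y + z ≈⟨ +-comm y z ⟩
    z + y ∎

  +-mono-≤ : ∀ {x y u v} → x ≤ y → u ≤ v → x + u ≤ y + v
  +-mono-≤ {y = y} {u} x≤y u≤v = ≤-trans (+-monoˡ-≤ u x≤y) (+-monoʳ-≤ y u≤v)

  0≤-+ : ∀ {x y} → 0# ≤ x → 0# ≤ y → 0# ≤ x + y
  0≤-+ {x} {y} 0≤x 0≤y = begin
    0#      ≈⟨ +-identityˡ 0# ⟨
    0# + 0# ≤⟨ +-mono-≤ 0≤x 0≤y ⟩
    x + y   ∎

  ≤-by-diff : ∀ {x y} e → 0# ≤ e → y ≈ x + e → x ≤ y
  ≤-by-diff {x} {y} e 0≤e y≈x+e = begin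
    x      ≈⟨ +-identityʳ x ⟨
    x + 0# ≤⟨ +-monoʳ-≤ x 0≤e ⟩
    x + e  ≈⟨ y≈x+e ⟨
    y      ∎

  <-by-diff : ∀ {x y} e → 0# < e → y ≈ x + e → x < y
  <-by-diff {x} {y} e 0<e y≈x+e = begin-strict
    x      ≈⟨ +-identityʳ x ⟨
    x + 0# <⟨ +-monoʳ-< x 0<e ⟩
    x + e  ≈⟨ y≈x+e ⟨
    y      ∎

  x≤x+y : ∀ x {y} → 0# ≤ y → x ≤ x + y
  x≤x+y x 0≤y = ≤-by-diff _ 0≤y refl

  y≤x+y : ∀ {x} y → 0# ≤ x → y ≤ x + y
  y≤x+y y 0≤x = ≤-by-diff _ 0≤x (+-comm _ _)

  0≤y-x : ∀ {x y} → x ≤ y → 0# ≤ y - x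
  0≤y-x {x} {y} x≤y = begin
    0#    ≈⟨ -‿inverseʳ x ⟨
    x - x ≤⟨ +-monoˡ-≤ (- x) x≤y ⟩
    y - x ∎

  0<y-x : ∀ {x y} → x < y → 0# < y - x
  0<y-x {x} {y} x<y = begin-strict
    0#    ≈⟨ -‿inverseʳ x ⟨
    x - x <⟨ +-monoˡ-< (- x) x<y ⟩
    y - x ∎

  x+[y-x]≈y : ∀ x y → y ≈ x + (y - x)
  x+[y-x]≈y = solve 2 (λ x y → y := x :+ (y :- x)) refl

  0<-neg : ∀ {x} → x < 0# → 0# < - x
  0<-neg {x} x<0 = <-respʳ-≈ (+-identityˡ (- x)) (0<y-x x<0)

  -- If `i` inverts `x * y`, then `y * i` inverts `x`.
  *-#0ˡ : ∀ {x y} → x * y # 0# → x # 0#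
  *-#0ˡ {x} {y} xy#0 = invertibleˡ⇒# (y * proj₁ inv , (begin-equality
    (y * proj₁ inv) * (x - 0#)   ≈⟨ *-congˡ (x-0≈x x) ⟩
    (y * proj₁ inv) * x          ≈⟨ solve 3 (λ x y i → (y :* i) :* x := i :* (x :* y)) refl x y (proj₁ inv) ⟩
    proj₁ inv * (x * y)          ≈⟨ *-congˡ (x-0≈x (x * y)) ⟨
    proj₁ inv * (x * y - 0#)     ≈⟨ proj₁ (proj₂ inv) ⟩
    1#                           ∎))
    where inv = #⇒invertible xy#0

  -- The signs of the factors are undecided, but the assumption `x * y < 0#` to be refuted makes
  -- both apart from zero, hence positive.
  *-nonneg : ∀ {x y} → 0# ≤ x → 0# ≤ y → 0# ≤ x * y
  *-nonneg {x} {y} 0≤x 0≤y xy<0 =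
    [ 0≤x , (λ 0<x → [ 0≤y , (λ 0<y → <-asym (*-pos 0<x 0<y) xy<0) ]′ (#⇒<⊎> y#0)) ]′ (#⇒<⊎> x#0)
    where
    x#0 : x # 0#
    x#0 = *-#0ˡ (<⇒# xy<0)
    y#0 : y # 0#
    y#0 = *-#0ˡ (<⇒# (<-respˡ-≈ (*-comm x y) xy<0))

  0<x² : ∀ {x} → x # 0# → 0# < x * x
  0<x² {x} x#0 = [ (λ x<0 → <-respʳ-≈ (solve 1 (λ x → :- x :* :- x := x :* x) refl x)
                              (*-pos (0<-neg x<0) (0<-neg x<0)))
                 , (λ 0<x → *-pos 0<x 0<x) ]′ (#⇒<⊎> x#0)

  0≤x² : ∀ x → 0# ≤ x * x
  0≤x² x x²<0 = <-asym (0<x² (*-#0ˡ (<⇒# x²<0))) x²<0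

  *-monoʳ-≤ : ∀ {z x y} → 0# ≤ z → x ≤ y → z * x ≤ z * y
  *-monoʳ-≤ {z} {x} {y} 0≤z x≤y = ≤-by-diff (z * (y - x)) (*-nonneg 0≤z (0≤y-x x≤y))
    (solve 3 (λ x y z → z :* y := z :* x :+ z :* (y :- x)) refl x y z)

  *-monoˡ-≤ : ∀ {z x y} → 0# ≤ z → x ≤ y → x * z ≤ y * z
  *-monoˡ-≤ {z} {x} {y} 0≤z x≤y = ≤-by-diff ((y - x) * z) (*-nonneg (0≤y-x x≤y) 0≤z)
    (solve 3 (λ x y z → y :* z := x :* z :+ (y :- x) :* z) refl x y z)

  *-mono-≤ : ∀ {x y u v} → 0# ≤ y → 0# ≤ u → x ≤ y → u ≤ v → x * u ≤ y * v
  *-mono-≤ 0≤y 0≤u x≤y u≤v = ≤-trans (*-monoˡ-≤ 0≤u x≤y) (*-monoʳ-≤ 0≤y u≤v)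

  *-monoʳ-< : ∀ {z x y} → 0# < z → x < y → z * x < z * y
  *-monoʳ-< {z} {x} {y} 0<z x<y = <-by-diff (z * (y - x)) (*-pos 0<z (0<y-x x<y))
    (solve 3 (λ x y z → z :* y := z :* x :+ z :* (y :- x)) refl x y z)

  *-monoˡ-< : ∀ {z x y} → 0# < z → x < y → x * z < y * z
  *-monoˡ-< {z} {x} {y} 0<z x<y = <-by-diff ((y - x) * z) (*-pos (0<y-x x<y) 0<z)
    (solve 3 (λ x y z → y :* z := x :* z :+ (y :- x) :* z) refl x y z)

  *-mono-< : ∀ {x y u v} → 0# ≤ x → 0# ≤ u → x < y → u < v → x * u < y * v
  *-mono-< {x} {y} {u} {v} 0≤x 0≤u x<y u<v = begin-strict
    x * u ≤⟨ *-monoˡ-≤ 0≤u (<⇒≤ x<y) ⟩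
    y * u <⟨ *-monoʳ-< (≤-<-trans 0≤x x<y) u<v ⟩
    y * v ∎

  *-cancelˡ-≤ : ∀ {z x y} → 0# < z → z * x ≤ z * y → x ≤ y
  *-cancelˡ-≤ 0<z zx≤zy y<x = zx≤zy (*-monoʳ-< 0<z y<x)

  x²≤y²⇒x≤y : ∀ {x y} → 0# ≤ y → x * x ≤ y * y → x ≤ y
  x²≤y²⇒x≤y 0≤y x²≤y² y<x = x²≤y² (*-mono-< 0≤y 0≤y y<x y<x)

  2# : Carrier
  2# = 1# + 1#

  0≤1 : 0# ≤ 1#
  0≤1 = <⇒≤ 0<1

  0<2 : 0# < 2#
  0<2 = <-respˡ-≈ (+-identityˡ 0#) (+-mono-< 0<1 0<1)

  recip : ∀ {x} → 0# < x → Carrier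
  recip 0<x = inverse⁺ _ 0<x

  recip-inverse : ∀ {x} (0<x : 0# < x) → x * recip 0<x ≈ 1#
  recip-inverse {x} 0<x =
    trans (*-congʳ (sym (x-0≈x x))) (proj₂ (proj₂ (#⇒invertible (#-sym (<⇒# 0<x)))))

  0<recip : ∀ {x} (0<x : 0# < x) → 0# < recip 0<x
  0<recip {x} 0<x = [ (λ r<0 → ⊥-elim (<-asym 0<1 (1<0 r<0))) , (λ 0<r → 0<r) ]′ (#⇒<⊎> r#0)
    where
    r#0 : recip 0<x # 0#
    r#0 = *-#0ˡ {recip 0<x} {x} (#-sym (<⇒#
            (<-respʳ-≈ (sym (trans (*-comm _ _) (recip-inverse 0<x))) 0<1)))
    1<0 : recip 0<x < 0# → 1# < 0#
    1<0 r<0 = begin-strict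
      1#              ≈⟨ recip-inverse 0<x ⟨
      x * recip 0<x   <⟨ *-monoʳ-< 0<x r<0 ⟩
      x * 0#          ≈⟨ zeroʳ x ⟩
      0#              ∎

-- Powers, binomial coefficients and null sequences.

module PowersOfOne (A : CommutativeRing 0ℓ 0ℓ) where
  open CommutativeRing A
  open SemiringExp semiring using (_^_)

  1^n≈1 : ∀ n → 1# ^ n ≈ 1#
  1^n≈1 zero    = refl
  1^n≈1 (suc n) = trans (*-identityˡ _) (1^n≈1 n)

-- The coefficient of `t ^ J` in the expansion of `1 / (1 - t) ^ (p + 1)`. The theorem's coefficient
-- is `binomial (p ∸ 1) (j ∸ 1)`.
binomial : ℕ → ℕ → ℕ
binomial p J = (J ℕ.+ p) C p

binomial-suc : ∀ p J → binomial (suc p) (suc J) ≡ binomial p (suc J) ℕ.+ binomial (suc p) J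
binomial-suc p J = ≡.trans
  (≡.sym (nCk+nC[k+1]≡[n+1]C[k+1] (J ℕ.+ suc p) p))
  (≡.cong (λ m → m C p ℕ.+ binomial (suc p) J) (ℕ.+-suc J p))

module RealArithmetic (R : Reals) where
  open RealOrder R public
  open PowersOfOne commutativeRing public
  open ≤-Reasoning
  open MonoidMult (CommutativeRing.+-monoid commutativeRing) using (×-homo-+)
  open SemiringMult semiring using (×1-homo-*)

  ^-nonneg : ∀ {x} n → 0# ≤ x → 0# ≤ x ^ n
  ^-nonneg zero    0≤x = 0≤1
  ^-nonneg (suc n) 0≤x = *-nonneg 0≤x (^-nonneg n 0≤x)

  ^-pos : ∀ {x} n → 0# < x → 0# < x ^ n
  ^-pos zero    0<x = 0<1
  ^-pos (suc n) 0<x = *-pos 0<x (^-pos n 0<x)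

  ^-monoˡ-≤ : ∀ {x y} n → 0# ≤ x → x ≤ y → x ^ n ≤ y ^ n
  ^-monoˡ-≤ zero    0≤x x≤y = ≤-refl
  ^-monoˡ-≤ (suc n) 0≤x x≤y =
    *-mono-≤ (≤-trans 0≤x x≤y) (^-nonneg n 0≤x) x≤y (^-monoˡ-≤ n 0≤x x≤y)

  ^-monoˡ-< : ∀ {x y} n → 0# ≤ x → x < y → x ^ suc n < y ^ suc n
  ^-monoˡ-< {x} {y} n 0≤x x<y = begin-strict
    x * x ^ n ≤⟨ *-monoʳ-≤ 0≤x (^-monoˡ-≤ n 0≤x (<⇒≤ x<y)) ⟩
    x * y ^ n <⟨ *-monoˡ-< (^-pos n (≤-<-trans 0≤x x<y)) x<y ⟩
    y * y ^ n ∎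

  ^-cancelˡ-≤ : ∀ {x y} n → 0# ≤ y → x ^ suc n ≤ y ^ suc n → x ≤ y
  ^-cancelˡ-≤ n 0≤y xⁿ≤yⁿ y<x = xⁿ≤yⁿ (^-monoˡ-< n 0≤y y<x)

  1≤^ : ∀ {x} n → 1# ≤ x → 1# ≤ x ^ n
  1≤^ {x} n 1≤x = begin
    1#     ≈⟨ 1^n≈1 n ⟨
    1# ^ n ≤⟨ ^-monoˡ-≤ n 0≤1 1≤x ⟩
    x ^ n  ∎

  ^≤1 : ∀ {x} n → 0# ≤ x → x ≤ 1# → x ^ n ≤ 1#
  ^≤1 {x} n 0≤x x≤1 = begin
    x ^ n  ≤⟨ ^-monoˡ-≤ n 0≤x x≤1 ⟩
    1# ^ n ≈⟨ 1^n≈1 n ⟩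
    1#     ∎

  ^-monoʳ-≤ : ∀ {x m n} → 1# ≤ x → m ℕ.≤ n → x ^ m ≤ x ^ n
  ^-monoʳ-≤ {n = n} 1≤x z≤n       = 1≤^ n 1≤x
  ^-monoʳ-≤         1≤x (s≤s m≤n) = *-monoʳ-≤ (≤-trans 0≤1 1≤x) (^-monoʳ-≤ 1≤x m≤n)

  fromℕ-+ : ∀ m n → fromℕ (m ℕ.+ n) ≈ fromℕ m + fromℕ n
  fromℕ-+ = ×-homo-+ 1#

  fromℕ-* : ∀ m n → fromℕ (m ℕ.* n) ≈ fromℕ m * fromℕ n
  fromℕ-* = ×1-homo-*

  0≤fromℕ : ∀ n → 0# ≤ fromℕ n
  0≤fromℕ zero    = ≤-refl
  0≤fromℕ (suc n) = <⇒≤ (0<fromℕ-suc n)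

  fromℕ-mono-≤ : ∀ {m n} → m ℕ.≤ n → fromℕ m ≤ fromℕ n
  fromℕ-mono-≤ {n = n} z≤n = 0≤fromℕ n
  fromℕ-mono-≤ (s≤s m≤n)   = +-monoʳ-≤ 1# (fromℕ-mono-≤ m≤n)

  fromℕ-cancel-≤ : ∀ {m n} → fromℕ m ≤ fromℕ n → m ℕ.≤ n
  fromℕ-cancel-≤ {m} {n} le with m ℕ.≤? n
  ... | yes m≤n = m≤n
  ... | no  m≰n = ⊥-elim (le (begin-strict
      fromℕ n        ≈⟨ +-identityˡ _ ⟨
      0# + fromℕ n   <⟨ +-monoˡ-< (fromℕ n) 0<1 ⟩
      1# + fromℕ n   ≤⟨ fromℕ-mono-≤ (ℕ.≰⇒> m≰n) ⟩
      fromℕ m        ∎))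

  1≤fromℕ-suc : ∀ n → 1# ≤ fromℕ (suc n)
  1≤fromℕ-suc n = x≤x+y 1# (0≤fromℕ n)

  bernoulli : ∀ {x} n → 0# ≤ 1# + x → 1# + fromℕ n * x ≤ (1# + x) ^ n
  bernoulli {x} zero    0≤1+x = ≤-reflexive (trans (+-congˡ (zeroˡ x)) (+-identityʳ 1#))
  bernoulli {x} (suc n) 0≤1+x = begin
    1# + fromℕ (suc n) * x           ≤⟨ ≤-by-diff (fromℕ n * (x * x)) (*-nonneg (0≤fromℕ n) (0≤x² x))
      (solve 2 (λ x n → (con (+ 1) :+ x) :* (con (+ 1) :+ n :* x)
          := con (+ 1) :+ (con (+ 1) :+ n) :* x :+ n :* (x :* x)) refl x (fromℕ n)) ⟩
    (1# + x) * (1# + fromℕ n * x)    ≤⟨ *-monoʳ-≤ 0≤1+x (bernoulli n 0≤1+x) ⟩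
    (1# + x) * (1# + x) ^ n          ∎

  half : Carrier
  half = recip 0<2

  0<half : 0# < half
  0<half = 0<recip 0<2

  half+half : ∀ x → half * x + half * x ≈ x
  half+half x = begin-equality
    half * x + half * x ≈⟨ solve 2 (λ h x → h :* x :+ h :* x := (con (+ 2) :* h) :* x) refl half x ⟩
    (2# * half) * x     ≈⟨ *-congʳ (recip-inverse 0<2) ⟩
    1# * x              ≈⟨ *-identityˡ x ⟩
    x                   ∎

  0<half* : ∀ {x} → 0# < x → 0# < half * x
  0<half* = *-pos 0<half

  half*< : ∀ {x} → 0# < x → half * x < x
  half*< {x} 0<x = <-by-diff (half * x) (0<half* 0<x) (sym (half+half x))

  *-recip-cancel : ∀ {x} (0<x : 0# < x) y → x * (recip 0<x * y) ≈ y
  *-recip-cancel {x} 0<x y =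
    trans (sym (*-assoc x _ y)) (trans (*-congʳ (recip-inverse 0<x)) (*-identityˡ y))

  archimedean-* : ∀ {c} → 0# < c → ∀ x → ∃[ N ] ∀ n → N ℕ.≤ n → x < fromℕ n * c
  archimedean-* {c} 0<c x = N , λ n N≤n → begin-strict
      x                        ≈⟨ *-recip-cancel 0<c x ⟨
      c * (recip 0<c * x)      <⟨ *-monoʳ-< 0<c (proj₂ arch) ⟩
      c * fromℕ N              ≤⟨ *-monoʳ-≤ (<⇒≤ 0<c) (fromℕ-mono-≤ N≤n) ⟩
      c * fromℕ n              ≈⟨ *-comm c _ ⟩
      fromℕ n * c              ∎
    where
    arch = archimedean (recip 0<c * x)
    N = proj₁ arch

  -- One-sided on purpose: such sequences serve as majorants, and nonnegativity is supplied
  -- separately where it matters.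
  Null : (ℕ → Carrier) → Set
  Null u = ∀ ε → 0# < ε → ∃[ N ] ∀ n → N ℕ.≤ n → u n ≤ ε

  Null-≤ : ∀ {u v} → (∀ n → v n ≤ u n) → Null u → Null v
  Null-≤ v≤u u→0 ε 0<ε = proj₁ (u→0 ε 0<ε) , λ n N≤n → ≤-trans (v≤u n) (proj₂ (u→0 ε 0<ε) n N≤n)

  Null-+ : ∀ {u v} → Null u → Null v → Null λ n → u n + v n
  Null-+ {u} {v} u→0 v→0 ε 0<ε = proj₁ U ℕ.⊔ proj₁ V , λ n N≤n → begin
      u n + v n           ≤⟨ +-mono-≤ (proj₂ U n (ℕ.≤-trans (ℕ.m≤m⊔n _ _) N≤n))
                                      (proj₂ V n (ℕ.≤-trans (ℕ.m≤n⊔m _ _) N≤n)) ⟩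
      half * ε + half * ε ≈⟨ half+half ε ⟩
      ε                   ∎
    where
    U = u→0 (half * ε) (0<half* 0<ε)
    V = v→0 (half * ε) (0<half* 0<ε)

  Null-* : ∀ {u} c → 0# ≤ c → Null u → Null λ n → c * u n
  Null-* {u} c 0≤c u→0 ε 0<ε = proj₁ U , λ n N≤n → begin
      c * u n                       ≤⟨ *-monoʳ-≤ 0≤c (proj₂ U n N≤n) ⟩
      c * (recip 0<1+c * ε)         ≤⟨ *-monoˡ-≤ (<⇒≤ 0<ε′) (y≤x+y c 0≤1) ⟩
      (1# + c) * (recip 0<1+c * ε)  ≈⟨ *-recip-cancel 0<1+c ε ⟩
      ε                             ∎
    where
    -- Dividing by `1# + c` instead of `c` avoids deciding whether `c` is zero.
    0<1+c : 0# < 1# + c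
    0<1+c = <-≤-trans 0<1 (x≤x+y 1# 0≤c)
    0<ε′ : 0# < recip 0<1+c * ε
    0<ε′ = *-pos (0<recip 0<1+c) 0<ε
    U = u→0 (recip 0<1+c * ε) 0<ε′

  Null-suc : ∀ {u} → Null u → Null (u ∘ suc)
  Null-suc u→0 ε 0<ε = proj₁ (u→0 ε 0<ε) , λ n N≤n → proj₂ (u→0 ε 0<ε) (suc n) (ℕ.m≤n⇒m≤1+n N≤n)

  -- Rests on `φ ^ n * (1 + n * (1 - φ)) ≤ 1`, a form of Bernoulli's inequality for `1 / φ` without
  -- the division, so that `φ` may vanish.
  Null-^ : ∀ {φ} → 0# ≤ φ → φ < 1# → Null (φ ^_)
  Null-^ {φ} 0≤φ φ<1 ε 0<ε = proj₁ arch , λ n N≤n ε<φⁿ → <-irrefl refl (begin-strict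
      1#                          <⟨ proj₂ arch n N≤n ⟩
      fromℕ n * (ε * δ)           ≤⟨ *-monoʳ-≤ (0≤fromℕ n) (*-monoˡ-≤ (<⇒≤ 0<δ) (<⇒≤ ε<φⁿ)) ⟩
      fromℕ n * (φ ^ n * δ)       ≤⟨ ≤-by-diff (φ ^ n) (^-nonneg n 0≤φ)
        (solve 3 (λ n p d → p :* (con (+ 1) :+ n :* d) := n :* (p :* d) :+ p) refl (fromℕ n) (φ ^ n) δ) ⟩
      φ ^ n * (1# + fromℕ n * δ)  ≤⟨ decay n ⟩
      1#                          ∎)
    where
    δ : Carrier
    δ = 1# - φ
    0<δ : 0# < δ
    0<δ = 0<y-x φ<1
    arch = archimedean-* (*-pos 0<ε 0<δ) 1#
    decay : ∀ n → φ ^ n * (1# + fromℕ n * δ) ≤ 1#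
    decay zero    = ≤-reflexive (solve 1 (λ d → con (+ 1) :* (con (+ 1) :+ con (+ 0) :* d) := con (+ 1)) refl δ)
    decay (suc n) = begin
      φ ^ suc n * (1# + fromℕ (suc n) * δ)
        ≤⟨ ≤-by-diff (φ ^ n * ((1# + fromℕ n) * (δ * δ)))
             (*-nonneg (^-nonneg n 0≤φ) (*-nonneg (0≤fromℕ (suc n)) (0≤x² δ)))
             (solve 3 (λ f p n → let d = con (+ 1) :- f in
                p :* (con (+ 1) :+ n :* d)
                  := (f :* p) :* (con (+ 1) :+ (con (+ 1) :+ n) :* d) :+ p :* ((con (+ 1) :+ n) :* (d :* d)))
                refl φ (φ ^ n) (fromℕ n)) ⟩
      φ ^ n * (1# + fromℕ n * δ)   ≤⟨ decay n ⟩
      1#                           ∎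

  private
    convex : ∀ {κ u v} → 0# ≤ κ → κ ≤ 1# → u ≤ 1# → v ≤ 1# → (1# - κ) * u + κ * v ≤ 1#
    convex {κ} {u} {v} 0≤κ κ≤1 u≤1 v≤1 = begin
      (1# - κ) * u + κ * v     ≤⟨ +-mono-≤ (*-monoʳ-≤ (0≤y-x κ≤1) u≤1) (*-monoʳ-≤ 0≤κ v≤1) ⟩
      (1# - κ) * 1# + κ * 1#   ≈⟨ solve 1 (λ k → (con (+ 1) :- k) :* con (+ 1) :+ k :* con (+ 1) := con (+ 1)) refl κ ⟩
      1#                       ∎

  -- By Pascal's rule each value is a convex combination, with weights 1 - κ
  -- and κ, of two earlier ones.
  binomial-bound : ∀ {κ} → 0# ≤ κ → κ ≤ 1# → ∀ p J →
    fromℕ (binomial p J) * (κ ^ J * (1# - κ) ^ p) ≤ 1#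
  binomial-bound {κ} 0≤κ κ≤1 zero J = begin
    fromℕ (binomial 0 J) * (κ ^ J * 1#) ≈⟨ solve 1 (λ k → (con (+ 1) :+ con (+ 0)) :* (k :* con (+ 1)) := k) refl (κ ^ J) ⟩
    κ ^ J                               ≤⟨ ^≤1 J 0≤κ κ≤1 ⟩
    1#                                  ∎
  binomial-bound {κ} 0≤κ κ≤1 (suc p) zero = begin
    fromℕ (suc p C suc p) * (1# * (1# - κ) ^ suc p) ≡⟨ ≡.cong (λ b → fromℕ b * (1# * (1# - κ) ^ suc p)) (nCn≡1 (suc p)) ⟩
    fromℕ 1 * (1# * (1# - κ) ^ suc p)   ≈⟨ solve 1 (λ k → (con (+ 1) :+ con (+ 0)) :* (con (+ 1) :* k) := k) refl _ ⟩
    (1# - κ) ^ suc p                    ≤⟨ ^≤1 (suc p) (0≤y-x κ≤1) (≤-by-diff κ 0≤κ (solve 1 (λ k → con (+ 1) := con (+ 1) :- k :+ k) refl κ)) ⟩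
    1#                                  ∎
  binomial-bound {κ} 0≤κ κ≤1 (suc p) (suc J) = begin
    fromℕ (binomial (suc p) (suc J)) * (κ ^ suc J * (1# - κ) ^ suc p)
      ≈⟨ *-congʳ (trans (reflexive (≡.cong fromℕ (binomial-suc p J))) (fromℕ-+ (binomial p (suc J)) _)) ⟩
    (fromℕ (binomial p (suc J)) + fromℕ (binomial (suc p) J)) * (κ ^ suc J * (1# - κ) ^ suc p)
      ≈⟨ solve 5 (λ b c k kj q → (b :+ c) :* ((k :* kj) :* ((con (+ 1) :- k) :* q))
            := (con (+ 1) :- k) :* (b :* ((k :* kj) :* q)) :+ k :* (c :* (kj :* ((con (+ 1) :- k) :* q))))
          refl (fromℕ (binomial p (suc J))) (fromℕ (binomial (suc p) J)) κ (κ ^ J) ((1# - κ) ^ p) ⟩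
    (1# - κ) * (fromℕ (binomial p (suc J)) * (κ ^ suc J * (1# - κ) ^ p))
      + κ * (fromℕ (binomial (suc p) J) * (κ ^ J * (1# - κ) ^ suc p))
      ≤⟨ convex 0≤κ κ≤1 (binomial-bound 0≤κ κ≤1 p (suc J)) (binomial-bound 0≤κ κ≤1 (suc p) J) ⟩
    1# ∎

  -- Writing θ = φ κ with κ = (1 + θ)/2, the binomial bound leaves the
  -- geometric factor φ ^ J.
  Null-binomial : ∀ {θ} → 0# ≤ θ → θ < 1# → ∀ p → Null λ J → fromℕ (binomial p J) * θ ^ J
  Null-binomial {θ} 0≤θ θ<1 p = Null-≤ le (Null-* (recip 0<μ) (<⇒≤ (0<recip 0<μ)) (Null-^ 0≤φ φ<1))
    where
    κ : Carrier
    κ = half * (1# + θ)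
    0<κ : 0# < κ
    0<κ = 0<half* (<-≤-trans 0<1 (x≤x+y 1# 0≤θ))
    κ<1 : κ < 1#
    κ<1 = begin-strict
      half * (1# + θ)  <⟨ *-monoʳ-< 0<half (+-monoʳ-< 1# θ<1) ⟩
      half * (1# + 1#) ≈⟨ trans (distribˡ half 1# 1#) (half+half 1#) ⟩
      1#               ∎
    θ<κ : θ < κ
    θ<κ = begin-strict
      θ                    ≈⟨ half+half θ ⟨
      half * θ + half * θ  ≈⟨ distribˡ half θ θ ⟨
      half * (θ + θ)       <⟨ *-monoʳ-< 0<half (+-monoˡ-< θ θ<1) ⟩
      half * (1# + θ)      ∎
    φ : Carrier
    φ = recip 0<κ * θ
    0≤φ : 0# ≤ φ
    0≤φ = *-nonneg (<⇒≤ (0<recip 0<κ)) 0≤θ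
    φ<1 : φ < 1#
    φ<1 = begin-strict
      recip 0<κ * θ ≈⟨ *-comm _ θ ⟩
      θ * recip 0<κ <⟨ *-monoˡ-< (0<recip 0<κ) θ<κ ⟩
      κ * recip 0<κ ≈⟨ recip-inverse 0<κ ⟩
      1#            ∎
    μ : Carrier
    μ = (1# - κ) ^ p
    0<μ : 0# < μ
    0<μ = ^-pos p (0<y-x κ<1)
    le : ∀ J → fromℕ (binomial p J) * θ ^ J ≤ recip 0<μ * φ ^ J
    le J = begin
      b * θ ^ J                            ≈⟨ *-congˡ (trans (^-congˡ J (sym (*-recip-cancel 0<κ θ))) (^-distrib-* κ φ J)) ⟩
      b * (κ ^ J * φ ^ J)                  ≈⟨ *-recip-cancel 0<μ _ ⟨
      μ * (recip 0<μ * (b * (κ ^ J * φ ^ J)))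
        ≈⟨ solve 5 (λ m r b k f → m :* (r :* (b :* (k :* f))) := (b :* (k :* m)) :* (r :* f))
             refl μ (recip 0<μ) b (κ ^ J) (φ ^ J) ⟩
      (b * (κ ^ J * μ)) * (recip 0<μ * φ ^ J)
        ≤⟨ *-monoˡ-≤ (*-nonneg (<⇒≤ (0<recip 0<μ)) (^-nonneg J 0≤φ)) (binomial-bound (<⇒≤ 0<κ) (<⇒≤ κ<1) p J) ⟩
      1# * (recip 0<μ * φ ^ J)             ≈⟨ *-identityˡ _ ⟩
      recip 0<μ * φ ^ J                    ∎
      where b = fromℕ (binomial p J)

-- Finite sums.

module Sums (A : CommutativeRing 0ℓ 0ℓ) where
  open CommutativeRing A
  open IntegerCoefficients A

  ∑ : ℕ → (ℕ → Carrier) → Carrier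
  ∑ zero    f = 0#
  ∑ (suc n) f = ∑ n f + f n

  ∑-cong : ∀ {f g} n → (∀ k → f k ≈ g k) → ∑ n f ≈ ∑ n g
  ∑-cong zero    f≈g = refl
  ∑-cong (suc n) f≈g = +-cong (∑-cong n f≈g) (f≈g n)

  ∑-+ : ∀ n f g → ∑ n (λ k → f k + g k) ≈ ∑ n f + ∑ n g
  ∑-+ zero    f g = sym (+-identityˡ 0#)
  ∑-+ (suc n) f g = trans (+-congʳ (∑-+ n f g))
    (solve 4 (λ a b c d → (a :+ b) :+ (c :+ d) := (a :+ c) :+ (b :+ d)) refl _ _ (f n) (g n))

  ∑-*ˡ : ∀ n c f → ∑ n (λ k → c * f k) ≈ c * ∑ n f
  ∑-*ˡ zero    c f = sym (zeroʳ c)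
  ∑-*ˡ (suc n) c f = trans (+-congʳ (∑-*ˡ n c f)) (sym (distribˡ c _ (f n)))

  ∑-- : ∀ n f g → ∑ n (λ k → f k - g k) ≈ ∑ n f - ∑ n g
  ∑-- zero    f g = sym (-‿inverseʳ 0#)
  ∑-- (suc n) f g = trans (+-congʳ (∑-- n f g))
    (solve 4 (λ a b c d → (a :- b) :+ (c :- d) := (a :+ c) :- (b :+ d)) refl _ _ (f n) (g n))

  ∑-neg : ∀ n f → ∑ n (λ k → - f k) ≈ - ∑ n f
  ∑-neg zero    f = solve 0 (con (+ 0) := :- con (+ 0)) refl
  ∑-neg (suc n) f = trans (+-congʳ (∑-neg n f)) (solve 2 (λ a b → :- a :+ :- b := :- (a :+ b)) refl _ (f n))

  ∑-0 : ∀ n → ∑ n (λ _ → 0#) ≈ 0#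
  ∑-0 zero    = refl
  ∑-0 (suc n) = trans (+-identityʳ _) (∑-0 n)

  ∑-split : ∀ m n f → ∑ (m ℕ.+ n) f ≈ ∑ m f + ∑ n (f ∘ (m ℕ.+_))
  ∑-split m zero    f = trans (reflexive (≡.cong (λ k → ∑ k f) (ℕ.+-identityʳ m))) (sym (+-identityʳ _))
  ∑-split m (suc n) f = trans (reflexive (≡.cong (λ k → ∑ k f) (ℕ.+-suc m n)))
    (trans (+-congʳ (∑-split m n f)) (+-assoc _ _ _))

  ∑-first : ∀ n f → ∑ (suc n) f ≈ f 0 + ∑ n (f ∘ suc)
  ∑-first n f = trans (∑-split 1 n f) (+-congʳ (+-identityˡ (f 0)))

  ∑-drop-first : ∀ n f → ∑ n (λ k → - f (suc k)) ≈ - (∑ (suc n) f - f 0)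
  ∑-drop-first n f = trans (∑-neg n (f ∘ suc)) (-‿cong (sym (trans (+-congʳ (∑-first n f))
    (solve 2 (λ a b → (a :+ b) :- a := b) refl (f 0) (∑ n (f ∘ suc))))))

  ∑-reverse : ∀ n f → ∑ n f ≈ ∑ n (λ k → f (n ℕ.∸ suc k))
  ∑-reverse zero    f = refl
  ∑-reverse (suc n) f = trans (+-congʳ (∑-reverse n f))
    (trans (+-comm _ (f n)) (sym (∑-first n (λ k → f (n ℕ.∸ k)))))

  ∑-cong-< : ∀ {f g} n → (∀ k → k ℕ.< n → f k ≈ g k) → ∑ n f ≈ ∑ n g
  ∑-cong-< zero    f≈g = refl
  ∑-cong-< (suc n) f≈g = +-cong (∑-cong-< n (λ k k<n → f≈g k (ℕ.m<n⇒m<1+n k<n))) (f≈g n (ℕ.n<1+n n))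

  ∑-swap : ∀ n J (c : ℕ → Carrier) (f : ℕ → ℕ → Carrier) →
    ∑ n (λ k → ∑ J (λ i → c i * f i k)) ≈ ∑ J (λ i → c i * ∑ n (f i))
  ∑-swap n zero    c f = ∑-0 n
  ∑-swap n (suc J) c f = trans (∑-+ n _ _) (+-cong (∑-swap n J c f) (∑-*ˡ n (c J) (f J)))

-- Summable majorants for the growth condition.

module Growth (R : Reals) where
  open RealArithmetic R public
  open Sums commutativeRing public
  open ≤-Reasoning
  open RealFacts R using (IsPower; IsRationalPower)

  κ : ℕ → Carrier
  κ k = recip (0<fromℕ-suc k)

  0<κ : ∀ k → 0# < κ k
  0<κ k = 0<recip (0<fromℕ-suc k)

  0≤κ : ∀ k → 0# ≤ κ k
  0≤κ k = <⇒≤ (0<κ k)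

  -- For nonnegative terms this is convergence without naming the limit: `tail` controls every block
  -- after a fixed start, and `bound` gives later estimates a concrete constant.
  record Summable (u : ℕ → Carrier) : Set where
    field
      bound   : Carrier
      bounded : ∀ n → ∑ n u ≤ bound
      tail    : ∀ ε → 0# < ε → ∃[ N ] ∀ n → ∑ n (u ∘ (N ℕ.+_)) ≤ ε

  ∑-nonneg : ∀ {u} n → (∀ k → 0# ≤ u k) → 0# ≤ ∑ n u
  ∑-nonneg zero    0≤u = ≤-refl
  ∑-nonneg (suc n) 0≤u = 0≤-+ (∑-nonneg n 0≤u) (0≤u n)

  Summable-shift : ∀ {u} m → (∀ k → 0# ≤ u k) → Summable u → Summable (λ k → u (m ℕ.+ k))
  Summable-shift {u} m 0≤u u-summable = record
    { bound   = bound
    ; bounded = λ n → ≤-trans (after m n u 0≤u) (bounded (m ℕ.+ n))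
    ; tail    = λ ε 0<ε → proj₁ (tail ε 0<ε) , λ n → let N = proj₁ (tail ε 0<ε) in begin
        ∑ n (λ k → u (m ℕ.+ (N ℕ.+ k)))  ≈⟨ ∑-cong n (λ k → reflexive (≡.cong u (+-exchange m N k))) ⟩
        ∑ n (λ k → u (N ℕ.+ (m ℕ.+ k)))  ≤⟨ after m n (u ∘ (N ℕ.+_)) (λ k → 0≤u (N ℕ.+ k)) ⟩
        ∑ (m ℕ.+ n) (u ∘ (N ℕ.+_))       ≤⟨ proj₂ (tail ε 0<ε) (m ℕ.+ n) ⟩
        ε                                ∎ }
    where
    open Summable u-summable
    after : ∀ m n v → (∀ k → 0# ≤ v k) → ∑ n (v ∘ (m ℕ.+_)) ≤ ∑ (m ℕ.+ n) v
    after m n v 0≤v = ≤-trans (y≤x+y _ (∑-nonneg m 0≤v)) (≤-reflexive (sym (∑-split m n v)))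
    +-exchange : ∀ m N k → m ℕ.+ (N ℕ.+ k) ≡ N ℕ.+ (m ℕ.+ k)
    +-exchange m N k = ≡.trans (≡.sym (ℕ.+-assoc m N k))
      (≡.trans (≡.cong (ℕ._+ k) (ℕ.+-comm m N)) (ℕ.+-assoc N m k))

  Summable-* : ∀ {u} c → 0# ≤ c → Summable u → Summable (λ k → c * u k)
  Summable-* {u} c 0≤c u-summable = record
    { bound   = c * bound
    ; bounded = λ n → ≤-trans (≤-reflexive (∑-*ˡ n c u)) (*-monoʳ-≤ 0≤c (bounded n))
    ; tail    = λ ε 0<ε → let T = tail (ε′ ε) (*-pos (0<recip 0<1+c) 0<ε) in proj₁ T , λ n → begin
        ∑ n (λ k → c * u (proj₁ T ℕ.+ k))  ≈⟨ ∑-*ˡ n c _ ⟩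
        c * ∑ n (u ∘ (proj₁ T ℕ.+_))       ≤⟨ *-monoʳ-≤ 0≤c (proj₂ T n) ⟩
        c * ε′ ε                           ≤⟨ *-monoˡ-≤ (<⇒≤ (*-pos (0<recip 0<1+c) 0<ε)) (y≤x+y c 0≤1) ⟩
        (1# + c) * ε′ ε                    ≈⟨ *-recip-cancel 0<1+c ε ⟩
        ε                                  ∎ }
    where
    open Summable u-summable
    0<1+c : 0# < 1# + c
    0<1+c = <-≤-trans 0<1 (x≤x+y 1# 0≤c)
    ε′ : Carrier → Carrier
    ε′ ε = recip 0<1+c * ε

  Summable-cong : ∀ {u v} → (∀ k → u k ≈ v k) → Summable u → Summable v
  Summable-cong u≈v u-summable = record
    { bound   = bound
    ; bounded = λ n → ≤-trans (≤-reflexive (∑-cong n (λ k → sym (u≈v k)))) (bounded n)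
    ; tail    = λ ε 0<ε → proj₁ (tail ε 0<ε) , λ n →
        ≤-trans (≤-reflexive (∑-cong n (λ k → sym (u≈v (proj₁ (tail ε 0<ε) ℕ.+ k))))) (proj₂ (tail ε 0<ε) n) }
    where open Summable u-summable

  telescope : ∀ (b : ℕ → Carrier) n → ∑ n (λ k → b k - b (suc k)) ≈ b 0 - b n
  telescope b zero    = sym (-‿inverseʳ (b 0))
  telescope b (suc n) = trans (+-congʳ (telescope b n))
    (solve 3 (λ x y z → (x :- y) :+ (y :- z) := x :- z) refl (b 0) (b n) (b (suc n)))

  telescoping-summable : ∀ {u : ℕ → Carrier} (b : ℕ → Carrier) → (∀ k → 0# ≤ b k) → Null b →
    (∀ k → u k ≈ b k - b (suc k)) → Summable u
  telescoping-summable {u} b 0≤b b→0 u≈ = record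
    { bound   = b 0
    ; bounded = λ n → begin
        ∑ n u                       ≈⟨ ∑-cong n u≈ ⟩
        ∑ n (λ k → b k - b (suc k)) ≈⟨ telescope b n ⟩
        b 0 - b n                   ≤⟨ x-b≤x (b 0) n ⟩
        b 0                         ∎
    ; tail    = λ ε 0<ε → let N = proj₁ (b→0 ε 0<ε) in N , λ n → begin
        ∑ n (u ∘ (N ℕ.+_))                          ≈⟨ ∑-cong n (λ k → u≈ (N ℕ.+ k)) ⟩
        ∑ n (λ k → b (N ℕ.+ k) - b (suc (N ℕ.+ k))) ≈⟨ ∑-cong n (λ k → reflexive
                                                         (≡.cong (λ j → b (N ℕ.+ k) - b j) (≡.sym (ℕ.+-suc N k)))) ⟩
        ∑ n (λ k → b (N ℕ.+ k) - b (N ℕ.+ suc k))   ≈⟨ telescope (b ∘ (N ℕ.+_)) n ⟩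
        b (N ℕ.+ 0) - b (N ℕ.+ n)                   ≤⟨ x-b≤x (b (N ℕ.+ 0)) (N ℕ.+ n) ⟩
        b (N ℕ.+ 0)                                 ≤⟨ proj₂ (b→0 ε 0<ε) (N ℕ.+ 0) (ℕ.m≤m+n N 0) ⟩
        ε                                           ∎
    }
    where
    x-b≤x : ∀ x k → x - b k ≤ x
    x-b≤x x k = ≤-by-diff (b k) (0≤b k) (solve 2 (λ x b → x := (x :- b) :+ b) refl x (b k))

  -- The products b k = ∏ (1 - 1/(m(i+1))), 1 ≤ i ≤ k, stand in for k^(-1/m),
  -- which need not be constructed: by Bernoulli's inequality
  -- 1/(k+1) ≤ (b k)^m ≤ 2/(k+2).
  module Decay (m′ : ℕ) where
    m : ℕ
    m = suc m′

    0<m[k+2] : ∀ k → 0# < fromℕ m * fromℕ (suc (suc k))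
    0<m[k+2] k = *-pos (0<fromℕ-suc m′) (0<fromℕ-suc (suc k))

    ρ : ℕ → Carrier
    ρ k = recip (0<m[k+2] k)

    0<ρ : ∀ k → 0# < ρ k
    0<ρ k = 0<recip (0<m[k+2] k)

    mρ[k+2]≈1 : ∀ k → (fromℕ m * ρ k) * fromℕ (suc (suc k)) ≈ 1#
    mρ[k+2]≈1 k = trans (solve 3 (λ m r k → (m :* r) :* k := (m :* k) :* r) refl (fromℕ m) (ρ k) (fromℕ (suc (suc k))))
                        (recip-inverse (0<m[k+2] k))

    ρ<1 : ∀ k → ρ k < 1#
    ρ<1 k = begin-strict
      ρ k                                      ≈⟨ *-identityˡ (ρ k) ⟨
      1# * ρ k                                 <⟨ *-monoˡ-< (0<ρ k) 1<m[k+2] ⟩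
      (fromℕ m * fromℕ (suc (suc k))) * ρ k    ≈⟨ recip-inverse (0<m[k+2] k) ⟩
      1#                                       ∎
      where
      1<m[k+2] : 1# < fromℕ m * fromℕ (suc (suc k))
      1<m[k+2] = begin-strict
        1#                              ≈⟨ +-identityʳ 1# ⟨
        1# + 0#                         <⟨ +-monoʳ-< 1# (0<fromℕ-suc k) ⟩
        fromℕ (suc (suc k))             ≈⟨ *-identityˡ _ ⟨
        1# * fromℕ (suc (suc k))        ≤⟨ *-monoˡ-≤ (0≤fromℕ (suc (suc k))) (1≤fromℕ-suc m′) ⟩
        fromℕ m * fromℕ (suc (suc k))   ∎

    -- `B` is the companion product with plus signs. Bernoulli's inequality bounds powers only from
    -- below, so the upper bound on `b` is obtained from a lower bound on `B` and `b * B ≤ 1`.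
    b B : ℕ → Carrier
    b zero    = 1#
    b (suc k) = b k * (1# - ρ k)
    B zero    = 1#
    B (suc k) = B k * (1# + ρ k)

    0<b : ∀ k → 0# < b k
    0<b zero    = 0<1
    0<b (suc k) = *-pos (0<b k) (0<y-x (ρ<1 k))

    0<B : ∀ k → 0# < B k
    0<B zero    = 0<1
    0<B (suc k) = *-pos (0<B k) (<-≤-trans 0<1 (x≤x+y 1# (<⇒≤ (0<ρ k))))

    bB≤1 : ∀ k → b k * B k ≤ 1#
    bB≤1 zero    = ≤-reflexive (*-identityˡ 1#)
    bB≤1 (suc k) = begin
      (b k * (1# - ρ k)) * (B k * (1# + ρ k))
        ≤⟨ ≤-by-diff ((b k * B k) * (ρ k * ρ k)) (*-nonneg (<⇒≤ (*-pos (0<b k) (0<B k))) (0≤x² (ρ k)))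
             (solve 3 (λ b B r → b :* B := (b :* (con (+ 1) :- r)) :* (B :* (con (+ 1) :+ r)) :+ (b :* B) :* (r :* r))
               refl (b k) (B k) (ρ k)) ⟩
      b k * B k ≤⟨ bB≤1 k ⟩
      1#        ∎

    -- In the induction step `(1 - ρ) ^ m ≥ 1 - m * ρ`, and the right side is `(k + 1) / (k + 2)` by
    -- the choice of `ρ`.
    1≤[k+1]bᵐ : ∀ k → 1# ≤ fromℕ (suc k) * b k ^ m
    1≤[k+1]bᵐ zero    = ≤-reflexive (sym (begin-equality
      (1# + 0#) * 1# ^ m ≈⟨ solve 1 (λ x → (con (+ 1) :+ con (+ 0)) :* x := x) refl (1# ^ m) ⟩
      1# ^ m             ≈⟨ 1^n≈1 m ⟩
      1#                 ∎))
    1≤[k+1]bᵐ (suc k) = begin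
      1#                                                  ≤⟨ 1≤[k+1]bᵐ k ⟩
      fromℕ (suc k) * b k ^ m                             ≈⟨ *-congʳ (solve 2 (λ k u → k := (con (+ 1) :+ k) :+ :- con (+ 1)) refl (fromℕ (suc k)) 1#) ⟩
      (fromℕ (suc (suc k)) + - 1#) * b k ^ m              ≈⟨ *-congʳ (+-congˡ (-‿cong (mρ[k+2]≈1 k))) ⟨
      (fromℕ (suc (suc k)) + - ((fromℕ m * ρ k) * fromℕ (suc (suc k)))) * b k ^ m
        ≈⟨ solve 4 (λ k m r b → (k :+ :- ((m :* r) :* k)) :* b := (k :* b) :* (con (+ 1) :+ m :* :- r))
             refl (fromℕ (suc (suc k))) (fromℕ m) (ρ k) (b k ^ m) ⟩
      (fromℕ (suc (suc k)) * b k ^ m) * (1# + fromℕ m * - ρ k)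
        ≤⟨ *-monoʳ-≤ (*-nonneg (0≤fromℕ (suc (suc k))) (^-nonneg m (<⇒≤ (0<b k)))) (bernoulli m (0≤y-x (<⇒≤ (ρ<1 k)))) ⟩
      (fromℕ (suc (suc k)) * b k ^ m) * (1# - ρ k) ^ m    ≈⟨ *-assoc _ _ _ ⟩
      fromℕ (suc (suc k)) * (b k ^ m * (1# - ρ k) ^ m)    ≈⟨ *-congˡ (^-distrib-* (b k) (1# - ρ k) m) ⟨
      fromℕ (suc (suc k)) * b (suc k) ^ m                 ∎

    -- Likewise `(1 + ρ) ^ m ≥ 1 + m * ρ = (k + 3) / (k + 2)`; the factor 2 is the value at `k = 0`.
    k+2≤2Bᵐ : ∀ k → fromℕ (suc (suc k)) ≤ 2# * B k ^ m
    k+2≤2Bᵐ zero    = ≤-reflexive (begin-equality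
      1# + (1# + 0#)  ≈⟨ solve 1 (λ x → con (+ 1) :+ (con (+ 1) :+ con (+ 0)) := con (+ 2) :* con (+ 1)) refl 1# ⟩
      2# * 1#         ≈⟨ *-congˡ (1^n≈1 m) ⟨
      2# * 1# ^ m     ∎)
    k+2≤2Bᵐ (suc k) = begin
      1# + fromℕ (suc (suc k))                            ≈⟨ +-congʳ (mρ[k+2]≈1 k) ⟨
      (fromℕ m * ρ k) * fromℕ (suc (suc k)) + fromℕ (suc (suc k))
        ≈⟨ solve 3 (λ m r k → (m :* r) :* k :+ k := (con (+ 1) :+ m :* r) :* k) refl (fromℕ m) (ρ k) (fromℕ (suc (suc k))) ⟩
      (1# + fromℕ m * ρ k) * fromℕ (suc (suc k))
        ≤⟨ *-mono-≤ (^-nonneg m 0≤1+ρ) (0≤fromℕ (suc (suc k))) (bernoulli m 0≤1+ρ) (k+2≤2Bᵐ k) ⟩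
      (1# + ρ k) ^ m * (2# * B k ^ m)                     ≈⟨ solve 3 (λ x y z → x :* (y :* z) := y :* (z :* x)) refl _ _ _ ⟩
      2# * (B k ^ m * (1# + ρ k) ^ m)                     ≈⟨ *-congˡ (^-distrib-* (B k) (1# + ρ k) m) ⟨
      2# * B (suc k) ^ m                                  ∎
      where
      0≤1+ρ : 0# ≤ 1# + ρ k
      0≤1+ρ = 0≤-+ 0≤1 (<⇒≤ (0<ρ k))

    -- If `ε < b n`, then `ε * B n ≤ 1`, and the lower bound on `B n ^ m` yields `n * ε ^ m ≤ 2`,
    -- which fails for large `n`.
    Null-b : Null b
    Null-b ε 0<ε = proj₁ arch , λ n N≤n ε<b → <-irrefl refl (begin-strict
        2#                               <⟨ proj₂ arch n N≤n ⟩
        fromℕ n * ε ^ m                  ≤⟨ *-monoˡ-≤ (^-nonneg m (<⇒≤ 0<ε)) (≤-trans (fromℕ-mono-≤ (ℕ.m≤n+m n 2)) (k+2≤2Bᵐ n)) ⟩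
        (2# * B n ^ m) * ε ^ m           ≈⟨ trans (*-assoc 2# _ _) (*-congˡ (trans (*-comm _ _) (sym (^-distrib-* ε (B n) m)))) ⟩
        2# * (ε * B n) ^ m               ≤⟨ *-monoʳ-≤ (<⇒≤ 0<2) (^≤1 m (<⇒≤ (*-pos 0<ε (0<B n)))
                                              (≤-trans (*-monoˡ-≤ (<⇒≤ (0<B n)) (<⇒≤ ε<b)) (bB≤1 n))) ⟩
        2# * 1#                          ≈⟨ *-identityʳ 2# ⟩
        2#                               ∎)
      where arch = archimedean-* (^-pos m 0<ε) 2#

    -- Stands in for `(k + 1) ^ (1 - 1/m)`; since `1 - 1/m = m′ / m`, it is to dominate powers with
    -- exponent at most `m′ / m`.
    β : ℕ → Carrier
    β k = fromℕ (suc k) * b k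

    0<β : ∀ k → 0# < β k
    0<β k = *-pos (0<fromℕ-suc k) (0<b k)

    [k+1]^m′≤βᵐ : ∀ k → fromℕ (suc k) ^ m′ ≤ β k ^ m
    [k+1]^m′≤βᵐ k = begin
      fromℕ (suc k) ^ m′                             ≈⟨ *-identityˡ _ ⟨
      1# * fromℕ (suc k) ^ m′                        ≤⟨ *-monoˡ-≤ (^-nonneg m′ (0≤fromℕ (suc k))) (1≤[k+1]bᵐ k) ⟩
      (fromℕ (suc k) * b k ^ m) * fromℕ (suc k) ^ m′ ≈⟨ solve 3 (λ x y z → (x :* y) :* z := (x :* z) :* y) refl _ _ _ ⟩
      fromℕ (suc k) ^ m * b k ^ m                    ≈⟨ ^-distrib-* (fromℕ (suc k)) (b k) m ⟨
      β k ^ m                                        ∎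

    1≤βᵐ : ∀ k → 1# ≤ β k ^ m
    1≤βᵐ k = ≤-trans (1≤^ m′ (1≤fromℕ-suc k)) ([k+1]^m′≤βᵐ k)

    -- This is `(k + 1) ^ 2` times `2 * m * (b k - b (k + 1))`, so that the series of `κ * κ * W`
    -- telescopes. As `m * ρ = 1 / (k + 2)`, the factor 2 secures `β ≤ W` through
    -- `k + 2 ≤ 2 * (k + 1)`.
    W : ℕ → Carrier
    W k = fromℕ (suc k) * (fromℕ (suc k) * ((fromℕ m * 2#) * (b k * ρ k)))

    0<W : ∀ k → 0# < W k
    0<W k = *-pos (0<fromℕ-suc k) (*-pos (0<fromℕ-suc k) (*-pos (*-pos (0<fromℕ-suc m′) 0<2) (*-pos (0<b k) (0<ρ k))))

    κW : ∀ k → κ k * W k ≈ fromℕ (suc k) * ((fromℕ m * 2#) * (b k * ρ k))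
    κW k = begin-equality
      κ k * (fromℕ (suc k) * _)   ≈⟨ *-assoc (κ k) (fromℕ (suc k)) _ ⟨
      (κ k * fromℕ (suc k)) * _   ≈⟨ *-congʳ (trans (*-comm _ _) (recip-inverse (0<fromℕ-suc k))) ⟩
      1# * _                      ≈⟨ *-identityˡ _ ⟩
      _                           ∎

    κκW : ∀ k → κ k * (κ k * W k) ≈ (fromℕ m * 2#) * (b k * ρ k)
    κκW k = begin-equality
      κ k * (κ k * W k)           ≈⟨ *-congˡ (κW k) ⟩
      κ k * (fromℕ (suc k) * _)   ≈⟨ *-assoc (κ k) (fromℕ (suc k)) _ ⟨
      (κ k * fromℕ (suc k)) * _   ≈⟨ *-congʳ (trans (*-comm _ _) (recip-inverse (0<fromℕ-suc k))) ⟩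
      1# * _                      ≈⟨ *-identityˡ _ ⟩
      _                           ∎

    β≤W : ∀ k → β k ≤ W k
    β≤W k = *-monoʳ-≤ (0≤fromℕ (suc k)) (begin
      b k                                                  ≈⟨ *-identityˡ (b k) ⟨
      1# * b k                                             ≈⟨ *-congʳ (mρ[k+2]≈1 k) ⟨
      ((fromℕ m * ρ k) * fromℕ (suc (suc k))) * b k
        ≤⟨ ≤-by-diff (((fromℕ m * ρ k) * b k) * fromℕ k)
             (*-nonneg (<⇒≤ (*-pos (*-pos (0<fromℕ-suc m′) (0<ρ k)) (0<b k))) (0≤fromℕ k))
             (solve 4 (λ k m r b → (con (+ 1) :+ k) :* ((m :* con (+ 2)) :* (b :* r))
               := ((m :* r) :* (con (+ 1) :+ (con (+ 1) :+ k))) :* b :+ ((m :* r) :* b) :* k)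
               refl (fromℕ k) (fromℕ m) (ρ k) (b k)) ⟩
      fromℕ (suc k) * ((fromℕ m * 2#) * (b k * ρ k))       ∎)

    Null-κW : Null λ k → κ k * W k
    Null-κW = Null-≤ κW≤2b (Null-* 2# (<⇒≤ 0<2) Null-b)
      where
      κW≤2b : ∀ k → κ k * W k ≤ 2# * b k
      κW≤2b k = begin
        κ k * W k                                       ≈⟨ κW k ⟩
        fromℕ (suc k) * ((fromℕ m * 2#) * (b k * ρ k))
          ≤⟨ ≤-by-diff ((fromℕ m * 2#) * (b k * ρ k)) (<⇒≤ (*-pos (*-pos (0<fromℕ-suc m′) 0<2) (*-pos (0<b k) (0<ρ k))))
               (solve 4 (λ k m r b → (con (+ 2) :* b) :* ((m :* r) :* (con (+ 1) :+ k))
                 := k :* ((m :* con (+ 2)) :* (b :* r)) :+ ((m :* con (+ 2)) :* (b :* r)))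
                 refl (fromℕ (suc k)) (fromℕ m) (ρ k) (b k)) ⟩
        (2# * b k) * ((fromℕ m * ρ k) * fromℕ (suc (suc k)))  ≈⟨ *-congˡ (mρ[k+2]≈1 k) ⟩
        (2# * b k) * 1#                                       ≈⟨ *-identityʳ _ ⟩
        2# * b k                                              ∎

    Summable-κκW : Summable λ k → κ k * (κ k * W k)
    Summable-κκW = telescoping-summable (λ k → (fromℕ m * 2#) * b k)
      (λ k → <⇒≤ (*-pos 0<2m (0<b k))) (Null-* (fromℕ m * 2#) (<⇒≤ 0<2m) Null-b)
      (λ k → trans (κκW k) (solve 3 (λ m b r → m :* (b :* r) := m :* b :- m :* (b :* (con (+ 1) :- r)))
                              refl (fromℕ m * 2#) (b k) (ρ k)))
      where
      0<2m : 0# < fromℕ m * 2#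
      0<2m = *-pos (0<fromℕ-suc m′) 0<2

    module _ {α} (mα≤m′ : fromℕ m * α ≤ fromℕ m′) (k : ℕ) where

      -- After raising both sides to a power that clears the denominators of `q` and `m′ / m`, the
      -- claim for `q ≥ 0` is a comparison of natural exponents, which follows from
      -- `q ≤ α ≤ m′ / m`. For `q < 0` the number 1 separates the two sides. The index `suc k` of
      -- `β` equals the base, so one also passes from base `k + 1` to `k + 2`.
      rationalPower≤β : ∀ q {r} → fromℤ (ℚᵘ.numerator q) ≤ fromℕ (suc (ℚᵘ.denominator-1 q)) * α →
        IsRationalPower (fromℕ (suc k)) q r → r ≤ β (suc k)
      rationalPower≤β (mkℚᵘ (+ u) d) {r} u≤dα (0<r , rᵈ≈kᵘ) =
        -- Here `d` is the denominator minus one, and `suc (m′ + d * m)` computes to `suc d * m`.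
        ^-cancelˡ-≤ (m′ ℕ.+ d ℕ.* m) (<⇒≤ (0<β (suc k))) (begin
          r ^ (suc d ℕ.* m)                       ≈⟨ ^-assocʳ r (suc d) m ⟨
          (r ^ suc d) ^ m                         ≈⟨ ^-congˡ m rᵈ≈kᵘ ⟩
          (fromℕ (suc k) ^ u) ^ m                 ≈⟨ ^-assocʳ (fromℕ (suc k)) u m ⟩
          fromℕ (suc k) ^ (u ℕ.* m)               ≤⟨ ^-monoʳ-≤ (1≤fromℕ-suc k) um≤m′d ⟩
          fromℕ (suc k) ^ (m′ ℕ.* suc d)          ≤⟨ ^-monoˡ-≤ (m′ ℕ.* suc d) (0≤fromℕ (suc k)) (fromℕ-mono-≤ (ℕ.n≤1+n (suc k))) ⟩
          fromℕ (suc (suc k)) ^ (m′ ℕ.* suc d)    ≈⟨ ^-assocʳ (fromℕ (suc (suc k))) m′ (suc d) ⟨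
          (fromℕ (suc (suc k)) ^ m′) ^ suc d      ≤⟨ ^-monoˡ-≤ (suc d) (^-nonneg m′ (0≤fromℕ (suc (suc k)))) ([k+1]^m′≤βᵐ (suc k)) ⟩
          (β (suc k) ^ m) ^ suc d                 ≈⟨ ^-assocʳ (β (suc k)) m (suc d) ⟩
          β (suc k) ^ (m ℕ.* suc d)               ≡⟨ ≡.cong (β (suc k) ^_) (ℕ.*-comm m (suc d)) ⟩
          β (suc k) ^ (suc d ℕ.* m)               ∎)
        where
        um≤m′d : u ℕ.* m ℕ.≤ m′ ℕ.* suc d
        um≤m′d = fromℕ-cancel-≤ (begin
          fromℕ (u ℕ.* m)                  ≈⟨ fromℕ-* u m ⟩
          fromℕ u * fromℕ m                ≤⟨ *-monoˡ-≤ (0≤fromℕ m) u≤dα ⟩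
          (fromℕ (suc d) * α) * fromℕ m    ≈⟨ solve 3 (λ d a m → (d :* a) :* m := (m :* a) :* d) refl (fromℕ (suc d)) α (fromℕ m) ⟩
          (fromℕ m * α) * fromℕ (suc d)    ≤⟨ *-monoˡ-≤ (0≤fromℕ (suc d)) mα≤m′ ⟩
          fromℕ m′ * fromℕ (suc d)         ≈⟨ fromℕ-* m′ (suc d) ⟨
          fromℕ (m′ ℕ.* suc d)             ∎)
      rationalPower≤β (mkℚᵘ -[1+ u ] d) {r} _ (0<r , rᵈkᵘ≈1) =
        ^-cancelˡ-≤ (m′ ℕ.+ d ℕ.* m) (<⇒≤ (0<β (suc k))) (begin
          r ^ (suc d ℕ.* m)                       ≈⟨ ^-assocʳ r (suc d) m ⟨
          (r ^ suc d) ^ m                         ≤⟨ ^≤1 m (^-nonneg (suc d) (<⇒≤ 0<r)) rᵈ≤1 ⟩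
          1#                                      ≤⟨ 1≤^ (suc d) (1≤βᵐ (suc k)) ⟩
          (β (suc k) ^ m) ^ suc d                 ≈⟨ ^-assocʳ (β (suc k)) m (suc d) ⟩
          β (suc k) ^ (m ℕ.* suc d)               ≡⟨ ≡.cong (β (suc k) ^_) (ℕ.*-comm m (suc d)) ⟩
          β (suc k) ^ (suc d ℕ.* m)               ∎)
        where
        rᵈ≤1 : r ^ suc d ≤ 1#
        rᵈ≤1 = begin
          r ^ suc d                             ≈⟨ *-identityʳ _ ⟨
          r ^ suc d * 1#                        ≤⟨ *-monoʳ-≤ (^-nonneg (suc d) (<⇒≤ 0<r)) (1≤^ (suc u) (1≤fromℕ-suc k)) ⟩
          r ^ suc d * fromℕ (suc k) ^ suc u     ≈⟨ rᵈkᵘ≈1 ⟩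
          1#                                    ∎

      -- A supremum above `β` would be approximated, within its excess over `β`, by a rational power
      -- that is itself above `β`.
      power≤β : ∀ {y} → IsPower (fromℕ (suc k)) α y → y ≤ β (suc k)
      power≤β {y} (_ , approx) β<y with approx (y - β (suc k)) (0<y-x β<y)
      ... | r , (q , q≤α , pow) , lt = rationalPower≤β q q≤α pow
        (<-respˡ-≈ (solve 2 (λ y b → y :- (y :- b) := b) refl y (β (suc k))) lt)

  -- A majorant of k ^ α with the decay that the series below need.
  record Weight (α : Carrier) : Set where
    field
      W            : ℕ → Carrier
      0<W          : ∀ k → 0# < W k
      power≤W      : ∀ k {y} → IsPower (fromℕ (suc k)) α y → y ≤ W (suc k)
      Null-κW      : Null λ k → κ k * W k
      Summable-κκW : Summable λ k → κ k * (κ k * W k)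

  weight : ∀ {α} → α < 1# → Weight α
  weight {α} α<1 = record
    { W = D.W ; 0<W = D.0<W ; Null-κW = D.Null-κW ; Summable-κκW = D.Summable-κκW
    ; power≤W = λ k pow → ≤-trans (D.power≤β mα≤m′ k pow) (D.β≤W (suc k)) }
    where
    -- The denominator `m = suc m′` is chosen with `m * (1 - α) > 1`, that is `m * α < m′`.
    arch = archimedean-* (0<y-x α<1) 1#
    m′ : ℕ
    m′ = proj₁ arch
    module D = Decay m′
    mα≤m′ : fromℕ (suc m′) * α ≤ fromℕ m′
    mα≤m′ = <⇒≤ (<-by-diff (fromℕ (suc m′) * (1# - α) - 1#) (0<y-x (proj₂ arch (suc m′) (ℕ.n≤1+n m′)))
      (solve 2 (λ m a → let m+1 = con (+ 1) :+ m in
         m := m+1 :* a :+ (m+1 :* (con (+ 1) :- a) :- con (+ 1))) refl (fromℕ m′) α))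

-- Complete valued fields over the reals.  The absolute value enters only
-- through its upper bounds, so that no square roots are needed for ℂ.
record ValuedField (R : Reals) : Set₁ where
  module ℝ = Growth R

  field
    commutativeRing : CommutativeRing 0ℓ 0ℓ

  open CommutativeRing commutativeRing public
  open SemiringMult semiring using () renaming (_×_ to _·_)

  ι : ℕ → Carrier
  ι n = n · 1#

  infix 4 ∣_∣≤_
  field
    ∣_∣≤_      : Carrier → ℝ.Carrier → Set
    ∣∣-resp    : ∀ {z w r} → z ≈ w → ∣ z ∣≤ r → ∣ w ∣≤ r
    ∣∣-mono    : ∀ {z r s} → r ℝ.≤ s → ∣ z ∣≤ r → ∣ z ∣≤ s
    ∣∣-nonneg  : ∀ {z r} → ∣ z ∣≤ r → ℝ.0# ℝ.≤ r
    ∣∣-+       : ∀ {z w r s} → ∣ z ∣≤ r → ∣ w ∣≤ s → ∣ z + w ∣≤ r ℝ.+ s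
    ∣∣-*       : ∀ {z w r s} → ∣ z ∣≤ r → ∣ w ∣≤ s → ∣ z * w ∣≤ r ℝ.* s
    ∣∣-neg     : ∀ {z r} → ∣ z ∣≤ r → ∣ - z ∣≤ r
    ∣0∣        : ∣ 0# ∣≤ ℝ.0#
    ∣1∣        : ∣ 1# ∣≤ ℝ.1#
    1≤∣1∣      : ∀ {r} → ∣ 1# ∣≤ r → ℝ.1# ℝ.≤ r
    ∣∣-bound   : ∀ z → ∃[ r ] ∣ z ∣≤ r
    separated  : ∀ {z} → (∀ ε → ℝ.0# ℝ.< ε → ∣ z ∣≤ ε) → z ≈ 0#
    -- Reads `|q| ≤ r` off `|w| > 1 / r`, the latter expressed as the failure of an upper bound.
    ∣∣-inverse : ∀ {w q r s} → ℝ.0# ℝ.< r → r ℝ.* s ℝ.≈ ℝ.1# → w * q ≈ 1# →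
                 ¬ (∣ w ∣≤ s) → ∣ q ∣≤ r
    ν          : ℕ → Carrier
    ν-inverse  : ∀ k → ι (suc k) * ν k ≈ 1#
    ∣ν∣        : ∀ k → ∣ ν k ∣≤ ℝ.κ k
    complete   : ∀ (u : ℕ → Carrier) →
                 (∀ ε → ℝ.0# ℝ.< ε → ∃[ N ] ∀ n → ∣ u (N ℕ.+ n) - u N ∣≤ ε) →
                 ∃[ l ] ∀ ε → ℝ.0# ℝ.< ε → ∃[ N ] ∀ n → N ℕ.≤ n → ∣ u n - l ∣≤ ε

-- Limits and dominated series in a valued field.

module Analysis (R : Reals) (V : ValuedField R) where
  open ValuedField V public
  open Sums commutativeRing public
  open IntegerCoefficients commutativeRing public
    using (solve; _:=_; _:+_; _:-_; _:*_; :-_; con)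
  open SemiringExp semiring public using (_^_; ^-homo-*; ^-congˡ)
  open PowersOfOne commutativeRing public
  open CommutativeExp commutativeSemiring public using (^-distrib-*)
  open MonoidMult +-monoid using (×-homo-+)
  open ℝ using (κ; 0<κ; 0≤κ; Null; Summable; half)
  open ℝ.≤-Reasoning

  0ᴿ 1ᴿ : ℝ.Carrier
  0ᴿ = ℝ.0#
  1ᴿ = ℝ.1#

  ∣∣-- : ∀ {z w r s} → ∣ z ∣≤ r → ∣ w ∣≤ s → ∣ z - w ∣≤ r ℝ.+ s
  ∣∣-- ∣z∣ ∣w∣ = ∣∣-+ ∣z∣ (∣∣-neg ∣w∣)

  ∣∣-^ : ∀ {z r} n → ∣ z ∣≤ r → ∣ z ^ n ∣≤ r ℝ.^ n
  ∣∣-^ zero    ∣z∣ = ∣1∣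
  ∣∣-^ (suc n) ∣z∣ = ∣∣-* ∣z∣ (∣∣-^ n ∣z∣)

  ∣ι∣ : ∀ n → ∣ ι n ∣≤ ℝ.fromℕ n
  ∣ι∣ zero    = ∣0∣
  ∣ι∣ (suc n) = ∣∣-+ ∣1∣ (∣ι∣ n)

  ι-+ : ∀ m n → ι (m ℕ.+ n) ≈ ι m + ι n
  ι-+ = ×-homo-+ 1#

  ∣∣-∑ : ∀ {f w} n → (∀ k → ∣ f k ∣≤ w k) → ∣ ∑ n f ∣≤ ℝ.∑ n w
  ∣∣-∑ zero    ∣f∣ = ∣0∣
  ∣∣-∑ (suc n) ∣f∣ = ∣∣-+ (∣∣-∑ n ∣f∣) (∣f∣ n)

  ∣∣-∑-< : ∀ {f w} n → (∀ k → k ℕ.< n → ∣ f k ∣≤ w k) → ∣ ∑ n f ∣≤ ℝ.∑ n w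
  ∣∣-∑-< zero    ∣f∣ = ∣0∣
  ∣∣-∑-< (suc n) ∣f∣ = ∣∣-+ (∣∣-∑-< n (λ k k<n → ∣f∣ k (ℕ.m<n⇒m<1+n k<n))) (∣f∣ n (ℕ.n<1+n n))

  Lim : (ℕ → Carrier) → Carrier → Set
  Lim u l = ∀ ε → 0ᴿ ℝ.< ε → ∃[ N ] ∀ n → N ℕ.≤ n → ∣ u n - l ∣≤ ε

  Lim-cong : ∀ {u v l} → (∀ n → u n ≈ v n) → Lim u l → Lim v l
  Lim-cong {l = l} u≈v u→l ε 0<ε = proj₁ (u→l ε 0<ε) , λ n N≤n →
    ∣∣-resp (+-congʳ {x = - l} (u≈v n)) (proj₂ (u→l ε 0<ε) n N≤n)

  Lim-congˡ : ∀ {u l m} → l ≈ m → Lim u l → Lim u m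
  Lim-congˡ l≈m u→l ε 0<ε = proj₁ (u→l ε 0<ε) , λ n N≤n →
    ∣∣-resp (+-congˡ (-‿cong l≈m)) (proj₂ (u→l ε 0<ε) n N≤n)

  Lim-const : ∀ c → Lim (λ _ → c) c
  Lim-const c ε 0<ε = 0 , λ n _ → ∣∣-resp (sym (-‿inverseʳ c)) (∣∣-mono (ℝ.<⇒≤ 0<ε) ∣0∣)

  Lim-null : ∀ {u l} (e : ℕ → ℝ.Carrier) → Null e → (∀ n → ∣ u n - l ∣≤ e n) → Lim u l
  Lim-null e e→0 ∣u-l∣ ε 0<ε = proj₁ (e→0 ε 0<ε) , λ n N≤n →
    ∣∣-mono (proj₂ (e→0 ε 0<ε) n N≤n) (∣u-l∣ n)

  Lim-+ : ∀ {u v l m} → Lim u l → Lim v m → Lim (λ n → u n + v n) (l + m)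
  Lim-+ {u} {v} {l} {m} u→l v→m ε 0<ε = proj₁ U ℕ.⊔ proj₁ V′ , λ n N≤n →
    ∣∣-mono (ℝ.≤-reflexive (ℝ.half+half ε))
      (∣∣-resp (solve 4 (λ u v l m → (u :- l) :+ (v :- m) := (u :+ v) :- (l :+ m)) refl (u n) (v n) l m)
        (∣∣-+ (proj₂ U n (ℕ.≤-trans (ℕ.m≤m⊔n _ _) N≤n))
              (proj₂ V′ n (ℕ.≤-trans (ℕ.m≤n⊔m _ _) N≤n))))
    where
    U = u→l (half ℝ.* ε) (ℝ.0<half* 0<ε)
    V′ = v→m (half ℝ.* ε) (ℝ.0<half* 0<ε)

  Lim-* : ∀ {u l} c → Lim u l → Lim (λ n → c * u n) (c * l)
  Lim-* {u} {l} c u→l ε 0<ε = proj₁ U , λ n N≤n →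
    ∣∣-mono (K*ε′≤ε)
      (∣∣-resp (solve 3 (λ c u l → c :* (u :- l) := c :* u :- c :* l) refl c (u n) l)
        (∣∣-* ∣c∣ (proj₂ U n N≤n)))
    where
    K = proj₁ (∣∣-bound c)
    ∣c∣ = proj₂ (∣∣-bound c)
    0<1+K : 0ᴿ ℝ.< 1ᴿ ℝ.+ K
    0<1+K = ℝ.<-≤-trans ℝ.0<1 (ℝ.x≤x+y 1ᴿ (∣∣-nonneg ∣c∣))
    ε′ = ℝ.recip 0<1+K ℝ.* ε
    0<ε′ : 0ᴿ ℝ.< ε′
    0<ε′ = ℝ.*-pos (ℝ.0<recip 0<1+K) 0<ε
    K*ε′≤ε : K ℝ.* ε′ ℝ.≤ ε
    K*ε′≤ε = begin
      K ℝ.* ε′             ≤⟨ ℝ.*-monoˡ-≤ (ℝ.<⇒≤ 0<ε′) (ℝ.y≤x+y K ℝ.0≤1) ⟩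
      (1ᴿ ℝ.+ K) ℝ.* ε′    ≈⟨ ℝ.*-recip-cancel 0<1+K ε ⟩
      ε                    ∎
    U = u→l ε′ 0<ε′

  Lim-neg : ∀ {u l} → Lim u l → Lim (λ n → - u n) (- l)
  Lim-neg {u} {l} u→l ε 0<ε = proj₁ (u→l ε 0<ε) , λ n N≤n →
    ∣∣-resp (solve 2 (λ u l → :- (u :- l) := :- u :- :- l) refl (u n) l)
      (∣∣-neg (proj₂ (u→l ε 0<ε) n N≤n))

  Lim-- : ∀ {u v l m} → Lim u l → Lim v m → Lim (λ n → u n - v n) (l - m)
  Lim-- u→l v→m = Lim-+ u→l (Lim-neg v→m)

  Lim-∑ : ∀ J {u : ℕ → ℕ → Carrier} {l : ℕ → Carrier} → (∀ i → Lim (u i) (l i)) →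
          Lim (λ n → ∑ J (λ i → u i n)) (∑ J l)
  Lim-∑ zero    u→l = Lim-const 0#
  Lim-∑ (suc J) u→l = Lim-+ (Lim-∑ J u→l) (u→l J)

  Lim-shift : ∀ {u l} m → Lim u l → Lim (λ n → u (m ℕ.+ n)) l
  Lim-shift m u→l ε 0<ε = proj₁ (u→l ε 0<ε) , λ n N≤n →
    proj₂ (u→l ε 0<ε) (m ℕ.+ n) (ℕ.≤-trans N≤n (ℕ.m≤n+m n m))

  Lim-unsuc : ∀ {u l} → Lim (u ∘ suc) l → Lim u l
  Lim-unsuc u→l ε 0<ε = suc (proj₁ (u→l ε 0<ε)) , λ where
    (suc n) (s≤s N≤n) → proj₂ (u→l ε 0<ε) n N≤n

  Lim-unique : ∀ {u l m} → Lim u l → Lim u m → l ≈ m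
  Lim-unique {u} {l} {m} u→l u→m = trans (solve 2 (λ l m → l := (l :- m) :+ m) refl l m)
      (trans (+-congʳ (separated ∣l-m∣)) (+-identityˡ m))
    where
    ∣l-m∣ : ∀ ε → 0ᴿ ℝ.< ε → ∣ l - m ∣≤ ε
    ∣l-m∣ ε 0<ε = ∣∣-mono (ℝ.≤-reflexive (ℝ.half+half ε))
      (∣∣-resp (solve 3 (λ u l m → (u :- m) :- (u :- l) := l :- m) refl (u n) l m)
        (∣∣-- (proj₂ V′ n (ℕ.m≤n⊔m _ _)) (proj₂ U n (ℕ.m≤m⊔n _ _))))
      where
      U = u→l (half ℝ.* ε) (ℝ.0<half* 0<ε)
      V′ = u→m (half ℝ.* ε) (ℝ.0<half* 0<ε)
      n = proj₁ U ℕ.⊔ proj₁ V′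

  -- The slack `r < s` lets a single index decide: one at which `u` is within `s - r` of `l`.
  Lim-bound : ∀ {u l r s} → Lim u l → (∀ n → ∣ u n ∣≤ r) → r ℝ.< s → ∣ l ∣≤ s
  Lim-bound {u} {l} {r} {s} u→l ∣u∣ r<s =
    ∣∣-mono (ℝ.≤-reflexive (ℝ.sym (ℝ.x+[y-x]≈y r s)))
      (∣∣-resp (solve 2 (λ u l → u :- (u :- l) := l) refl (u N) l) (∣∣-- (∣u∣ N) (proj₂ U N ℕ.≤-refl)))
    where
    U = u→l (s ℝ.- r) (ℝ.0<y-x r<s)
    N = proj₁ U

  module _ {f : ℕ → Carrier} {w : ℕ → ℝ.Carrier} {G : ℝ.Carrier} (w-summable : Summable w)
           (0≤G : 0ᴿ ℝ.≤ G) (∣f∣ : ∀ k → ∣ f k ∣≤ G ℝ.* w k) where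

    dominated-partial : ∀ n → ∣ ∑ n f ∣≤ G ℝ.* Summable.bound w-summable
    dominated-partial n = ∣∣-mono
      (begin
        ℝ.∑ n (λ k → G ℝ.* w k)             ≈⟨ ℝ.∑-*ˡ n G w ⟩
        G ℝ.* ℝ.∑ n w                       ≤⟨ ℝ.*-monoʳ-≤ 0≤G (Summable.bounded w-summable n) ⟩
        G ℝ.* Summable.bound w-summable     ∎)
      (∣∣-∑ n ∣f∣)

    dominated : ∃[ l ] Lim (λ n → ∑ n f) l
    dominated = complete (λ n → ∑ n f) cauchy
      where
      cauchy : ∀ ε → 0ᴿ ℝ.< ε → ∃[ N ] ∀ n → ∣ ∑ (N ℕ.+ n) f - ∑ N f ∣≤ ε
      cauchy ε 0<ε = proj₁ T , λ n → ∣∣-mono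
          (begin
            ℝ.∑ n (λ k → G ℝ.* w (N ℕ.+ k))  ≈⟨ ℝ.∑-*ˡ n G _ ⟩
            G ℝ.* ℝ.∑ n (w ∘ (N ℕ.+_))       ≤⟨ ℝ.*-monoʳ-≤ 0≤G (proj₂ T n) ⟩
            G ℝ.* ε′                         ≤⟨ ℝ.*-monoˡ-≤ (ℝ.<⇒≤ 0<ε′) (ℝ.y≤x+y G ℝ.0≤1) ⟩
            (1ᴿ ℝ.+ G) ℝ.* ε′                ≈⟨ ℝ.*-recip-cancel 0<1+G ε ⟩
            ε                                ∎)
          (∣∣-resp
            (sym (trans (+-congʳ (∑-split N n f))
                        (solve 2 (λ s t → (s :+ t) :- s := t) refl (∑ N f) (∑ n (f ∘ (N ℕ.+_))))))
            (∣∣-∑ n (λ k → ∣f∣ (N ℕ.+ k))))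
        where
        0<1+G : 0ᴿ ℝ.< 1ᴿ ℝ.+ G
        0<1+G = ℝ.<-≤-trans ℝ.0<1 (ℝ.x≤x+y 1ᴿ 0≤G)
        ε′ = ℝ.recip 0<1+G ℝ.* ε
        0<ε′ : 0ᴿ ℝ.< ε′
        0<ε′ = ℝ.*-pos (ℝ.0<recip 0<1+G) 0<ε
        T = Summable.tail w-summable ε′ 0<ε′
        N = proj₁ T

  -- Extends an eventual bound to all indices by adding the bounds of the finitely many exceptions,
  -- the last one first. Adding instead of taking maxima uses only monotonicity and nonnegativity.
  uniform : (P : ℕ → ℝ.Carrier → Set) → (∀ {k r s} → r ℝ.≤ s → P k r → P k s) →
    (∀ {k r} → P k r → 0ᴿ ℝ.≤ r) → (∀ k → ∃[ r ] P k r) →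
    ∀ N {r} → (∀ k → N ℕ.≤ k → P k r) → ∃[ s ] ∀ k → P k s
  uniform P mono nonneg each zero    {r} large = r , λ k → large k z≤n
  uniform P mono nonneg each (suc N) {r} large = uniform P mono nonneg each N larger
    where
    t = proj₁ (each N)
    larger : ∀ k → N ℕ.≤ k → P k (r ℝ.+ t)
    larger k N≤k with suc N ℕ.≤? k
    ... | yes N<k = mono (ℝ.x≤x+y r (nonneg (proj₂ (each N)))) (large k N<k)
    ... | no  N≮k = mono (ℝ.y≤x+y t (nonneg (large (suc N) ℕ.≤-refl)))
      (≡.subst (λ j → P j t) (ℕ.≤-antisym N≤k (ℕ.≤-pred (ℕ.≰⇒> N≮k))) (proj₂ (each N)))

  -- `σ` is a natural number above `1 / (1 - θ)`, the factor by which an inverse can grow when its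
  -- argument is perturbed by the relative amount `θ`.
  gap : ∀ {θ} → θ ℝ.< 1ᴿ → ∃[ σ ] (0ᴿ ℝ.< σ) × (1ᴿ ℝ.+ σ ℝ.* θ ℝ.< σ)
  gap {θ} θ<1 = σ , ℝ.0<fromℕ-suc N , (begin-strict
      1ᴿ ℝ.+ σ ℝ.* θ                         <⟨ ℝ.+-monoˡ-< (σ ℝ.* θ) (proj₂ arch (suc N) (ℕ.n≤1+n N)) ⟩
      σ ℝ.* (1ᴿ ℝ.- θ) ℝ.+ σ ℝ.* θ           ≈⟨ ℝ.solve 2 (λ s t → s ℝ.:* (ℝ.con (+ 1) ℝ.:- t) ℝ.:+ s ℝ.:* t ℝ.:= s) ℝ.refl σ θ ⟩
      σ                                      ∎)
    where
    arch = ℝ.archimedean-* (ℝ.0<y-x θ<1) 1ᴿ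
    N = proj₁ arch
    σ = ℝ.fromℕ (suc N)

  -- |w′| ≥ |w| - |w′ - w|, read off through the inverses q and q′ of w and w′.
  ∣∣-perturbed-inverse : ∀ {w w′ q q′ ρ η θ σ} → 0ᴿ ℝ.< ρ → 0ᴿ ℝ.< σ → 1ᴿ ℝ.+ σ ℝ.* θ ℝ.< σ →
    w * q ≈ 1# → ∣ q ∣≤ ρ → w′ * q′ ≈ 1# → ∣ w′ - w ∣≤ η → η ℝ.* ρ ℝ.≤ θ → ∣ q′ ∣≤ ρ ℝ.* σ
  ∣∣-perturbed-inverse {w} {w′} {q} {q′} {ρ} {η} {θ} {σ} 0<ρ 0<σ 1+σθ<σ wq≈1 ∣q∣ w′q′≈1 ∣w′-w∣ ηρ≤θ =
    ∣∣-inverse 0<ρσ (ℝ.recip-inverse 0<ρσ) w′q′≈1 λ ∣w′∣ → ℝ.<-irrefl ℝ.refl (begin-strict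
      σ                                             ≈⟨ ℝ.*-identityʳ σ ⟨
      σ ℝ.* 1ᴿ                                      ≤⟨ ℝ.*-monoʳ-≤ (ℝ.<⇒≤ 0<σ) (1≤∣1∣ (∣∣-resp wq≈1 (∣∣-* (∣w∣ ∣w′∣) ∣q∣))) ⟩
      σ ℝ.* ((s ℝ.+ η) ℝ.* ρ)
        ≈⟨ ℝ.solve 4 (λ σ s η ρ → σ ℝ.:* ((s ℝ.:+ η) ℝ.:* ρ) ℝ.:= (ρ ℝ.:* σ) ℝ.:* s ℝ.:+ σ ℝ.:* (η ℝ.:* ρ)) ℝ.refl σ s η ρ ⟩
      (ρ ℝ.* σ) ℝ.* s ℝ.+ σ ℝ.* (η ℝ.* ρ)           ≤⟨ ℝ.+-mono-≤ (ℝ.≤-reflexive (ℝ.recip-inverse 0<ρσ)) (ℝ.*-monoʳ-≤ (ℝ.<⇒≤ 0<σ) ηρ≤θ) ⟩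
      1ᴿ ℝ.+ σ ℝ.* θ                                <⟨ 1+σθ<σ ⟩
      σ                                             ∎)
    where
    0<ρσ : 0ᴿ ℝ.< ρ ℝ.* σ
    0<ρσ = ℝ.*-pos 0<ρ 0<σ
    s = ℝ.recip 0<ρσ
    ∣w∣ : ∣ w′ ∣≤ s → ∣ w ∣≤ s ℝ.+ η
    ∣w∣ ∣w′∣ = ∣∣-resp (solve 2 (λ w w′ → w′ :- (w′ :- w) := w) refl w w′) (∣∣-- ∣w′∣ ∣w′-w∣)

-- Resolvents `1 / (k - s)`: bounds and second-order expansion.

module Resolvents (R : Reals) (V : ValuedField R) where
  open Analysis R V public
  open ℝ using (κ; 0<κ; 0≤κ; Null; Summable; half)
  open ℝ.≤-Reasoning

  κ-inverse : ∀ k → ℝ.fromℕ (suc k) ℝ.* κ k ℝ.≈ 1ᴿ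
  κ-inverse k = ℝ.recip-inverse (ℝ.0<fromℕ-suc k)

  κ≤1 : ∀ k → κ k ℝ.≤ 1ᴿ
  κ≤1 k = begin
    κ k                          ≈⟨ ℝ.*-identityˡ (κ k) ⟨
    1ᴿ ℝ.* κ k                   ≤⟨ ℝ.*-monoˡ-≤ (0≤κ k) (ℝ.1≤fromℕ-suc k) ⟩
    ℝ.fromℕ (suc k) ℝ.* κ k      ≈⟨ κ-inverse k ⟩
    1ᴿ                           ∎

  -- Amounts to `m + k + 1 ≤ (m + 1) * (k + 1)`. It pays for a shift of the index with a constant.
  κ-shift : ∀ m k → κ k ℝ.≤ ℝ.fromℕ (suc m) ℝ.* κ (m ℕ.+ k)
  κ-shift m k = begin
    κ k                                                  ≈⟨ ℝ.*-identityʳ (κ k) ⟨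
    κ k ℝ.* 1ᴿ                                           ≈⟨ ℝ.*-congˡ (κ-inverse (m ℕ.+ k)) ⟨
    κ k ℝ.* (ℝ.fromℕ (suc (m ℕ.+ k)) ℝ.* κ (m ℕ.+ k))
      ≤⟨ ℝ.*-monoʳ-≤ (0≤κ k) (ℝ.*-monoˡ-≤ (0≤κ (m ℕ.+ k)) m+k+1≤) ⟩
    κ k ℝ.* ((ℝ.fromℕ (suc m) ℝ.* ℝ.fromℕ (suc k)) ℝ.* κ (m ℕ.+ k))
      ≈⟨ ℝ.solve 4 (λ x m k y → x ℝ.:* ((m ℝ.:* k) ℝ.:* y) ℝ.:= (k ℝ.:* x) ℝ.:* (m ℝ.:* y)) ℝ.refl
           (κ k) (ℝ.fromℕ (suc m)) (ℝ.fromℕ (suc k)) (κ (m ℕ.+ k)) ⟩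
    (ℝ.fromℕ (suc k) ℝ.* κ k) ℝ.* (ℝ.fromℕ (suc m) ℝ.* κ (m ℕ.+ k))   ≈⟨ ℝ.*-congʳ (κ-inverse k) ⟩
    1ᴿ ℝ.* (ℝ.fromℕ (suc m) ℝ.* κ (m ℕ.+ k))             ≈⟨ ℝ.*-identityˡ _ ⟩
    ℝ.fromℕ (suc m) ℝ.* κ (m ℕ.+ k)                      ∎
    where
    m+k+1≤ : ℝ.fromℕ (suc (m ℕ.+ k)) ℝ.≤ ℝ.fromℕ (suc m) ℝ.* ℝ.fromℕ (suc k)
    m+k+1≤ = begin
      ℝ.fromℕ (suc (m ℕ.+ k))               ≤⟨ ℝ.fromℕ-mono-≤ (s≤s (ℕ.≤-trans (ℕ.≤-reflexive (ℕ.+-comm m k)) (ℕ.+-monoʳ-≤ k (ℕ.m≤m*n m (suc k))))) ⟩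
      ℝ.fromℕ (suc m ℕ.* suc k)             ≈⟨ ℝ.fromℕ-* (suc m) (suc k) ⟩
      ℝ.fromℕ (suc m) ℝ.* ℝ.fromℕ (suc k)   ∎

  [Lκ]^[p+2]≤ : ∀ {L} k p → 0ᴿ ℝ.≤ L →
    (L ℝ.* κ k) ℝ.^ suc (suc p) ℝ.≤ L ℝ.^ suc (suc p) ℝ.* (κ k ℝ.* κ k)
  [Lκ]^[p+2]≤ {L} k p 0≤L = begin
    (L ℝ.* κ k) ℝ.^ suc (suc p)                               ≈⟨ ℝ.^-distrib-* L (κ k) (suc (suc p)) ⟩
    L ℝ.^ suc (suc p) ℝ.* (κ k ℝ.* (κ k ℝ.* κ k ℝ.^ p))
      ≤⟨ ℝ.*-monoʳ-≤ (ℝ.^-nonneg (suc (suc p)) 0≤L) (ℝ.*-monoʳ-≤ (0≤κ k)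
           (ℝ.*-monoʳ-≤ (0≤κ k) (ℝ.^≤1 p (0≤κ k) (κ≤1 k)))) ⟩
    L ℝ.^ suc (suc p) ℝ.* (κ k ℝ.* (κ k ℝ.* 1ᴿ))              ≈⟨ ℝ.*-congˡ (ℝ.*-congˡ (ℝ.*-identityʳ (κ k))) ⟩
    L ℝ.^ suc (suc p) ℝ.* (κ k ℝ.* κ k)                       ∎

  IsResolvent : Carrier → (ℕ → Carrier) → Set
  IsResolvent s q = ∀ k → (ι k - s) * q k ≈ 1#

  Bounded : ℝ.Carrier → (ℕ → Carrier) → Set
  Bounded L q = ∀ k → ∣ q k ∣≤ L ℝ.* κ k

  half<1 : half ℝ.< 1ᴿ
  half<1 = ℝ.<-respˡ-≈ (ℝ.*-identityʳ half) (ℝ.half*< ℝ.0<1)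

  σ : ℝ.Carrier
  σ = proj₁ (gap half<1)

  0<σ : 0ᴿ ℝ.< σ
  0<σ = proj₁ (proj₂ (gap half<1))

  -- For large `k`, `k - s` is a perturbation of `k + 1`, whose inverse is `ν k`, by the fixed
  -- amount `- (1 + s)`, which is at most half of `k + 1` in size. The remaining indices are
  -- absorbed by `uniform`.
  resolvent-bound : ∀ {s q} → IsResolvent s q → ∃[ L ] (0ᴿ ℝ.< L) × Bounded L q
  resolvent-bound {s} {q} q-inverse = 1ᴿ ℝ.+ L , ℝ.<-≤-trans ℝ.0<1 (ℝ.x≤x+y 1ᴿ 0≤L) ,
      λ k → ∣∣-mono (ℝ.*-monoˡ-≤ (0≤κ k) (ℝ.y≤x+y L ℝ.0≤1)) (∣q∣ k)
    where
    η = proj₁ (∣∣-bound (- (1# + s)))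
    ∣1+s∣ = proj₂ (∣∣-bound (- (1# + s)))
    arch = ℝ.archimedean-* ℝ.0<half η
    ηκ≤half : ∀ k → proj₁ arch ℕ.≤ k → η ℝ.* κ k ℝ.≤ half
    ηκ≤half k N≤k = begin
      η ℝ.* κ k                                ≤⟨ ℝ.*-monoˡ-≤ (0≤κ k) (ℝ.<⇒≤ (proj₂ arch (suc k) (ℕ.m≤n⇒m≤1+n N≤k))) ⟩
      (ℝ.fromℕ (suc k) ℝ.* half) ℝ.* κ k       ≈⟨ ℝ.solve 3 (λ x h y → (x ℝ.:* h) ℝ.:* y ℝ.:= (x ℝ.:* y) ℝ.:* h) ℝ.refl _ half (κ k) ⟩
      (ℝ.fromℕ (suc k) ℝ.* κ k) ℝ.* half       ≈⟨ ℝ.*-congʳ (κ-inverse k) ⟩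
      1ᴿ ℝ.* half                              ≈⟨ ℝ.*-identityˡ half ⟩
      half                                     ∎
    large : ∀ k → proj₁ arch ℕ.≤ k → ∣ q k ∣≤ σ ℝ.* κ k
    large k N≤k = ∣∣-mono (ℝ.≤-reflexive (ℝ.*-comm (κ k) σ))
      (∣∣-perturbed-inverse (0<κ k) 0<σ (proj₂ (proj₂ (gap half<1))) (ν-inverse k) (∣ν∣ k) (q-inverse k)
        (∣∣-resp (solve 2 (λ n s → :- (con (+ 1) :+ s) := (n :- s) :- (con (+ 1) :+ n)) refl (ι k) s) ∣1+s∣)
        (ηκ≤half k N≤k))
    each : ∀ k → ∃[ r ] ∣ q k ∣≤ r ℝ.* κ k
    each k = proj₁ (∣∣-bound (q k)) ℝ.* ℝ.fromℕ (suc k) , ∣∣-mono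
      (ℝ.≤-reflexive (ℝ.sym (ℝ.trans (ℝ.*-assoc _ _ _) (ℝ.trans (ℝ.*-congˡ (κ-inverse k)) (ℝ.*-identityʳ _)))))
      (proj₂ (∣∣-bound (q k)))
    bounds = uniform (λ k r → ∣ q k ∣≤ r ℝ.* κ k)
      (λ {k} r≤s → ∣∣-mono (ℝ.*-monoˡ-≤ (0≤κ k) r≤s))
      (λ {k} {r} ∣qk∣ → ℝ.*-cancelˡ-≤ (0<κ k)
         (ℝ.≤-trans (ℝ.≤-reflexive (ℝ.zeroʳ (κ k)))
           (ℝ.≤-trans (∣∣-nonneg ∣qk∣) (ℝ.≤-reflexive (ℝ.*-comm r (κ k))))))
      each (proj₁ arch) large
    L = proj₁ bounds
    ∣q∣ = proj₂ bounds
    0≤L : 0ᴿ ℝ.≤ L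
    0≤L = ℝ.*-cancelˡ-≤ (0<κ 0)
         (ℝ.≤-trans (ℝ.≤-reflexive (ℝ.zeroʳ (κ 0)))
           (ℝ.≤-trans (∣∣-nonneg (∣q∣ 0)) (ℝ.≤-reflexive (ℝ.*-comm L (κ 0)))))

  -- Moving `s` by `δ` perturbs every `k - s` by at most half its size, as `1 / |k - s| ≤ L`. One
  -- bound thus serves a whole neighbourhood, which differentiation requires.
  resolvent-bound-near : ∀ {s s′ q q′ L δ} → 0ᴿ ℝ.< L → IsResolvent s q → Bounded L q →
    IsResolvent s′ q′ → ∣ s - s′ ∣≤ δ → δ ℝ.* L ℝ.≤ half → Bounded (L ℝ.* σ) q′
  resolvent-bound-near {s} {s′} {q} {q′} {L} {δ} 0<L q-inverse ∣q∣ q′-inverse ∣s-s′∣ δL≤half k =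
    ∣∣-mono (ℝ.≤-reflexive (ℝ.solve 3 (λ L k s → (L ℝ.:* k) ℝ.:* s ℝ.:= (L ℝ.:* s) ℝ.:* k) ℝ.refl L (κ k) σ))
      (∣∣-perturbed-inverse (ℝ.*-pos 0<L (0<κ k)) 0<σ (proj₂ (proj₂ (gap half<1)))
        (q-inverse k) (∣q∣ k) (q′-inverse k)
        (∣∣-resp (solve 3 (λ n s s′ → s :- s′ := (n :- s′) :- (n :- s)) refl (ι k) s s′) ∣s-s′∣)
        (begin
          δ ℝ.* (L ℝ.* κ k)   ≈⟨ ℝ.*-assoc δ L (κ k) ⟨
          (δ ℝ.* L) ℝ.* κ k   ≤⟨ ℝ.*-monoˡ-≤ (0≤κ k) δL≤half ⟩
          half ℝ.* κ k        ≤⟨ ℝ.*-monoʳ-≤ (ℝ.<⇒≤ ℝ.0<half) (κ≤1 k) ⟩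
          half ℝ.* 1ᴿ         ≈⟨ ℝ.*-identityʳ half ⟩
          half                ∎))

  -- The second difference quotient of q ^ p along q ↦ q′, see power-expansion.
  quotient : Carrier → Carrier → ℕ → Carrier
  quotient q q′ zero    = 0#
  quotient q q′ (suc p) = q′ * (quotient q q′ p + ι (suc p) * q ^ suc (suc p))

  module _ {w w′ q q′ : Carrier} (wq≈1 : w * q ≈ 1#) (w′q′≈1 : w′ * q′ ≈ 1#) where
    private
      h : Carrier
      h = w′ - w

    inverse-difference : q′ - q ≈ - (h * (q * q′))
    inverse-difference = trans
      (+-cong (sym (trans (*-congˡ wq≈1) (*-identityʳ q′))) (-‿cong (sym (trans (*-congˡ w′q′≈1) (*-identityʳ q)))))
      (solve 4 (λ w w′ q q′ → q′ :* (w :* q) :- q :* (w′ :* q′) := :- ((w′ :- w) :* (q :* q′))) refl w w′ q q′)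

    -- The second-order Taylor formula for `w ^ (- p)` with exact remainder. In the induction the
    -- formula for `p` is multiplied by `q′`, and `q′ - q` is replaced by `- (h * (q * q′))`; the
    -- leftover is the recursion of `quotient`.
    power-expansion : ∀ p → (q′ ^ p - q ^ p) + ι p * (h * q ^ suc p) ≈ h * (h * quotient q q′ p)
    power-expansion zero = solve 2 (λ h q → (con (+ 1) :- con (+ 1)) :+ con (+ 0) :* (h :* (q :* con (+ 1)))
      := h :* (h :* con (+ 0))) refl h q
    power-expansion (suc p) = trans step₁ (trans (+-cong (*-congˡ (power-expansion p)) (+-congʳ (*-congʳ inverse-difference))) step₂)
      where
      step₁ = solve 6 (λ q q′ Q Q′ n h →
          (q′ :* Q′ :- q :* Q) :+ (con (+ 1) :+ n) :* (h :* (q :* (q :* Q)))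
            := q′ :* ((Q′ :- Q) :+ n :* (h :* (q :* Q)))
               :+ ((q′ :- q) :* (Q :- (con (+ 1) :+ n) :* (h :* (q :* Q))) :+ (h :* (q :* q′)) :* Q))
        refl q q′ (q ^ p) (q′ ^ p) (ι p) h
      step₂ = solve 6 (λ q q′ Q D n h →
          q′ :* (h :* (h :* D)) :+ ((:- (h :* (q :* q′))) :* (Q :- (con (+ 1) :+ n) :* (h :* (q :* Q))) :+ (h :* (q :* q′)) :* Q)
            := h :* (h :* (q′ :* (D :+ (con (+ 1) :+ n) :* (q :* (q :* Q))))))
        refl q q′ (q ^ p) (quotient q q′ p) (ι p) h

  -- The triangular number `p * (p + 1) / 2`, which is the second Taylor coefficient of `w ^ (- p)`
  -- at `w = 1`.
  quotientBound : ℕ → ℝ.Carrier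
  quotientBound zero    = 0ᴿ
  quotientBound (suc p) = quotientBound p ℝ.+ ℝ.fromℕ (suc p)

  0≤quotientBound : ∀ p → 0ᴿ ℝ.≤ quotientBound p
  0≤quotientBound zero    = ℝ.≤-refl
  0≤quotientBound (suc p) = ℝ.0≤-+ (0≤quotientBound p) (ℝ.0≤fromℕ (suc p))

  ∣quotient∣ : ∀ {q q′ Q} → ∣ q ∣≤ Q → ∣ q′ ∣≤ Q → ∀ p →
    ∣ quotient q q′ p ∣≤ quotientBound p ℝ.* Q ℝ.^ suc (suc p)
  ∣quotient∣ {Q = Q} ∣q∣ ∣q′∣ zero    = ∣∣-mono (ℝ.≤-reflexive (ℝ.sym (ℝ.zeroˡ _))) ∣0∣
  ∣quotient∣ {Q = Q} ∣q∣ ∣q′∣ (suc p) = ∣∣-mono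
    (ℝ.≤-reflexive (ℝ.solve 4 (λ Q P c n → Q ℝ.:* (c ℝ.:* P ℝ.:+ n ℝ.:* P) ℝ.:= (c ℝ.:+ n) ℝ.:* (Q ℝ.:* P)) ℝ.refl
      Q (Q ℝ.^ suc (suc p)) (quotientBound p) (ℝ.fromℕ (suc p))))
    (∣∣-* ∣q′∣ (∣∣-+ (∣quotient∣ ∣q∣ ∣q′∣ p) (∣∣-* (∣ι∣ (suc p)) (∣∣-^ (suc (suc p)) ∣q∣))))

-- Taylor expansion of resolvent powers to finite order.

module Taylor (R : Reals) (V : ValuedField R) where
  open Resolvents R V public
  open ℝ using (Null)

  ι-pascal : ∀ J p → ι (suc (J ℕ.+ p) C suc p) ≈ ι (binomial p J) + ι ((J ℕ.+ p) C suc p)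
  ι-pascal J p = trans (reflexive (≡.cong ι (≡.sym (nCk+nC[k+1]≡[n+1]C[k+1] (J ℕ.+ p) p))))
    (ι-+ (binomial p J) ((J ℕ.+ p) C suc p))

  -- The resolvent identity `1 / (m - y) = 1 / m + y / (m * (m - y))`, in the form that iterates to
  -- the geometric series.
  resolvent-recurrence : ∀ {m v y q} → m * v ≈ 1# → (m - y) * q ≈ 1# → q ≈ v + y * (v * q)
  resolvent-recurrence {m} {v} {y} {q} mv≈1 [m-y]q≈1 = trans
    (sym (trans (*-congʳ mv≈1) (*-identityˡ q)))
    (trans (solve 4 (λ m v y q → (m :* v) :* q := v :* ((m :- y) :* q) :+ y :* (v :* q)) refl m v y q)
      (+-congʳ (trans (*-congˡ [m-y]q≈1) (*-identityʳ v))))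

  -- The `i`-th term of `1 / (m - x) ^ (p + 1)` expanded at `x = 0`, where `v = 1 / m`.
  taylorTerm : Carrier → Carrier → ℕ → ℕ → Carrier
  taylorTerm x v p i = ι (binomial p i) * (x ^ i * v ^ suc (i ℕ.+ p))

  -- Multiplying the expansion of q ^ suc p by q = v + x v q and using Pascal's
  -- rule yields the expansion of q ^ suc (suc p).
  remainder : Carrier → Carrier → Carrier → ℕ → ℕ → Carrier
  remainder x v q J zero    = q * (x * v) ^ J
  remainder x v q J (suc p) =
    q * (remainder x v q J p + ι ((J ℕ.+ p) C suc p) * ((x * v) ^ J * v ^ suc p))

  module _ {x v q : Carrier} (q≈v+xvq : q ≈ v + x * (v * q)) where
    private
      taylor-zero : ∀ J → q ^ 1 ≈ ∑ J (taylorTerm x v 0) + q * (x * v) ^ J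
      taylor-zero zero    = sym (+-identityˡ _)
      taylor-zero (suc J) = trans (taylor-zero J) (trans (+-congˡ last) (sym (+-assoc _ _ _)))
        where
        X = x ^ J
        last : q * (x * v) ^ J ≈ taylorTerm x v 0 J + q * (x * v) ^ suc J
        last = trans (*-cong q≈v+xvq (^-distrib-* x v J))
          (trans (solve 5 (λ x v q X V → (v :+ x :* (v :* q)) :* (X :* V)
                    := (con (+ 1) :+ con (+ 0)) :* (X :* (v :* V)) :+ q :* ((x :* v) :* (X :* V))) refl x v q X (v ^ J))
            (+-cong (*-congˡ (*-congˡ (reflexive (≡.cong (λ j → v ^ suc j) (≡.sym (ℕ.+-identityʳ J))))))
                    (*-congˡ (*-congˡ (sym (^-distrib-* x v J))))))

      power-merge : ∀ J p → (x * v) ^ J * v ^ suc p ≈ x ^ J * v ^ suc (J ℕ.+ p)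
      power-merge J p = trans (*-congʳ (^-distrib-* x v J)) (trans (*-assoc _ _ _)
        (*-congˡ (trans (sym (^-homo-* v J (suc p))) (reflexive (≡.cong (v ^_) (ℕ.+-suc J p))))))

      -- An induction on `J` with a carry: the pending coefficient `b` is joined by the new `c`,
      -- Pascal's rule evaluates `c + b`, and writing `q` as `v + x * (v * q)` splits off the
      -- finished term and passes the rest on.
      multiply : ∀ p J → q * ∑ J (taylorTerm x v p) ≈
        ∑ J (taylorTerm x v (suc p)) + q * (ι ((J ℕ.+ p) C suc p) * ((x * v) ^ J * v ^ suc p))
      -- With no terms yet there is nothing to carry, in agreement with `p C suc p` being zero.
      multiply p zero = trans (solve 2 (λ q y → q :* con (+ 0) := con (+ 0) :+ q :* (con (+ 0) :* y)) refl q _)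
        (+-congˡ (*-congˡ (*-congʳ (reflexive (≡.cong ι (≡.sym (k>n⇒nCk≡0 (ℕ.n<1+n p))))))))
      multiply p (suc J) = induction-step
        where
        X = x ^ J
        U = v ^ suc (J ℕ.+ p)
        b = ι ((J ℕ.+ p) C suc p)
        c = ι (binomial p J)
        T = ∑ J (taylorTerm x v p)
        T′ = ∑ J (taylorTerm x v (suc p))
        open ≈-Reasoning setoid
        term : (c + b) * (X * (v * U)) ≈ taylorTerm x v (suc p) J
        term = *-cong (trans (sym (ι-pascal J p)) (reflexive (≡.cong (λ j → ι (j C suc p)) (≡.sym (ℕ.+-suc J p)))))
                      (*-congˡ (reflexive (≡.cong (λ j → v ^ suc j) (≡.sym (ℕ.+-suc J p)))))
        rest : (c + b) * ((x * v) * (X * U)) ≈ ι (suc (J ℕ.+ p) C suc p) * ((x * v) ^ suc J * v ^ suc p)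
        rest = *-cong (sym (ι-pascal J p)) (trans (*-congˡ (sym (power-merge J p))) (sym (*-assoc _ _ _)))
        induction-step : q * (T + c * (X * U)) ≈
          (T′ + taylorTerm x v (suc p) J) + q * (ι (suc (J ℕ.+ p) C suc p) * ((x * v) ^ suc J * v ^ suc p))
        induction-step = begin
          q * (T + c * (X * U))                                 ≈⟨ distribˡ q T _ ⟩
          q * T + q * (c * (X * U))                             ≈⟨ +-congʳ (multiply p J) ⟩
          (T′ + q * (b * ((x * v) ^ J * v ^ suc p))) + q * (c * (X * U))
            ≈⟨ +-congʳ (+-congˡ (*-congˡ (*-congˡ (power-merge J p)))) ⟩
          (T′ + q * (b * (X * U))) + q * (c * (X * U))
            ≈⟨ solve 5 (λ T q b c Y → (T :+ q :* (b :* Y)) :+ q :* (c :* Y) := T :+ q :* ((c :+ b) :* Y)) refl T′ q b c (X * U) ⟩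
          T′ + q * ((c + b) * (X * U))                          ≈⟨ +-congˡ (*-congʳ q≈v+xvq) ⟩
          T′ + (v + x * (v * q)) * ((c + b) * (X * U))
            ≈⟨ solve 7 (λ T x v q d X U → T :+ (v :+ x :* (v :* q)) :* (d :* (X :* U))
                 := (T :+ d :* (X :* (v :* U))) :+ q :* (d :* ((x :* v) :* (X :* U)))) refl T′ x v q (c + b) X U ⟩
          (T′ + (c + b) * (X * (v * U))) + q * ((c + b) * ((x * v) * (X * U)))
            ≈⟨ +-cong (+-congˡ term) (*-congˡ rest) ⟩
          (T′ + taylorTerm x v (suc p) J) + q * (ι (suc (J ℕ.+ p) C suc p) * ((x * v) ^ suc J * v ^ suc p)) ∎

    taylor : ∀ p J → q ^ suc p ≈ ∑ J (taylorTerm x v p) + remainder x v q J p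
    taylor zero    J = taylor-zero J
    taylor (suc p) J = trans (*-congˡ (taylor p J)) (trans (distribˡ q _ _)
      (trans (+-congʳ (multiply p J)) (trans (+-assoc _ _ _)
        (+-congˡ (trans (+-comm _ _) (sym (distribˡ q _ _)))))))

  open ℝ.≤-Reasoning

  -- The coefficient `(J + p) C suc p` of `remainder` is enlarged to `binomial (suc p) J`, whose
  -- product with `θ ^ J` is already known to tend to 0.
  remainderBound : ℝ.Carrier → ℝ.Carrier → ℕ → ℕ → ℝ.Carrier
  remainderBound L θ zero    J = L ℝ.* θ ℝ.^ J
  remainderBound L θ (suc p) J =
    L ℝ.* (remainderBound L θ p J ℝ.+ ℝ.fromℕ (binomial (suc p) J) ℝ.* θ ℝ.^ J)

  module _ {L θ : ℝ.Carrier} (0≤L : 0ᴿ ℝ.≤ L) (0≤θ : 0ᴿ ℝ.≤ θ) where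

    0≤remainderBound : ∀ p J → 0ᴿ ℝ.≤ remainderBound L θ p J
    0≤remainderBound zero    J = ℝ.*-nonneg 0≤L (ℝ.^-nonneg J 0≤θ)
    0≤remainderBound (suc p) J = ℝ.*-nonneg 0≤L (ℝ.0≤-+ (0≤remainderBound p J)
      (ℝ.*-nonneg (ℝ.0≤fromℕ (binomial (suc p) J)) (ℝ.^-nonneg J 0≤θ)))

    Null-remainderBound : θ ℝ.< 1ᴿ → ∀ p → Null (remainderBound L θ p)
    Null-remainderBound θ<1 zero    = ℝ.Null-* L 0≤L (ℝ.Null-^ 0≤θ θ<1)
    Null-remainderBound θ<1 (suc p) =
      ℝ.Null-* L 0≤L (ℝ.Null-+ (Null-remainderBound θ<1 p) (ℝ.Null-binomial 0≤θ θ<1 (suc p)))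

    module _ {x v q : Carrier} {r : ℝ.Carrier} (0≤r : 0ᴿ ℝ.≤ r) (r≤1 : r ℝ.≤ 1ᴿ)
             (∣x∣ : ∣ x ∣≤ θ) (∣v∣ : ∣ v ∣≤ r) (∣q∣ : ∣ q ∣≤ L ℝ.* r) where

      ∣[xv]^[J+1]∣ : ∀ J → ∣ (x * v) ^ suc J ∣≤ θ ℝ.^ suc J ℝ.* r
      ∣[xv]^[J+1]∣ J = ∣∣-mono (begin
        (θ ℝ.* r) ℝ.^ suc J              ≈⟨ ℝ.^-distrib-* θ r (suc J) ⟩
        θ ℝ.^ suc J ℝ.* (r ℝ.* r ℝ.^ J)  ≤⟨ ℝ.*-monoʳ-≤ (ℝ.^-nonneg (suc J) 0≤θ) (ℝ.*-monoʳ-≤ 0≤r (ℝ.^≤1 J 0≤r r≤1)) ⟩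
        θ ℝ.^ suc J ℝ.* (r ℝ.* 1ᴿ)       ≈⟨ ℝ.*-congˡ (ℝ.*-identityʳ r) ⟩
        θ ℝ.^ suc J ℝ.* r                ∎) (∣∣-^ (suc J) (∣∣-* ∣x∣ ∣v∣))

      -- The order is at least 1, so `q` and the power of `x * v` contribute a factor `r` each. With
      -- `r = κ k` this is the decay that the summable majorant needs.
      ∣remainder∣ : ∀ p J → ∣ remainder x v q (suc J) p ∣≤ remainderBound L θ p (suc J) ℝ.* (r ℝ.* r)
      ∣remainder∣ zero J = ∣∣-mono
        (ℝ.≤-reflexive (ℝ.solve 3 (λ L r t → (L ℝ.:* r) ℝ.:* (t ℝ.:* r) ℝ.:= (L ℝ.:* t) ℝ.:* (r ℝ.:* r)) ℝ.refl L r (θ ℝ.^ suc J)))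
        (∣∣-* ∣q∣ (∣[xv]^[J+1]∣ J))
      ∣remainder∣ (suc p) J = ∣∣-mono
        (begin
          (L ℝ.* r) ℝ.* (τ ℝ.* (r ℝ.* r) ℝ.+ b ℝ.* ((t ℝ.* r) ℝ.* (r ℝ.* r ℝ.^ p)))
            ≤⟨ ℝ.*-monoʳ-≤ (ℝ.*-nonneg 0≤L 0≤r) (ℝ.+-monoʳ-≤ (τ ℝ.* (r ℝ.* r)) second) ⟩
          (L ℝ.* r) ℝ.* (τ ℝ.* (r ℝ.* r) ℝ.+ B ℝ.* ((t ℝ.* r) ℝ.* (r ℝ.* 1ᴿ)))
            ≈⟨ ℝ.solve 5 (λ L r τ B t → (L ℝ.:* r) ℝ.:* (τ ℝ.:* (r ℝ.:* r) ℝ.:+ B ℝ.:* ((t ℝ.:* r) ℝ.:* (r ℝ.:* ℝ.con (+ 1))))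
                 ℝ.:= r ℝ.:* ((L ℝ.:* (τ ℝ.:+ B ℝ.:* t)) ℝ.:* (r ℝ.:* r))) ℝ.refl L r τ B t ⟩
          r ℝ.* (remainderBound L θ (suc p) (suc J) ℝ.* (r ℝ.* r))
            ≤⟨ ℝ.*-monoˡ-≤ (ℝ.*-nonneg (0≤remainderBound (suc p) (suc J)) (ℝ.0≤x² r)) r≤1 ⟩
          1ᴿ ℝ.* (remainderBound L θ (suc p) (suc J) ℝ.* (r ℝ.* r))   ≈⟨ ℝ.*-identityˡ _ ⟩
          remainderBound L θ (suc p) (suc J) ℝ.* (r ℝ.* r)            ∎)
        (∣∣-* ∣q∣ (∣∣-+ (∣remainder∣ p J)
          (∣∣-* (∣ι∣ ((suc J ℕ.+ p) C suc p)) (∣∣-* (∣[xv]^[J+1]∣ J) (∣∣-^ (suc p) ∣v∣)))))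
        where
        τ = remainderBound L θ p (suc J)
        t = θ ℝ.^ suc J
        b = ℝ.fromℕ ((suc J ℕ.+ p) C suc p)
        B = ℝ.fromℕ (binomial (suc p) (suc J))
        b≤B : b ℝ.≤ B
        b≤B = ℝ.fromℕ-mono-≤ (ℕ.≤-trans
          (ℕ.≤-reflexive (≡.cong (_C suc p) (≡.sym (ℕ.+-suc J p))))
          (ℕ.≤-trans (ℕ.m≤n+m _ (binomial p (suc J))) (ℕ.≤-reflexive (≡.sym (binomial-suc p J)))))
        0≤tr : 0ᴿ ℝ.≤ t ℝ.* r
        0≤tr = ℝ.*-nonneg (ℝ.^-nonneg (suc J) 0≤θ) 0≤r
        second : b ℝ.* ((t ℝ.* r) ℝ.* (r ℝ.* r ℝ.^ p)) ℝ.≤ B ℝ.* ((t ℝ.* r) ℝ.* (r ℝ.* 1ᴿ))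
        second = ℝ.*-mono-≤ (ℝ.0≤fromℕ (binomial (suc p) (suc J)))
          (ℝ.*-nonneg 0≤tr (ℝ.*-nonneg 0≤r (ℝ.^-nonneg p 0≤r))) b≤B
          (ℝ.*-monoʳ-≤ 0≤tr (ℝ.*-monoʳ-≤ 0≤r (ℝ.^≤1 p 0≤r r≤1)))

-- The series `Y_p` and its derivative in `s`.

record Coefficients (R : Reals) (V : ValuedField R) : Set where
  open ValuedField V
  field
    a            : ℕ → Carrier
    W            : ℕ → ℝ.Carrier
    ∣a∣          : ∀ k → ∣ a k ∣≤ W k
    Null-κW      : ℝ.Null λ k → ℝ.κ k ℝ.* W k
    Summable-κκW : ℝ.Summable λ k → ℝ.κ k ℝ.* (ℝ.κ k ℝ.* W k)

module Series (R : Reals) (V : ValuedField R) (coefficients : Coefficients R V) where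
  open Taylor R V public
  open Coefficients coefficients public
  open ℝ using (κ; 0<κ; 0≤κ; Null; Summable; half)
  open ℝ.≤-Reasoning

  Small : (ℕ → Carrier) → ℝ.Carrier → Set
  Small g G = ∀ k → ∣ g k ∣≤ G ℝ.* (κ k ℝ.* κ k)

  ∣ag∣ : ∀ {g G} → Small g G → ∀ k → ∣ a k * g k ∣≤ G ℝ.* (κ k ℝ.* (κ k ℝ.* W k))
  ∣ag∣ {g} {G} g-small k = ∣∣-mono (ℝ.≤-reflexive
    (ℝ.solve 3 (λ w g k → w ℝ.:* (g ℝ.:* (k ℝ.:* k)) ℝ.:= g ℝ.:* (k ℝ.:* (k ℝ.:* w))) ℝ.refl (W k) G (κ k)))
    (∣∣-* (∣a∣ k) (g-small k))

  series : ∀ {g G} → 0ᴿ ℝ.≤ G → Small g G → ∃[ l ] Lim (λ n → ∑ n (λ k → a k * g k)) l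
  series 0≤G g-small = dominated Summable-κκW 0≤G (∣ag∣ g-small)

  -- The correction a k/k in Ψ, with the exponent shifted: only the simple
  -- poles, p = 0, need it.
  reg : ℕ → ℕ → Carrier
  reg zero    zero    = 0#
  reg zero    (suc k) = ν k
  reg (suc p) k       = 0#

  -- Powers from the second on have the required decay by themselves. For `p = 0` the correction
  -- supplies it, because `1 / (k - s) - 1 / k = s / (k * (k - s))`.
  resolvent-small : ∀ {s q L} → IsResolvent s q → 0ᴿ ℝ.< L → Bounded L q → ∀ p →
    ∃[ G ] (0ᴿ ℝ.≤ G) × Small (λ k → q k ^ suc p - reg p k) G
  resolvent-small {s} {q} {L} q-inverse 0<L ∣q∣ (suc p) =
    L ℝ.^ suc (suc p) , ℝ.^-nonneg (suc (suc p)) (ℝ.<⇒≤ 0<L) , λ k →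
      ∣∣-mono ([Lκ]^[p+2]≤ k p (ℝ.<⇒≤ 0<L))
        (∣∣-resp (solve 1 (λ x → x := x :- con (+ 0)) refl _) (∣∣-^ (suc (suc p)) (∣q∣ k)))
  resolvent-small {s} {q} {L} q-inverse 0<L ∣q∣ zero = G , 0≤G , small
    where
    S = proj₁ (∣∣-bound s)
    ∣s∣ = proj₂ (∣∣-bound s)
    0≤LS : 0ᴿ ℝ.≤ L ℝ.* (S ℝ.* ℝ.2#)
    0≤LS = ℝ.*-nonneg (ℝ.<⇒≤ 0<L) (ℝ.*-nonneg (∣∣-nonneg ∣s∣) (ℝ.<⇒≤ ℝ.0<2))
    G = L ℝ.+ L ℝ.* (S ℝ.* ℝ.2#)
    0≤G : 0ᴿ ℝ.≤ G
    0≤G = ℝ.0≤-+ (ℝ.<⇒≤ 0<L) 0≤LS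
    κ0≈1 : κ 0 ℝ.≈ 1ᴿ
    κ0≈1 = ℝ.trans (ℝ.sym (ℝ.*-identityˡ (κ 0)))
      (ℝ.trans (ℝ.*-congʳ (ℝ.sym (ℝ.+-identityʳ 1ᴿ))) (κ-inverse 0))
    small : Small (λ k → q k ^ 1 - reg 0 k) G
    -- There is no correction at index 0, but `κ 0` is 1 and no decay is asked for.
    small zero = ∣∣-mono
      (begin
        L ℝ.* κ 0             ≤⟨ ℝ.*-monoˡ-≤ (0≤κ 0) (ℝ.x≤x+y L 0≤LS) ⟩
        G ℝ.* κ 0             ≈⟨ ℝ.*-congˡ (ℝ.trans (ℝ.*-congʳ κ0≈1) (ℝ.*-identityˡ (κ 0))) ⟨
        G ℝ.* (κ 0 ℝ.* κ 0)   ∎)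
      (∣∣-resp (solve 1 (λ q → q := q :* con (+ 1) :- con (+ 0)) refl (q 0)) (∣q∣ 0))
    small (suc j) = ∣∣-mono
      (begin
        (L ℝ.* κ (suc j)) ℝ.* (S ℝ.* κ j)
          ≤⟨ ℝ.*-monoʳ-≤ (ℝ.*-nonneg (ℝ.<⇒≤ 0<L) (0≤κ (suc j))) (ℝ.*-monoʳ-≤ (∣∣-nonneg ∣s∣) (κ-shift 1 j)) ⟩
        (L ℝ.* κ (suc j)) ℝ.* (S ℝ.* (ℝ.fromℕ 2 ℝ.* κ (suc j)))
          ≈⟨ ℝ.solve 3 (λ L S k → (L ℝ.:* k) ℝ.:* (S ℝ.:* ((ℝ.con (+ 1) ℝ.:+ (ℝ.con (+ 1) ℝ.:+ ℝ.con (+ 0))) ℝ.:* k))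
               ℝ.:= (L ℝ.:* (S ℝ.:* ℝ.con (+ 2))) ℝ.:* (k ℝ.:* k)) ℝ.refl L S (κ (suc j)) ⟩
        (L ℝ.* (S ℝ.* ℝ.2#)) ℝ.* (κ (suc j) ℝ.* κ (suc j))
          ≤⟨ ℝ.*-monoˡ-≤ (ℝ.0≤x² (κ (suc j))) (ℝ.y≤x+y _ (ℝ.<⇒≤ 0<L)) ⟩
        G ℝ.* (κ (suc j) ℝ.* κ (suc j)) ∎)
      (∣∣-resp (sym difference) (∣∣-* (∣q∣ (suc j)) (∣∣-* ∣s∣ (∣ν∣ j))))
      where
      difference : q (suc j) ^ 1 - ν j ≈ q (suc j) * (s * ν j)
      difference = trans
        (+-cong (sym (trans (*-congʳ (ν-inverse j)) (*-identityˡ _)))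
                (-‿cong (sym (trans (*-congˡ (q-inverse (suc j))) (*-identityʳ (ν j))))))
        (solve 4 (λ n v s q → (n :* v) :* (q :* con (+ 1)) :- v :* ((n :- s) :* q) := q :* (s :* v)) refl
          (ι (suc j)) (ν j) s (q (suc j)))

  -- The series for (-1)^(p+1) Ψ^(p)/p! when q k = 1/(k - s).
  IsY : ℕ → (ℕ → Carrier) → Carrier → Set
  IsY p q = Lim λ n → ∑ n λ k → a k * (q k ^ suc p - reg p k)

  Y : ∀ {s q} → IsResolvent s q → ∀ p → ∃[ y ] IsY p q y
  Y {s} {q} q-inverse p = series (proj₁ (proj₂ G)) (proj₂ (proj₂ G))
    where
    L = resolvent-bound q-inverse
    G = resolvent-small q-inverse (proj₁ (proj₂ L)) (proj₂ (proj₂ L)) p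

  private
    ∑-expansion : ∀ {f f′ f₊ x : ℕ → Carrier} {c h} → (∀ k → (f′ k - f k) + c * (h * f₊ k) ≈ h * (h * x k)) →
      ∀ n → (∑ n f′ - ∑ n f) + c * (h * ∑ n f₊) ≈ h * (h * ∑ n x)
    ∑-expansion {c = c} {h} eq zero = solve 2 (λ c h →
      (con (+ 0) :- con (+ 0)) :+ c :* (h :* con (+ 0)) := h :* (h :* con (+ 0))) refl c h
    ∑-expansion {f} {f′} {f₊} {x} {c} {h} eq (suc n) = trans
      (solve 8 (λ S′ S T f′ f t c h → ((S′ :+ f′) :- (S :+ f)) :+ c :* (h :* (T :+ t))
          := ((S′ :- S) :+ c :* (h :* T)) :+ ((f′ :- f) :+ c :* (h :* t))) refl
        (∑ n f′) (∑ n f) (∑ n f₊) (f′ n) (f n) (f₊ n) c h)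
      (trans (+-cong (∑-expansion eq n) (eq n))
        (solve 3 (λ X x h → h :* (h :* X) :+ h :* (h :* x) := h :* (h :* (X :+ x))) refl (∑ n x) (x n) h))

  module _ {s s′ : Carrier} {q q′ : ℕ → Carrier} (q-inverse : IsResolvent s q) (q′-inverse : IsResolvent s′ q′) (p : ℕ) where
    private
      h : Carrier
      h = s - s′
      x : ℕ → Carrier
      x k = quotient (q k) (q′ k) (suc p)
      f f′ f₊ : ℕ → Carrier
      f  k = a k * (q k ^ suc p - reg p k)
      f′ k = a k * (q′ k ^ suc p - reg p k)
      f₊ k = a k * (q k ^ suc (suc p) - 0#)
      difference : ∀ k → (ι k - s′) - (ι k - s) ≈ h
      difference k = solve 3 (λ n s s′ → (n :- s′) :- (n :- s) := s :- s′) refl (ι k) s s′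
      expansion : ∀ k → (q′ k ^ suc p - q k ^ suc p) + ι (suc p) * (h * q k ^ suc (suc p)) ≈ h * (h * x k)
      expansion k = trans (+-congˡ (*-congˡ (*-congʳ (sym (difference k)))))
        (trans (power-expansion (q-inverse k) (q′-inverse k) (suc p))
          (*-cong (difference k) (*-congʳ (difference k))))
      termwise : ∀ k → (f′ k - f k) + ι (suc p) * (h * f₊ k) ≈ h * (h * (a k * x k))
      termwise k = trans
        (solve 7 (λ a P′ P r n h P₊ → (a :* (P′ :- r) :- a :* (P :- r)) :+ n :* (h :* (a :* (P₊ :- con (+ 0))))
            := a :* ((P′ :- P) :+ n :* (h :* P₊))) refl
          (a k) (q′ k ^ suc p) (q k ^ suc p) (reg p k) (ι (suc p)) h (q k ^ suc (suc p)))
        (trans (*-congˡ (expansion k))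
          (solve 3 (λ a h x → a :* (h :* (h :* x)) := h :* (h :* (a :* x))) refl (a k) h (x k)))

    Y-quotient-small : ∀ {L} → 0ᴿ ℝ.≤ L → Bounded L q → Bounded L q′ →
      Small (λ k → quotient (q k) (q′ k) (suc p)) (quotientBound (suc p) ℝ.* L ℝ.^ suc (suc (suc p)))
    Y-quotient-small 0≤L ∣q∣ ∣q′∣ k = ∣∣-mono
        (ℝ.≤-trans (ℝ.*-monoʳ-≤ (0≤quotientBound (suc p)) ([Lκ]^[p+2]≤ k (suc p) 0≤L))
                   (ℝ.≤-reflexive (ℝ.sym (ℝ.*-assoc _ _ _))))
        (∣quotient∣ (∣q∣ k) (∣q′∣ k) (suc p))

    -- Both sides are limits of the same finite sums, by the power expansion applied termwise; the
    -- corrections cancel in the difference.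
    Y-difference : ∀ {y y′ y₊ X} → IsY p q y → IsY p q′ y′ → IsY (suc p) q y₊ →
      Lim (λ n → ∑ n (λ k → a k * quotient (q k) (q′ k) (suc p))) X →
      (y′ - y) + ι (suc p) * ((s - s′) * y₊) ≈ (s - s′) * ((s - s′) * X)
    Y-difference {y} {y′} {y₊} {X} →y →y′ →y₊ →X = Lim-unique lhs rhs
      where
      u : ℕ → Carrier
      u n = (∑ n f′ - ∑ n f) + ι (suc p) * (h * ∑ n f₊)
      lhs : Lim u ((y′ - y) + ι (suc p) * (h * y₊))
      lhs = Lim-+ (Lim-- →y′ →y) (Lim-* (ι (suc p)) (Lim-* h →y₊))
      rhs : Lim u (h * (h * X))
      rhs = Lim-cong (λ n → sym (∑-expansion termwise n)) (Lim-* h (Lim-* h →X))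

  -- `B` depends on `L` and `p` alone. This uniformity in both points is what allows `δ` to be fixed
  -- before the second point is given.
  Y-expansion : ∀ {L} → 0ᴿ ℝ.≤ L → ∀ p → ∃[ B ] (0ᴿ ℝ.≤ B) × (∀ {s s′ q q′ y y′ y₊} →
    IsResolvent s q → IsResolvent s′ q′ → Bounded L q → Bounded L q′ →
    IsY p q y → IsY p q′ y′ → IsY (suc p) q y₊ →
    ∃[ X ] ∣ X ∣≤ B × (y′ - y) + ι (suc p) * ((s - s′) * y₊) ≈ (s - s′) * ((s - s′) * X))
  Y-expansion {L} 0≤L p = B , 0≤B , expand
    where
    G = quotientBound (suc p) ℝ.* L ℝ.^ suc (suc (suc p))
    0≤G : 0ᴿ ℝ.≤ G
    0≤G = ℝ.*-nonneg (0≤quotientBound (suc p)) (ℝ.^-nonneg (suc (suc (suc p))) 0≤L)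
    GS = G ℝ.* Summable.bound Summable-κκW
    -- The added 1 is the strict slack for `Lim-bound`.
    B = GS ℝ.+ 1ᴿ
    0≤GS : 0ᴿ ℝ.≤ GS
    0≤GS = ℝ.*-nonneg 0≤G (Summable.bounded Summable-κκW 0)
    0≤B : 0ᴿ ℝ.≤ B
    0≤B = ℝ.0≤-+ 0≤GS ℝ.0≤1
    GS<B : GS ℝ.< B
    GS<B = ℝ.<-by-diff 1ᴿ ℝ.0<1 ℝ.refl
    expand : ∀ {s s′ q q′ y y′ y₊} →
      IsResolvent s q → IsResolvent s′ q′ → Bounded L q → Bounded L q′ →
      IsY p q y → IsY p q′ y′ → IsY (suc p) q y₊ →
      ∃[ X ] ∣ X ∣≤ B × (y′ - y) + ι (suc p) * ((s - s′) * y₊) ≈ (s - s′) * ((s - s′) * X)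
    expand q-inverse q′-inverse ∣q∣ ∣q′∣ →y →y′ →y₊ =
      proj₁ X , Lim-bound (proj₂ X) (dominated-partial Summable-κκW 0≤G (∣ag∣ small)) GS<B ,
      Y-difference q-inverse q′-inverse p →y →y′ →y₊ (proj₂ X)
      where
      small = Y-quotient-small q-inverse q′-inverse p 0≤L ∣q∣ ∣q′∣
      X = series 0≤G small

  private
    -- Division of the second-order expansion by `h`, with `i = 1 / h`: the error of the difference
    -- quotient is `c * (h * X)`, which is linear in `h`.
    quotient-identity : ∀ {h i g n c c₊ X Y y y′} → h * i ≈ 1# → g ≈ h →
      (y′ - y) + n * (g * Y) ≈ g * (g * X) → c₊ ≈ - (n * c) →
      (c * y′ - c * y) * i - c₊ * Y ≈ c * (h * X)
    quotient-identity {h} {i} {g} {n} {c} {c₊} {X} {Y} {y} {y′} hi≈1 g≈h expansion c₊≈ = trans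
      (+-congˡ (-‿cong (trans (*-congʳ c₊≈) (sym (trans (*-congˡ hi≈1) (*-identityʳ _))))))
      (trans (solve 7 (λ c y′ y i n h Y → (c :* y′ :- c :* y) :* i :- (:- (n :* c) :* Y) :* (h :* i)
          := c :* (i :* ((y′ :- y) :+ n :* (h :* Y)))) refl c y′ y i n h Y)
        (*-congˡ (trans (*-congˡ (trans (+-congˡ (*-congˡ (*-congʳ (sym g≈h)))) (trans expansion (*-cong g≈h (*-congʳ g≈h)))))
          (trans (solve 3 (λ i h X → i :* (h :* (h :* X)) := (h :* i) :* (h :* X)) refl i h X)
            (trans (*-congʳ hi≈1) (*-identityˡ _))))))

  -- In the variable z = - s, the derivative of Y p is - (p + 1) Y (p + 1).
  Y-derivative : ∀ {s q c c₊} p → IsResolvent s q → c₊ ≈ - (ι (suc p) * c) → ∀ ε → 0ᴿ ℝ.< ε →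
    ∃[ δ ] (0ᴿ ℝ.< δ) × (∀ {s′ q′ h i y y′ y₊} → IsResolvent s′ q′ → h * i ≈ 1# → s - s′ ≈ h → ∣ h ∣≤ δ →
      IsY p q y → IsY p q′ y′ → IsY (suc p) q y₊ → ∣ (c * y′ - c * y) * i - c₊ * y₊ ∣≤ ε)
  Y-derivative {s} {q} {c} {c₊} p q-inverse c₊≈ ε 0<ε = δ , 0<δ , estimate
    where
    bounds = resolvent-bound q-inverse
    L = proj₁ bounds
    0<L : 0ᴿ ℝ.< L
    0<L = proj₁ (proj₂ bounds)
    ∣q∣ : Bounded L q
    ∣q∣ = proj₂ (proj₂ bounds)
    Bs = Y-expansion (ℝ.<⇒≤ (ℝ.*-pos 0<L 0<σ)) p
    B = proj₁ Bs
    K = proj₁ (∣∣-bound c)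
    ∣c∣ : ∣ c ∣≤ K
    ∣c∣ = proj₂ (∣∣-bound c)
    0≤KB : 0ᴿ ℝ.≤ K ℝ.* B
    0≤KB = ℝ.*-nonneg (∣∣-nonneg ∣c∣) (proj₁ (proj₂ Bs))
    -- With `δ = 1 / (2 * T)`, the first summand gives `δ * L ≤ 1/2`, which keeps the resolvent
    -- bound, and the second gives `K * (δ * B) ≤ ε`. The sum replaces a maximum.
    T = L ℝ.+ (K ℝ.* B) ℝ.* ℝ.recip 0<ε
    0≤KB/ε : 0ᴿ ℝ.≤ (K ℝ.* B) ℝ.* ℝ.recip 0<ε
    0≤KB/ε = ℝ.*-nonneg 0≤KB (ℝ.<⇒≤ (ℝ.0<recip 0<ε))
    0<T : 0ᴿ ℝ.< T
    0<T = ℝ.<-≤-trans 0<L (ℝ.x≤x+y L 0≤KB/ε)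
    δ = half ℝ.* ℝ.recip 0<T
    0<δ : 0ᴿ ℝ.< δ
    0<δ = ℝ.0<half* (ℝ.0<recip 0<T)
    δT≈half : δ ℝ.* T ℝ.≈ half
    δT≈half = ℝ.trans (ℝ.solve 3 (λ h r t → (h ℝ.:* r) ℝ.:* t ℝ.:= h ℝ.:* (t ℝ.:* r)) ℝ.refl half (ℝ.recip 0<T) T)
      (ℝ.trans (ℝ.*-congˡ (ℝ.recip-inverse 0<T)) (ℝ.*-identityʳ half))
    δL≤half : δ ℝ.* L ℝ.≤ half
    δL≤half = begin
      δ ℝ.* L   ≤⟨ ℝ.*-monoʳ-≤ (ℝ.<⇒≤ 0<δ) (ℝ.x≤x+y L 0≤KB/ε) ⟩
      δ ℝ.* T   ≈⟨ δT≈half ⟩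
      half      ∎
    KδB≤ε : K ℝ.* (δ ℝ.* B) ℝ.≤ ε
    KδB≤ε = begin
      K ℝ.* (δ ℝ.* B)                               ≈⟨ ℝ.*-recip-cancel 0<ε _ ⟨
      ε ℝ.* (ℝ.recip 0<ε ℝ.* (K ℝ.* (δ ℝ.* B)))
        ≈⟨ ℝ.solve 5 (λ e r k d b → e ℝ.:* (r ℝ.:* (k ℝ.:* (d ℝ.:* b))) ℝ.:= (d ℝ.:* ((k ℝ.:* b) ℝ.:* r)) ℝ.:* e) ℝ.refl
             ε (ℝ.recip 0<ε) K δ B ⟩
      (δ ℝ.* ((K ℝ.* B) ℝ.* ℝ.recip 0<ε)) ℝ.* ε     ≤⟨ ℝ.*-monoˡ-≤ (ℝ.<⇒≤ 0<ε) (ℝ.*-monoʳ-≤ (ℝ.<⇒≤ 0<δ) (ℝ.y≤x+y _ (ℝ.<⇒≤ 0<L))) ⟩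
      (δ ℝ.* T) ℝ.* ε                               ≤⟨ ℝ.*-monoˡ-≤ (ℝ.<⇒≤ 0<ε) (ℝ.≤-trans (ℝ.≤-reflexive δT≈half) (ℝ.<⇒≤ half<1)) ⟩
      1ᴿ ℝ.* ε                                      ≈⟨ ℝ.*-identityˡ ε ⟩
      ε                                             ∎
    estimate : ∀ {s′ q′ h i y y′ y₊} → IsResolvent s′ q′ → h * i ≈ 1# → s - s′ ≈ h → ∣ h ∣≤ δ →
      IsY p q y → IsY p q′ y′ → IsY (suc p) q y₊ → ∣ (c * y′ - c * y) * i - c₊ * y₊ ∣≤ ε
    estimate q′-inverse hi≈1 s-s′≈h ∣h∣ →y →y′ →y₊ = ∣∣-mono KδB≤ε
      (∣∣-resp (sym (quotient-identity hi≈1 s-s′≈h (proj₂ (proj₂ X)) c₊≈)) (∣∣-* ∣c∣ (∣∣-* ∣h∣ (proj₁ (proj₂ X)))))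
      where
      near : ∀ {s′ q′} → IsResolvent s′ q′ → ∣ s - s′ ∣≤ δ → Bounded (L ℝ.* σ) q′
      near q′-inverse ∣s-s′∣ = resolvent-bound-near 0<L q-inverse ∣q∣ q′-inverse ∣s-s′∣ δL≤half
      X = proj₂ (proj₂ Bs) q-inverse q′-inverse
        (near q-inverse (∣∣-resp (sym (-‿inverseʳ s)) (∣∣-mono (ℝ.<⇒≤ 0<δ) ∣0∣)))
        (near q′-inverse (∣∣-resp (sym s-s′≈h) ∣h∣)) →y →y′ →y₊

-- Expansion of `Y_p` around `s = n`.

module Expansion (R : Reals) (V : ValuedField R) (coefficients : Coefficients R V)
  {s : ValuedField.Carrier V} {q : ℕ → ValuedField.Carrier V} (q-inverse : Resolvents.IsResolvent R V s q) (n : ℕ) where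
  open Series R V coefficients public
  open ℝ using (κ; 0<κ; 0≤κ; Null; Summable; half)

  x : Carrier
  x = s - ι n

  weight : ℕ → ℕ → Carrier
  weight p i = ι (binomial p i) * x ^ i

  weight⁻ : ℕ → ℕ → Carrier
  weight⁻ p i = ι (binomial p i) * (- x) ^ i

  -- Here p stands for the exponent p + 1, and k for the summation index k + 1.
  E : ℕ → Carrier
  E p = ∑ n λ k → a (n ℕ.∸ suc k) * ν k ^ suc p

  FTerm : ℕ → ℕ → Carrier
  FTerm p k = a (suc n ℕ.+ k) * ν k ^ suc p - a (suc k) * reg p (suc k)

  private
    -- `G` pairs the terms of `Y` beyond `n` with the corrections at the unshifted index, as in
    -- `F_n(1)`, whereas `f` pairs terms and corrections of equal index.
    u e f G : ℕ → ℕ → Carrier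
    u p k = a k * q k ^ suc p
    e p k = a k * reg p k
    f p k = a k * (q k ^ suc p - reg p k)
    G p k = a (suc n ℕ.+ k) * q (suc n ℕ.+ k) ^ suc p - a (suc k) * reg p (suc k)

    a*0≈0 : ∀ k → a k * 0# ≈ 0#
    a*0≈0 k = zeroʳ (a k)

    -- For `p = 0` this is `a_k / k → 0`, a consequence of `κ * W → 0`.
    Lim-e : ∀ p → Lim (λ k → e p (suc k)) 0#
    Lim-e zero = Lim-null (λ k → ℝ.2# ℝ.* (κ (suc k) ℝ.* W (suc k)))
      (ℝ.Null-* ℝ.2# (ℝ.<⇒≤ ℝ.0<2) (ℝ.Null-suc Null-κW)) λ k → ∣∣-mono
        (begin
          W (suc k) ℝ.* κ k                                ≤⟨ ℝ.*-monoʳ-≤ (∣∣-nonneg (∣a∣ (suc k))) (κ-shift 1 k) ⟩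
          W (suc k) ℝ.* (ℝ.fromℕ 2 ℝ.* κ (suc k))
            ≈⟨ ℝ.solve 2 (λ w k → w ℝ.:* ((ℝ.con (+ 1) ℝ.:+ (ℝ.con (+ 1) ℝ.:+ ℝ.con (+ 0))) ℝ.:* k)
                 ℝ.:= ℝ.con (+ 2) ℝ.:* (k ℝ.:* w)) ℝ.refl (W (suc k)) (κ (suc k)) ⟩
          ℝ.2# ℝ.* (κ (suc k) ℝ.* W (suc k))               ∎)
        (∣∣-resp (solve 1 (λ y → y := y :- con (+ 0)) refl _) (∣∣-* (∣a∣ (suc k)) (∣ν∣ k)))
      where open ℝ.≤-Reasoning
    Lim-e (suc p) = Lim-cong (λ k → sym (a*0≈0 (suc k))) (Lim-const 0#)

    Lim-shifted-e : ∀ p i → Lim (λ N → e p (suc N ℕ.+ i)) 0#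
    Lim-shifted-e p i = Lim-cong (λ N → reflexive (≡.cong (λ j → e p (suc j)) (ℕ.+-comm i N))) (Lim-shift i (Lim-e p))

    e-zero : ∀ p → e p 0 ≈ 0#
    e-zero zero    = a*0≈0 0
    e-zero (suc p) = a*0≈0 0

    -- Re-indexing the corrections changes their partial sum by the `n` boundary terms with indices
    -- `N + 1` to `N + n`, since `e p 0` vanishes. These disappear in the limit.
    ∑G : ∀ p N → ∑ N (G p) ≈
      (∑ (suc n ℕ.+ N) (f p) - ∑ (suc n) (u p)) + ∑ n (λ i → e p (suc N ℕ.+ i))
    ∑G p N = trans (∑-- N (u p ∘ (suc n ℕ.+_)) (e p ∘ suc)) (trans
      (solve 4 (λ U′ U E E′ → U′ :- E := ((U :+ U′) :- (con (+ 0) :+ E :+ E′) :- U) :+ E′) refl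
        (∑ N (u p ∘ (suc n ℕ.+_))) (∑ (suc n) (u p)) (∑ N (e p ∘ suc)) (∑ n (λ i → e p (suc N ℕ.+ i))))
      (+-congʳ (+-congʳ (sym total))))
      where
      total : ∑ (suc n ℕ.+ N) (f p) ≈ (∑ (suc n) (u p) + ∑ N (u p ∘ (suc n ℕ.+_)))
        - (0# + ∑ N (e p ∘ suc) + ∑ n (λ i → e p (suc N ℕ.+ i)))
      total = trans (∑-cong (suc n ℕ.+ N) (λ k → solve 3 (λ a q r → a :* (q :- r) := a :* q :- a :* r) refl (a k) (q k ^ suc p) (reg p k)))
        (trans (∑-- (suc n ℕ.+ N) (u p) (e p))
          (+-cong (∑-split (suc n) N (u p))
            (-‿cong (trans (reflexive (≡.cong (λ m → ∑ (suc m) (e p)) (ℕ.+-comm n N)))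
              (trans (∑-split (suc N) n (e p))
                (+-congʳ (trans (∑-first N (e p)) (+-congʳ (e-zero p)))))))))

  H : ∀ p → Carrier → Carrier
  H p y = y - ∑ (suc n) (λ k → a k * q k ^ suc p)

  Lim-G : ∀ p {y} → IsY p q y → Lim (λ N → ∑ N (G p)) (H p y)
  Lim-G p →y = Lim-congˡ (trans (+-congˡ (∑-0 n)) (+-identityʳ _))
    (Lim-cong (λ N → sym (∑G p N))
      (Lim-+ (Lim-- (Lim-shift (suc n) →y) (Lim-const _)) (Lim-∑ n (Lim-shifted-e p))))

  open ℝ.≤-Reasoning

  private
    bounds = resolvent-bound q-inverse
    L : ℝ.Carrier
    L = proj₁ bounds
    0<L : 0ᴿ ℝ.< L
    0<L = proj₁ (proj₂ bounds)
    ∣q∣ : Bounded L q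
    ∣q∣ = proj₂ (proj₂ bounds)

    -- The constant of `κ-shift (suc n)`.
    D : ℝ.Carrier
    D = ℝ.fromℕ (suc (suc n))

    0≤D : 0ᴿ ℝ.≤ D
    0≤D = ℝ.0≤fromℕ (suc (suc n))

    w : ℕ → ℝ.Carrier
    w k = κ k ℝ.* (κ k ℝ.* W k)

    0≤w : ∀ k → 0ᴿ ℝ.≤ w k
    0≤w k = ℝ.*-nonneg (0≤κ k) (ℝ.*-nonneg (0≤κ k) (∣∣-nonneg (∣a∣ k)))

    Summable-w : Summable (λ k → w (suc n ℕ.+ k))
    Summable-w = ℝ.Summable-shift (suc n) 0≤w Summable-κκW

    ∣shifted-ag∣ : ∀ {g K} → 0ᴿ ℝ.≤ K → Small g K → ∀ k →
      ∣ a (suc n ℕ.+ k) * g k ∣≤ (K ℝ.* (D ℝ.* D)) ℝ.* w (suc n ℕ.+ k)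
    ∣shifted-ag∣ {g} {K} 0≤K small k = ∣∣-mono
      (begin
        W j ℝ.* (K ℝ.* (κ k ℝ.* κ k))
          ≤⟨ ℝ.*-monoʳ-≤ (∣∣-nonneg (∣a∣ j)) (ℝ.*-monoʳ-≤ 0≤K
               (ℝ.*-mono-≤ (ℝ.*-nonneg 0≤D (0≤κ j)) (0≤κ k) (κ-shift (suc n) k) (κ-shift (suc n) k))) ⟩
        W j ℝ.* (K ℝ.* ((D ℝ.* κ j) ℝ.* (D ℝ.* κ j)))
          ≈⟨ ℝ.solve 4 (λ w c d k → w ℝ.:* (c ℝ.:* ((d ℝ.:* k) ℝ.:* (d ℝ.:* k)))
               ℝ.:= (c ℝ.:* (d ℝ.:* d)) ℝ.:* (k ℝ.:* (k ℝ.:* w))) ℝ.refl (W j) K D (κ j) ⟩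
        (K ℝ.* (D ℝ.* D)) ℝ.* w j ∎)
      (∣∣-* (∣a∣ j) (small k))
      where
      j = suc n ℕ.+ k

    rem : ℕ → ℕ → ℕ → Carrier
    rem J p k = remainder x (ν k) (q (suc n ℕ.+ k)) J p

    -- Since `(n + 1 + k) - s = (k + 1) - x`, the resolvent beyond `n` is expanded in `x` with
    -- `v = 1 / (k + 1)`.
    recurrence : ∀ k → q (suc n ℕ.+ k) ≈ ν k + x * (ν k * q (suc n ℕ.+ k))
    recurrence k = resolvent-recurrence (ν-inverse k) (trans (*-congʳ shift) (q-inverse (suc n ℕ.+ k)))
      where
      shift : ι (suc k) - x ≈ ι (suc n ℕ.+ k) - s
      shift = sym (trans (+-congʳ (trans (reflexive (≡.cong ι (≡.sym (ℕ.+-suc n k)))) (ι-+ n (suc k))))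
        (solve 3 (λ n k s → (n :+ k) :- s := k :- (s :- n)) refl (ι n) (ι (suc k)) s))

    ∣q-shifted∣ : ∀ k → ∣ q (suc n ℕ.+ k) ∣≤ L ℝ.* κ k
    ∣q-shifted∣ k = ∣∣-mono (ℝ.*-monoʳ-≤ (ℝ.<⇒≤ 0<L) (κ-antitone k)) (∣q∣ (suc n ℕ.+ k))
      where
      κ-antitone : ∀ k → κ (suc n ℕ.+ k) ℝ.≤ κ k
      κ-antitone k = begin
        κ j                                       ≈⟨ ℝ.*-identityˡ (κ j) ⟨
        1ᴿ ℝ.* κ j                                ≈⟨ ℝ.*-congʳ (κ-inverse k) ⟨
        (ℝ.fromℕ (suc k) ℝ.* κ k) ℝ.* κ j
          ≤⟨ ℝ.*-monoˡ-≤ (0≤κ j) (ℝ.*-monoˡ-≤ (0≤κ k) (ℝ.fromℕ-mono-≤ (s≤s (ℕ.m≤n+m k (suc n))))) ⟩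
        (ℝ.fromℕ (suc j) ℝ.* κ k) ℝ.* κ j
          ≈⟨ ℝ.solve 3 (λ n k j → (n ℝ.:* k) ℝ.:* j ℝ.:= (n ℝ.:* j) ℝ.:* k) ℝ.refl (ℝ.fromℕ (suc j)) (κ k) (κ j) ⟩
        (ℝ.fromℕ (suc j) ℝ.* κ j) ℝ.* κ k         ≈⟨ ℝ.*-congʳ (κ-inverse j) ⟩
        1ᴿ ℝ.* κ k                                ≈⟨ ℝ.*-identityˡ (κ k) ⟩
        κ k                                       ∎
        where
        j = suc n ℕ.+ k

  module _ {θ : ℝ.Carrier} (0≤θ : 0ᴿ ℝ.≤ θ) (∣x∣ : ∣ x ∣≤ θ) where
    private
      0≤L : 0ᴿ ℝ.≤ L
      0≤L = ℝ.<⇒≤ 0<L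

      rem-small : ∀ J p → Small (rem (suc J) p) (remainderBound L θ p (suc J))
      rem-small J p k = ∣remainder∣ 0≤L 0≤θ (0≤κ k) (κ≤1 k) ∣x∣ (∣ν∣ k) (∣q-shifted∣ k) p J

      0≤bound : ∀ p J → 0ᴿ ℝ.≤ remainderBound L θ p J ℝ.* (D ℝ.* D)
      0≤bound p J = ℝ.*-nonneg (0≤remainderBound 0≤L 0≤θ p J) (ℝ.0≤x² D)

      ∣a·rem∣ : ∀ J p k → ∣ a (suc n ℕ.+ k) * rem (suc J) p k ∣≤
        (remainderBound L θ p (suc J) ℝ.* (D ℝ.* D)) ℝ.* w (suc n ℕ.+ k)
      ∣a·rem∣ J p = ∣shifted-ag∣ (0≤remainderBound 0≤L 0≤θ p (suc J)) (rem-small J p)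

      -- For `i > 0` the correction `reg (i + p)` is zero, and `weight p 0` is 1.
      weighted-reg : ∀ p J k → ∑ (suc J) (λ i → weight p i * (a (suc k) * reg (i ℕ.+ p) (suc k))) ≈ a (suc k) * reg p (suc k)
      weighted-reg p J k = trans (∑-first J _)
        (trans (+-cong (trans (*-congʳ (trans (*-identityʳ _) (trans (reflexive (≡.cong ι (nCn≡1 p))) (+-identityʳ 1#)))) (*-identityˡ _))
                       (trans (∑-cong J (λ i → trans (*-congˡ (a*0≈0 (suc k))) (zeroʳ _))) (∑-0 J)))
          (+-identityʳ _))

      G-expansion : ∀ p J k → G p k - ∑ (suc J) (λ i → weight p i * FTerm (i ℕ.+ p) k)
        ≈ a (suc n ℕ.+ k) * rem (suc J) p k
      G-expansion p J k = trans
        (+-cong (+-congʳ (*-congˡ (taylor (recurrence k) p (suc J)))) (-‿cong weighted-F))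
        (solve 4 (λ A T r B → (A :* (T :+ r) :- B) :- (A :* T :- B) := A :* r) refl
          A T (rem (suc J) p k) (a (suc k) * reg p (suc k)))
        where
        A = a (suc n ℕ.+ k)
        T = ∑ (suc J) (taylorTerm x (ν k) p)
        weighted-F : ∑ (suc J) (λ i → weight p i * FTerm (i ℕ.+ p) k) ≈ A * T - a (suc k) * reg p (suc k)
        weighted-F = trans
          (∑-cong (suc J) (λ i → solve 5 (λ c X A v B → (c :* X) :* (A :* v :- B) := A :* (c :* (X :* v)) :- (c :* X) :* B)
            refl (ι (binomial p i)) (x ^ i) A (ν k ^ suc (i ℕ.+ p)) (a (suc k) * reg (i ℕ.+ p) (suc k))))
          (trans (∑-- (suc J) _ _) (+-cong (∑-*ˡ (suc J) A _) (-‿cong (weighted-reg p J k))))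

    -- At order 1 the only Taylor weight is 1, so `FTerm p` is `G p` minus a remainder. The first
    -- part converges with `Y`, perhaps conditionally, and the second is dominated.
    F : ∀ p → ∃[ φ ] Lim (λ N → ∑ N (FTerm p)) φ
    F p = _ , Lim-cong (λ N → trans (sym (∑-- N _ _)) (∑-cong N single))
        (Lim-- (Lim-G p (proj₂ (Y q-inverse p))) (proj₂ (dominated Summable-w (0≤bound p 1) (∣a·rem∣ 0 p))))
      where
      single : ∀ k → G p k - a (suc n ℕ.+ k) * rem 1 p k ≈ FTerm p k
      single k = trans (+-congˡ (-‿cong (sym (G-expansion p 0 k))))
        (trans (solve 3 (λ g b F → g :- (g :- (con (+ 0) :+ b :* F)) := b :* F) refl (G p k) (weight p 0) (FTerm p k))
          (trans (*-congʳ (trans (*-identityʳ _) (trans (reflexive (≡.cong ι (nCn≡1 p))) (+-identityʳ 1#)))) (*-identityˡ _)))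

    module _ (p : ℕ) {y : Carrier} (→y : IsY p q y) where
      private
        S : ℝ.Carrier
        S = Summable.bound Summable-w

        tail-difference : ℕ → Carrier
        tail-difference J = H p y - ∑ J (λ i → weight p i * proj₁ (F (i ℕ.+ p)))

        -- The sum over `k` of the Taylor remainders, weighted by `a`, converges to this difference.
        -- The summand `half ^ suc J` is the slack for `Lim-bound`, chosen positive and tending to
        -- 0.
        ∣tail-difference∣ : ∀ J → ∣ tail-difference (suc J) ∣≤
          (D ℝ.* D ℝ.* S) ℝ.* remainderBound L θ p (suc J) ℝ.+ half ℝ.^ suc J
        ∣tail-difference∣ J = Lim-bound limit (dominated-partial Summable-w (0≤bound p (suc J)) (∣a·rem∣ J p)) bound<
          where
          limit : Lim (λ N → ∑ N (λ k → a (suc n ℕ.+ k) * rem (suc J) p k)) (tail-difference (suc J))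
          limit = Lim-cong (λ N → trans (+-congˡ (-‿cong (sym (∑-swap N (suc J) (weight p) (λ i → FTerm (i ℕ.+ p))))))
                      (trans (sym (∑-- N (G p) _)) (∑-cong N (G-expansion p J))))
            (Lim-- (Lim-G p →y) (Lim-∑ (suc J) (λ i → Lim-* (weight p i) (proj₂ (F (i ℕ.+ p))))))
          bound< : (remainderBound L θ p (suc J) ℝ.* (D ℝ.* D)) ℝ.* S ℝ.<
            (D ℝ.* D ℝ.* S) ℝ.* remainderBound L θ p (suc J) ℝ.+ half ℝ.^ suc J
          bound< = ℝ.<-by-diff (half ℝ.^ suc J) (ℝ.^-pos (suc J) ℝ.0<half)
            (ℝ.+-congʳ (ℝ.solve 3 (λ r d S → (d ℝ.:* S) ℝ.:* r ℝ.:= (r ℝ.:* d) ℝ.:* S) ℝ.refl (remainderBound L θ p (suc J)) (D ℝ.* D) S))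

        -- Below `n` the sum is reversed and `q` negated: with `m = n - (k + 1)`,
        -- `- q m = 1 / ((k + 1) - (- x))`, so the same Taylor formula applies with `- x` for `x`.
        q⁻ : ℕ → Carrier
        q⁻ k = - q (n ℕ.∸ suc k)

        ι-reverse : ∀ {k} → k ℕ.< n → ι n ≈ ι (n ℕ.∸ suc k) + ι (suc k)
        ι-reverse {k} k<n = trans (reflexive (≡.cong ι (≡.sym (ℕ.m∸n+n≡m k<n)))) (ι-+ (n ℕ.∸ suc k) (suc k))

        recurrence⁻ : ∀ k → k ℕ.< n → q⁻ k ≈ ν k + (- x) * (ν k * q⁻ k)
        recurrence⁻ k k<n = resolvent-recurrence (ν-inverse k)
          (trans (*-congʳ (+-congˡ (-‿cong (-‿cong (+-congˡ (-‿cong (ι-reverse k<n)))))))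
            (trans (solve 4 (λ k s m q → (k :- (:- (s :- (m :+ k)))) :* (:- q) := (m :- s) :* q) refl
                (ι (suc k)) s (ι (n ℕ.∸ suc k)) (q (n ℕ.∸ suc k)))
              (q-inverse (n ℕ.∸ suc k))))

        -- Reversal destroys the decay in `k`, but `1 ≤ n * κ k` for the finitely many `k < n`.
        L⁻ : ℝ.Carrier
        L⁻ = L ℝ.* ℝ.fromℕ n

        0≤L⁻ : 0ᴿ ℝ.≤ L⁻
        0≤L⁻ = ℝ.*-nonneg 0≤L (ℝ.0≤fromℕ n)

        ∣q⁻∣ : ∀ k → k ℕ.< n → ∣ q⁻ k ∣≤ L⁻ ℝ.* κ k
        ∣q⁻∣ k k<n = ∣∣-mono
          (begin
            L ℝ.* κ m                              ≤⟨ ℝ.*-monoʳ-≤ 0≤L (κ≤1 m) ⟩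
            L ℝ.* 1ᴿ                               ≈⟨ ℝ.*-congˡ (κ-inverse k) ⟨
            L ℝ.* (ℝ.fromℕ (suc k) ℝ.* κ k)        ≤⟨ ℝ.*-monoʳ-≤ 0≤L (ℝ.*-monoˡ-≤ (0≤κ k) (ℝ.fromℕ-mono-≤ k<n)) ⟩
            L ℝ.* (ℝ.fromℕ n ℝ.* κ k)              ≈⟨ ℝ.*-assoc L (ℝ.fromℕ n) (κ k) ⟨
            L⁻ ℝ.* κ k                             ∎)
          (∣∣-neg (∣q∣ m))
          where m = n ℕ.∸ suc k

        rem⁻ : ℕ → ℕ → Carrier
        rem⁻ J k = remainder (- x) (ν k) (q⁻ k) J p

        W⁻ : ℝ.Carrier
        W⁻ = ℝ.∑ n (λ k → W (n ℕ.∸ suc k))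

        head : Carrier
        head = ∑ n (λ k → a (n ℕ.∸ suc k) * q⁻ k ^ suc p)

        head-difference : ℕ → Carrier
        head-difference J = head - ∑ J (λ i → weight⁻ p i * E (i ℕ.+ p))

        head-expansion : ∀ J → ∑ n (λ k → a (n ℕ.∸ suc k) * rem⁻ J k) ≈ head-difference J
        head-expansion J = trans (∑-cong-< n termwise) (trans (∑-- n _ _)
          (+-congˡ (-‿cong (∑-swap n J (weight⁻ p) (λ i k → a (n ℕ.∸ suc k) * ν k ^ suc (i ℕ.+ p))))))
          where
          termwise : ∀ k → k ℕ.< n → a (n ℕ.∸ suc k) * rem⁻ J k ≈
            a (n ℕ.∸ suc k) * q⁻ k ^ suc p - ∑ J (λ i → weight⁻ p i * (a (n ℕ.∸ suc k) * ν k ^ suc (i ℕ.+ p)))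
          termwise k k<n = sym (trans
            (+-cong (*-congˡ (taylor (recurrence⁻ k k<n) p J))
              (-‿cong (trans (∑-cong J (λ i → solve 4 (λ c X A v → (c :* X) :* (A :* v) := A :* (c :* (X :* v))) refl
                  (ι (binomial p i)) ((- x) ^ i) A (ν k ^ suc (i ℕ.+ p))))
                (∑-*ˡ J A _))))
            (solve 3 (λ A T r → A :* (T :+ r) :- A :* T := A :* r) refl A (∑ J (taylorTerm (- x) (ν k) p)) (rem⁻ J k)))
            where A = a (n ℕ.∸ suc k)

        ∣head-difference∣ : ∀ J → ∣ head-difference (suc J) ∣≤ W⁻ ℝ.* remainderBound L⁻ θ p (suc J)
        ∣head-difference∣ J = ∣∣-mono
          (ℝ.≤-reflexive (ℝ.trans (ℝ.∑-cong n (λ k → ℝ.*-comm _ _)) (ℝ.trans (ℝ.∑-*ˡ n _ _) (ℝ.*-comm _ W⁻))))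
          (∣∣-resp (head-expansion (suc J)) (∣∣-∑-< n (λ k k<n → ∣∣-* (∣a∣ (n ℕ.∸ suc k)) (∣rem⁻∣ k k<n))))
          where
          τ = remainderBound L⁻ θ p (suc J)
          ∣rem⁻∣ : ∀ k → k ℕ.< n → ∣ rem⁻ (suc J) k ∣≤ τ
          ∣rem⁻∣ k k<n = ∣∣-mono
            (begin
              τ ℝ.* (κ k ℝ.* κ k)  ≤⟨ ℝ.*-monoʳ-≤ (0≤remainderBound 0≤L⁻ 0≤θ p (suc J))
                                        (ℝ.*-mono-≤ ℝ.0≤1 (0≤κ k) (κ≤1 k) (κ≤1 k)) ⟩
              τ ℝ.* (1ᴿ ℝ.* 1ᴿ)    ≈⟨ ℝ.trans (ℝ.*-congˡ (ℝ.*-identityˡ 1ᴿ)) (ℝ.*-identityʳ τ) ⟩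
              τ                    ∎)
            (∣remainder∣ 0≤L⁻ 0≤θ (0≤κ k) (κ≤1 k) (∣∣-neg ∣x∣) (∣ν∣ k) (∣q⁻∣ k k<n) p J)

        sign : ℕ → Carrier
        sign = (- 1#) ^_

        neg-^ : ∀ z m → (- z) ^ m ≈ sign m * z ^ m
        neg-^ z m = trans (^-congˡ m (solve 1 (λ z → :- z := (:- con (+ 1)) :* z) refl z)) (^-distrib-* (- 1#) z m)

        sign² : ∀ i → sign i * sign i ≈ 1#
        sign² zero    = *-identityˡ 1#
        sign² (suc i) = trans (solve 1 (λ s → (:- con (+ 1) :* s) :* (:- con (+ 1) :* s) := s :* s) refl (sign i)) (sign² i)

      -- The summand of the theorem at `j = i + 1`, with `p + 1` for `p`.
      term : ℕ → Carrier
      term i = ((sign (suc i) * ι (binomial p i)) * (E (i ℕ.+ p) + sign (suc (i ℕ.+ p)) * proj₁ (F (i ℕ.+ p)))) * x ^ suc (i ℕ.+ p)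

      -- The theorem's identity solved for its series, `(-1) ^ (p + 1) * y` being the normalised
      -- derivative of `Ψ`.
      total : Carrier
      total = a n - x ^ suc p * (sign (suc p) * y)

      private
        -- `- q n` is the inverse of `x`, because `ι n - s = - x`.
        pole : x ^ suc p * (sign (suc p) * (a n * q n ^ suc p)) ≈ a n
        pole = trans (solve 4 (λ X s a Q → X :* (s :* (a :* Q)) := a :* (X :* (s :* Q))) refl _ _ _ _)
          (trans (*-congˡ (trans (*-congˡ (sym (neg-^ (q n) (suc p))))
            (trans (sym (^-distrib-* x (- q n) (suc p))) (trans (^-congˡ (suc p) x[-q]≈1) (1^n≈1 (suc p))))))
            (*-identityʳ (a n)))
          where
          x[-q]≈1 : x * (- q n) ≈ 1#
          x[-q]≈1 = trans (solve 3 (λ s n q → (s :- n) :* (:- q) := (n :- s) :* q) refl s (ι n) (q n)) (q-inverse n)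

        head≈ : sign (suc p) * ∑ n (u p) ≈ head
        head≈ = trans (*-congˡ (∑-reverse n (u p))) (trans (sym (∑-*ˡ n _ _))
          (∑-cong n (λ k → trans (solve 3 (λ s a Q → s :* (a :* Q) := a :* (s :* Q)) refl _ _ _)
            (*-congˡ (sym (neg-^ (q (n ℕ.∸ suc k)) (suc p)))))))

        -- `a n` cancels the term `k = n` of `y`; the terms above `n` remain in `H` and those below
        -- in `head`.
        total≈ : total ≈ - (x ^ suc p * (sign (suc p) * H p y + head))
        total≈ = trans
          (+-congʳ {x = - (x ^ suc p * (sign (suc p) * y))} (sym pole))
          (trans (solve 5 (λ X s v y U → X :* (s :* v) :- X :* (s :* y) := :- (X :* (s :* (y :- (U :+ v)) :+ s :* U))) refl
              (x ^ suc p) (sign (suc p)) (u p n) y (∑ n (u p)))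
            (-‿cong (*-congˡ (+-congˡ head≈))))

        -- In the `F` part the two signs combine to one that does not depend on `i`; in the `E` part
        -- the sign turns `x ^ i` into `(- x) ^ i`. These are exactly the weights of the tail and
        -- head expansions.
        term≈ : ∀ i → term i ≈ (- (x ^ suc p)) * (sign (suc p) * (weight p i * proj₁ (F (i ℕ.+ p))) + weight⁻ p i * E (i ℕ.+ p))
        term≈ i = trans (*-cong (*-congˡ (+-congˡ (*-congʳ sign-split))) power-split)
          (trans (solve 7 (λ σ c E t φ X Z → ((:- con (+ 1) :* σ) :* c :* (E :+ (σ :* t) :* φ)) :* (X :* Z)
                := (:- Z) :* (t :* ((c :* X) :* φ) :* (σ :* σ) :+ (c :* (σ :* X)) :* E)) refl
              (sign i) (ι (binomial p i)) (E (i ℕ.+ p)) (sign (suc p)) (proj₁ (F (i ℕ.+ p))) (x ^ i) (x ^ suc p))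
            (*-congˡ (+-cong (trans (*-congˡ (sign² i)) (*-identityʳ _)) (*-congʳ (*-congˡ (sym (neg-^ x i)))))))
          where
          sign-split : sign (suc (i ℕ.+ p)) ≈ sign i * sign (suc p)
          sign-split = trans (reflexive (≡.cong sign (≡.sym (ℕ.+-suc i p)))) (^-homo-* (- 1#) i (suc p))
          power-split : x ^ suc (i ℕ.+ p) ≈ x ^ i * x ^ suc p
          power-split = trans (reflexive (≡.cong (x ^_) (≡.sym (ℕ.+-suc i p)))) (^-homo-* x i (suc p))

        difference≈ : ∀ J → ∑ J term - total ≈ x ^ suc p * (sign (suc p) * tail-difference J + head-difference J)
        difference≈ J = trans
          (+-cong (trans (∑-cong J term≈) (trans (∑-*ˡ J _ _) (*-congˡ (trans (∑-+ J _ _) (+-congʳ (∑-*ˡ J _ _))))))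
            (-‿cong total≈))
          (solve 6 (λ Z t A B h e → (:- Z) :* (t :* A :+ B) :- (:- (Z :* (t :* h :+ e))) := Z :* (t :* (h :- A) :+ (e :- B))) refl
            (x ^ suc p) (sign (suc p)) (∑ J (λ i → weight p i * proj₁ (F (i ℕ.+ p)))) (∑ J (λ i → weight⁻ p i * E (i ℕ.+ p))) (H p y) head)

      expansion : θ ℝ.< 1ᴿ → Lim (λ J → ∑ J term) total
      -- The remainder estimates hold from order 1 on, hence the shift by one.
      expansion θ<1 = Lim-unsuc (Lim-null error Null-error ∣difference∣)
        where
        tail-error : ℕ → ℝ.Carrier
        tail-error J = (D ℝ.* D ℝ.* S) ℝ.* remainderBound L θ p (suc J) ℝ.+ half ℝ.^ suc J
        error : ℕ → ℝ.Carrier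
        error J = θ ℝ.^ suc p ℝ.* (1ᴿ ℝ.^ suc p ℝ.* tail-error J ℝ.+ W⁻ ℝ.* remainderBound L⁻ θ p (suc J))
        ∣difference∣ : ∀ J → ∣ ∑ (suc J) term - total ∣≤ error J
        ∣difference∣ J = ∣∣-resp (sym (difference≈ (suc J)))
          (∣∣-* (∣∣-^ (suc p) ∣x∣) (∣∣-+ (∣∣-* (∣∣-^ (suc p) (∣∣-neg ∣1∣)) (∣tail-difference∣ J)) (∣head-difference∣ J)))
        Null-error : Null error
        Null-error = ℝ.Null-* (θ ℝ.^ suc p) (ℝ.^-nonneg (suc p) 0≤θ)
          (ℝ.Null-+
            (ℝ.Null-* (1ᴿ ℝ.^ suc p) (ℝ.^-nonneg (suc p) ℝ.0≤1)
              (ℝ.Null-+ (ℝ.Null-* (D ℝ.* D ℝ.* S) (ℝ.*-nonneg (ℝ.0≤x² D) (Summable.bounded Summable-w 0))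
                          (ℝ.Null-suc (Null-remainderBound 0≤L 0≤θ θ<1 p)))
                        (ℝ.Null-suc (ℝ.Null-^ (ℝ.<⇒≤ ℝ.0<half) half<1))))
            (ℝ.Null-* W⁻ (∣∣-nonneg (∣head-sum∣)) (ℝ.Null-suc (Null-remainderBound 0≤L⁻ 0≤θ θ<1 p))))
          where
          ∣head-sum∣ : ∣ ∑ n (λ k → a (n ℕ.∸ suc k)) ∣≤ W⁻
          ∣head-sum∣ = ∣∣-∑ n (λ k → ∣a∣ (n ℕ.∸ suc k))

-- The complex numbers as a valued field.

module ComplexNumbers (R : Reals) where
  open Complex R
  module ℝ = Growth R
  open ℝ using (half)
  open ℝ.≤-Reasoning

  open ℝ using (solve; _:=_; _:+_; _:-_; _:*_; :-_; con)

  ℂ-commutativeRing : CommutativeRing 0ℓ 0ℓ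
  ℂ-commutativeRing = record
    { Carrier = ℂ ; _≈_ = _≈_ ; _+_ = _+_ ; _*_ = _*_ ; -_ = -_ ; 0# = 0# ; 1# = 1#
    ; isCommutativeRing = record
      { isRing = record
        { +-isAbelianGroup = record
          { isGroup = record
            { isMonoid = record
              { isSemigroup = record
                { isMagma = record
                  { isEquivalence = record
                    { refl  = ℝ.refl , ℝ.refl
                    ; sym   = λ (p , q) → ℝ.sym p , ℝ.sym q
                    ; trans = λ (p , q) (p′ , q′) → ℝ.trans p p′ , ℝ.trans q q′ }
                  ; ∙-cong = λ (p , q) (p′ , q′) → ℝ.+-cong p p′ , ℝ.+-cong q q′ }
                ; assoc = λ z w v → ℝ.+-assoc _ _ _ , ℝ.+-assoc _ _ _ }
              ; identity = (λ z → ℝ.+-identityˡ _ , ℝ.+-identityˡ _) , (λ z → ℝ.+-identityʳ _ , ℝ.+-identityʳ _) }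
            ; inverse = (λ z → ℝ.-‿inverseˡ _ , ℝ.-‿inverseˡ _) , (λ z → ℝ.-‿inverseʳ _ , ℝ.-‿inverseʳ _)
            ; ⁻¹-cong = λ (p , q) → ℝ.-‿cong p , ℝ.-‿cong q }
          ; comm = λ z w → ℝ.+-comm _ _ , ℝ.+-comm _ _ }
        ; *-cong = λ (p , q) (p′ , q′) →
            ℝ.+-cong (ℝ.*-cong p p′) (ℝ.-‿cong (ℝ.*-cong q q′)) , ℝ.+-cong (ℝ.*-cong p q′) (ℝ.*-cong q p′)
        ; *-assoc = λ (a +i b) (c +i d) (e +i f) →
            solve 6 (λ a b c d e f → (a :* c :- b :* d) :* e :- (a :* d :+ b :* c) :* f
              := a :* (c :* e :- d :* f) :- b :* (c :* f :+ d :* e)) ℝ.refl a b c d e f ,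
            solve 6 (λ a b c d e f → (a :* c :- b :* d) :* f :+ (a :* d :+ b :* c) :* e
              := a :* (c :* f :+ d :* e) :+ b :* (c :* e :- d :* f)) ℝ.refl a b c d e f
        ; *-identity =
            (λ (a +i b) → solve 2 (λ a b → con (+ 1) :* a :- con (+ 0) :* b := a) ℝ.refl a b ,
                          solve 2 (λ a b → con (+ 1) :* b :+ con (+ 0) :* a := b) ℝ.refl a b) ,
            (λ (a +i b) → solve 2 (λ a b → a :* con (+ 1) :- b :* con (+ 0) := a) ℝ.refl a b ,
                          solve 2 (λ a b → a :* con (+ 0) :+ b :* con (+ 1) := b) ℝ.refl a b)
        ; distrib =
            (λ (a +i b) (c +i d) (e +i f) →
              solve 6 (λ a b c d e f → a :* (c :+ e) :- b :* (d :+ f) := (a :* c :- b :* d) :+ (a :* e :- b :* f)) ℝ.refl a b c d e f ,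
              solve 6 (λ a b c d e f → a :* (d :+ f) :+ b :* (c :+ e) := (a :* d :+ b :* c) :+ (a :* f :+ b :* e)) ℝ.refl a b c d e f) ,
            (λ (a +i b) (c +i d) (e +i f) →
              solve 6 (λ a b c d e f → (c :+ e) :* a :- (d :+ f) :* b := (c :* a :- d :* b) :+ (e :* a :- f :* b)) ℝ.refl a b c d e f ,
              solve 6 (λ a b c d e f → (c :+ e) :* b :+ (d :+ f) :* a := (c :* b :+ d :* a) :+ (e :* b :+ f :* a)) ℝ.refl a b c d e f) }
      ; *-comm = λ (a +i b) (c +i d) →
          solve 4 (λ a b c d → a :* c :- b :* d := c :* a :- d :* b) ℝ.refl a b c d ,
          solve 4 (λ a b c d → a :* d :+ b :* c := c :* b :+ d :* a) ℝ.refl a b c d } }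

  0≤∣∣² : ∀ z → ℝ.0# ℝ.≤ ∣ z ∣²
  0≤∣∣² z = ℝ.0≤-+ (ℝ.0≤x² (re z)) (ℝ.0≤x² (im z))

  re²≤∣∣² : ∀ z → re z ℝ.* re z ℝ.≤ ∣ z ∣²
  re²≤∣∣² z = ℝ.x≤x+y _ (ℝ.0≤x² (im z))

  im²≤∣∣² : ∀ z → im z ℝ.* im z ℝ.≤ ∣ z ∣²
  im²≤∣∣² z = ℝ.y≤x+y _ (ℝ.0≤x² (re z))

  ∣∣²-cong : ∀ {z w} → z ≈ w → ∣ z ∣² ℝ.≈ ∣ w ∣²
  ∣∣²-cong (p , q) = ℝ.+-cong (ℝ.*-cong p p) (ℝ.*-cong q q)

  ∣∣²-* : ∀ z w → ∣ z * w ∣² ℝ.≈ ∣ z ∣² ℝ.* ∣ w ∣²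
  ∣∣²-* (a +i b) (c +i d) = solve 4 (λ a b c d →
    (a :* c :- b :* d) :* (a :* c :- b :* d) :+ (a :* d :+ b :* c) :* (a :* d :+ b :* c)
      := (a :* a :+ b :* b) :* (c :* c :+ d :* d)) ℝ.refl a b c d

  ∣∣²-neg : ∀ z → ∣ - z ∣² ℝ.≈ ∣ z ∣²
  ∣∣²-neg (a +i b) = solve 2 (λ a b → (:- a) :* (:- a) :+ (:- b) :* (:- b) := a :* a :+ b :* b) ℝ.refl a b

  ∣1∣²≈1 : ∣ 1# ∣² ℝ.≈ ℝ.1# ℝ.* ℝ.1#
  ∣1∣²≈1 = ℝ.trans (ℝ.+-congˡ (ℝ.zeroˡ ℝ.0#)) (ℝ.+-identityʳ _)

  ∣∣≤-mono : ∀ {z r s} → r ℝ.≤ s → ∣ z ∣≤ r → ∣ z ∣≤ s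
  ∣∣≤-mono r≤s (0≤r , z≤r) = ℝ.≤-trans 0≤r r≤s , ℝ.≤-trans z≤r (ℝ.*-mono-≤ (ℝ.≤-trans 0≤r r≤s) 0≤r r≤s r≤s)

  ∣∣≤-resp : ∀ {z w r} → z ≈ w → ∣ z ∣≤ r → ∣ w ∣≤ r
  ∣∣≤-resp z≈w (0≤r , z≤r) = 0≤r , ℝ.≤-trans (ℝ.≤-reflexive (ℝ.sym (∣∣²-cong z≈w))) z≤r

  ∣∣≤-* : ∀ {z w r s} → ∣ z ∣≤ r → ∣ w ∣≤ s → ∣ z * w ∣≤ r ℝ.* s
  ∣∣≤-* {z} {w} {r} {s} (0≤r , z≤r) (0≤s , w≤s) = ℝ.*-nonneg 0≤r 0≤s , (begin
    ∣ z * w ∣²                     ≈⟨ ∣∣²-* z w ⟩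
    ∣ z ∣² ℝ.* ∣ w ∣²              ≤⟨ ℝ.*-mono-≤ (ℝ.0≤x² r) (0≤∣∣² w) z≤r w≤s ⟩
    (r ℝ.* r) ℝ.* (s ℝ.* s)        ≈⟨ solve 2 (λ r s → (r :* r) :* (s :* s) := (r :* s) :* (r :* s)) ℝ.refl r s ⟩
    (r ℝ.* s) ℝ.* (r ℝ.* s)        ∎)

  -- The Cauchy–Schwarz inequality bounds the cross term of |z + w|².
  ∣∣≤-+ : ∀ {z w r s} → ∣ z ∣≤ r → ∣ w ∣≤ s → ∣ z + w ∣≤ r ℝ.+ s
  ∣∣≤-+ {z@(a +i b)} {w@(c +i d)} {r} {s} (0≤r , z≤r) (0≤s , w≤s) = ℝ.0≤-+ 0≤r 0≤s , (begin
    ∣ z + w ∣²                                             ≈⟨ solve 4 (λ a b c d →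
      (a :+ c) :* (a :+ c) :+ (b :+ d) :* (b :+ d)
        := (a :* a :+ b :* b) :+ (c :* c :+ d :* d) :+ con (+ 2) :* (a :* c :+ b :* d)) ℝ.refl a b c d ⟩
    ∣ z ∣² ℝ.+ ∣ w ∣² ℝ.+ ℝ.2# ℝ.* dot                     ≤⟨ ℝ.+-mono-≤ (ℝ.+-mono-≤ z≤r w≤s) (ℝ.*-monoʳ-≤ (ℝ.<⇒≤ ℝ.0<2) dot≤rs) ⟩
    r ℝ.* r ℝ.+ s ℝ.* s ℝ.+ ℝ.2# ℝ.* (r ℝ.* s)             ≈⟨ solve 2 (λ r s →
      r :* r :+ s :* s :+ con (+ 2) :* (r :* s) := (r :+ s) :* (r :+ s)) ℝ.refl r s ⟩
    (r ℝ.+ s) ℝ.* (r ℝ.+ s)                                ∎)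
    where
    dot : ℝ
    dot = a ℝ.* c ℝ.+ b ℝ.* d
    det : ℝ
    det = a ℝ.* d ℝ.- b ℝ.* c
    dot≤rs : dot ℝ.≤ r ℝ.* s
    dot≤rs = ℝ.x²≤y²⇒x≤y (ℝ.*-nonneg 0≤r 0≤s) (begin
      dot ℝ.* dot                 ≤⟨ ℝ.≤-by-diff (det ℝ.* det) (ℝ.0≤x² det) (solve 4 (λ a b c d →
        (a :* a :+ b :* b) :* (c :* c :+ d :* d)
          := (a :* c :+ b :* d) :* (a :* c :+ b :* d) :+ (a :* d :- b :* c) :* (a :* d :- b :* c)) ℝ.refl a b c d) ⟩
      ∣ z ∣² ℝ.* ∣ w ∣²           ≤⟨ ℝ.*-mono-≤ (ℝ.0≤x² r) (0≤∣∣² w) z≤r w≤s ⟩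
      (r ℝ.* r) ℝ.* (s ℝ.* s)     ≈⟨ solve 2 (λ r s → (r :* r) :* (s :* s) := (r :* s) :* (r :* s)) ℝ.refl r s ⟩
      (r ℝ.* s) ℝ.* (r ℝ.* s)     ∎)

  -- `1 + |z|²` dominates `|z|` without a square root.
  ∣∣≤-bound : ∀ z → ∃[ r ] ∣ z ∣≤ r
  ∣∣≤-bound z = ℝ.1# ℝ.+ N , ℝ.0≤-+ ℝ.0≤1 (0≤∣∣² z) ,
      ℝ.≤-by-diff (ℝ.1# ℝ.+ (N ℝ.+ N ℝ.* N)) (ℝ.0≤-+ ℝ.0≤1 (ℝ.0≤-+ (0≤∣∣² z) (ℝ.0≤x² N)))
        (solve 1 (λ n → (con (+ 1) :+ n) :* (con (+ 1) :+ n) := n :+ (con (+ 1) :+ (n :+ n :* n))) ℝ.refl N)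
    where N = ∣ z ∣²

  -- Were `x` apart from 0, half of `|x|` as `ε` would give a contradiction; tightness of apartness
  -- does the rest.
  x²≤ε²⇒x≈0 : ∀ {x} → (∀ ε → ℝ.0# ℝ.< ε → x ℝ.* x ℝ.≤ ε ℝ.* ε) → x ℝ.≈ ℝ.0#
  x²≤ε²⇒x≈0 {x} small = proj₁ (ℝ.tight x ℝ.0#) λ x#0 →
    [ (λ x<0 → positive (ℝ.- x) (ℝ.0<-neg x<0)
         (solve 1 (λ x → (:- x) :* (:- x) := x :* x) ℝ.refl x))
    , (λ 0<x → positive x 0<x ℝ.refl) ]′ (ℝ.#⇒<⊎> x#0)
    where
    positive : ∀ y → ℝ.0# ℝ.< y → y ℝ.* y ℝ.≈ x ℝ.* x → ⊥
    positive y 0<y y²≈x² = ℝ.<-irrefl ℝ.refl (begin-strict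
      x ℝ.* x                           ≤⟨ small (half ℝ.* y) (ℝ.0<half* 0<y) ⟩
      (half ℝ.* y) ℝ.* (half ℝ.* y)     <⟨ ℝ.*-mono-< 0≤hy 0≤hy (ℝ.half*< 0<y) (ℝ.half*< 0<y) ⟩
      y ℝ.* y                           ≈⟨ y²≈x² ⟩
      x ℝ.* x                           ∎)
      where
      0≤hy : ℝ.0# ℝ.≤ half ℝ.* y
      0≤hy = ℝ.<⇒≤ (ℝ.0<half* 0<y)

  -- The conclusion is a negation, so `r² < |q|²` may be assumed. Then `s² < |w|²` contradicts
  -- `|w * q|² = 1`, which gives `|w| ≤ s` against the hypothesis.
  ∣∣≤-inverse : ∀ {w q r s} → ℝ.0# ℝ.< r → r ℝ.* s ℝ.≈ ℝ.1# → w * q ≈ 1# → ¬ (∣ w ∣≤ s) → ∣ q ∣≤ r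
  ∣∣≤-inverse {w} {q} {r} {s} 0<r rs≈1 wq≈1 w≰s = ℝ.<⇒≤ 0<r , λ r²<q → w≰s (0≤s , λ s²<w → ℝ.<-irrefl ℝ.refl (begin-strict
      ℝ.1#                        ≈⟨ ℝ.trans (ℝ.*-cong rs≈1 rs≈1) (ℝ.*-identityˡ ℝ.1#) ⟨
      (r ℝ.* s) ℝ.* (r ℝ.* s)     ≈⟨ solve 2 (λ r s → (r :* s) :* (r :* s) := (s :* s) :* (r :* r)) ℝ.refl r s ⟩
      (s ℝ.* s) ℝ.* (r ℝ.* r)     <⟨ ℝ.*-mono-< (ℝ.0≤x² s) (ℝ.0≤x² r) s²<w r²<q ⟩
      ∣ w ∣² ℝ.* ∣ q ∣²           ≈⟨ ∣∣²-* w q ⟨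
      ∣ w * q ∣²                  ≈⟨ ∣∣²-cong wq≈1 ⟩
      ∣ 1# ∣²                     ≈⟨ ℝ.trans ∣1∣²≈1 (ℝ.*-identityˡ ℝ.1#) ⟩
      ℝ.1#                        ∎))
    where
    0≤s : ℝ.0# ℝ.≤ s
    0≤s = ℝ.*-cancelˡ-≤ 0<r (begin
      r ℝ.* ℝ.0# ≈⟨ ℝ.zeroʳ r ⟩
      ℝ.0#       ≤⟨ ℝ.0≤1 ⟩
      ℝ.1#       ≈⟨ rs≈1 ⟨
      r ℝ.* s    ∎)

  ⁻¹-inverse : ∀ z (z≠0 : z ≠0) → z * z ⁻¹[ z≠0 ] ≈ 1#
  ⁻¹-inverse (a +i b) z≠0 =
    ℝ.trans (solve 3 (λ a b r → a :* (a :* r) :- b :* ((:- b) :* r) := (a :* a :+ b :* b) :* r) ℝ.refl a b r) (ℝ.recip-inverse z≠0) ,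
    solve 3 (λ a b r → a :* ((:- b) :* r) :+ b :* (a :* r) := con (+ 0)) ℝ.refl a b r
    where r = ℝ.recip z≠0

  ∣re∣≤ : ∀ {z r} → ∣ z ∣≤ r → re z ℝ.≤ r × ℝ.- re z ℝ.≤ r
  ∣re∣≤ {z} (0≤r , z≤r) = ℝ.x²≤y²⇒x≤y 0≤r (ℝ.≤-trans (re²≤∣∣² z) z≤r) ,
    ℝ.x²≤y²⇒x≤y 0≤r (ℝ.≤-trans (ℝ.≤-reflexive (solve 1 (λ x → (:- x) :* (:- x) := x :* x) ℝ.refl (re z))) (ℝ.≤-trans (re²≤∣∣² z) z≤r))

  ∣im∣≤ : ∀ {z r} → ∣ z ∣≤ r → im z ℝ.≤ r × ℝ.- im z ℝ.≤ r
  ∣im∣≤ {z} (0≤r , z≤r) = ℝ.x²≤y²⇒x≤y 0≤r (ℝ.≤-trans (im²≤∣∣² z) z≤r) ,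
    ℝ.x²≤y²⇒x≤y 0≤r (ℝ.≤-trans (ℝ.≤-reflexive (solve 1 (λ x → (:- x) :* (:- x) := x :* x) ℝ.refl (im z))) (ℝ.≤-trans (im²≤∣∣² z) z≤r))

  private
    square≤ : ∀ {x δ} → x ℝ.< δ → ℝ.- x ℝ.< δ → x ℝ.* x ℝ.≤ δ ℝ.* δ
    square≤ {x} {δ} x<δ -x<δ = ℝ.≤-by-diff ((δ ℝ.- x) ℝ.* (δ ℝ.- (ℝ.- x)))
      (ℝ.*-nonneg (ℝ.0≤y-x (ℝ.<⇒≤ x<δ)) (ℝ.0≤y-x (ℝ.<⇒≤ -x<δ)))
      (solve 2 (λ x d → d :* d := x :* x :+ (d :- x) :* (d :- (:- x))) ℝ.refl x δ)

    module _ (u : ℕ → ℂ)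
             (cauchy : ∀ ε → ℝ.0# ℝ.< ε → ∃[ N ] ∀ n → ∣ u (N ℕ.+ n) - u N ∣≤ ε) where

      part-cauchy : (part : ℂ → ℝ) →
        (∀ {z w r} → ∣ z - w ∣≤ r → (part z ℝ.- part w ℝ.≤ r) × (part w ℝ.- part z ℝ.≤ r)) →
        ℝ.IsCauchy (λ n → part (u n))
      part-cauchy part part≤ ε 0<ε = N , λ m n N≤m N≤n → begin-strict
          part (u m) ℝ.- part (u n)
            ≈⟨ solve 3 (λ m n k → m :- n := (m :- k) :+ (k :- n)) ℝ.refl (part (u m)) (part (u n)) (part (u N)) ⟩
          (part (u m) ℝ.- part (u N)) ℝ.+ (part (u N) ℝ.- part (u n))
            ≤⟨ ℝ.+-mono-≤ (proj₁ (part≤ (near m N≤m))) (proj₂ (part≤ (near n N≤n))) ⟩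
          half ℝ.* (half ℝ.* ε) ℝ.+ half ℝ.* (half ℝ.* ε)   ≈⟨ ℝ.half+half _ ⟩
          half ℝ.* ε                                        <⟨ ℝ.half*< 0<ε ⟩
          ε                                                 ∎
        where
        C₀ = cauchy (half ℝ.* (half ℝ.* ε)) (ℝ.0<half* (ℝ.0<half* 0<ε))
        N = proj₁ C₀
        near : ∀ m → N ℕ.≤ m → ∣ u m - u N ∣≤ half ℝ.* (half ℝ.* ε)
        near m N≤m = ≡.subst (λ j → ∣ u j - u N ∣≤ half ℝ.* (half ℝ.* ε)) (ℕ.m+[n∸m]≡n N≤m) (proj₂ C₀ (m ℕ.∸ N))

      re-limit : ∃[ l ] ℝ.ConvergesTo (λ n → re (u n)) l
      re-limit = ℝ.complete _ (part-cauchy re λ {z} {w} z-w → proj₁ (∣re∣≤ z-w) ,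
        ℝ.≤-trans (ℝ.≤-reflexive (solve 2 (λ z w → w :- z := :- (z :- w)) ℝ.refl (re z) (re w))) (proj₂ (∣re∣≤ z-w)))

      im-limit : ∃[ l ] ℝ.ConvergesTo (λ n → im (u n)) l
      im-limit = ℝ.complete _ (part-cauchy im λ {z} {w} z-w → proj₁ (∣im∣≤ z-w) ,
        ℝ.≤-trans (ℝ.≤-reflexive (solve 2 (λ z w → w :- z := :- (z :- w)) ℝ.refl (im z) (im w))) (proj₂ (∣im∣≤ z-w)))

  ℂ-complete : ∀ (u : ℕ → ℂ) → (∀ ε → ℝ.0# ℝ.< ε → ∃[ N ] ∀ n → ∣ u (N ℕ.+ n) - u N ∣≤ ε) →
    ∃[ l ] ∀ ε → ℝ.0# ℝ.< ε → ∃[ N ] ∀ n → N ℕ.≤ n → ∣ u n - l ∣≤ ε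
  ℂ-complete u cauchy = (lr +i li) , λ ε 0<ε →
      let X = proj₂ (re-limit u cauchy) (half ℝ.* ε) (ℝ.0<half* 0<ε)
          Y = proj₂ (im-limit u cauchy) (half ℝ.* ε) (ℝ.0<half* 0<ε)
      in proj₁ X ℕ.⊔ proj₁ Y , λ n N≤n →
           close ε 0<ε n (proj₂ X n (ℕ.≤-trans (ℕ.m≤m⊔n _ _) N≤n)) (proj₂ Y n (ℕ.≤-trans (ℕ.m≤n⊔m _ _) N≤n))
    where
    lr = proj₁ (re-limit u cauchy)
    li = proj₁ (im-limit u cauchy)
    flip : ∀ {x l δ} → l ℝ.- x ℝ.< δ → ℝ.- (x ℝ.- l) ℝ.< δ
    flip {x} {l} = ℝ.<-respˡ-≈ (solve 2 (λ x l → l :- x := :- (x :- l)) ℝ.refl x l)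
    close : ∀ ε → ℝ.0# ℝ.< ε → ∀ n →
      (re (u n) ℝ.- lr ℝ.< half ℝ.* ε) × (lr ℝ.- re (u n) ℝ.< half ℝ.* ε) →
      (im (u n) ℝ.- li ℝ.< half ℝ.* ε) × (li ℝ.- im (u n) ℝ.< half ℝ.* ε) →
      ∣ u n - (lr +i li) ∣≤ ε
    close ε 0<ε n (x<δ , -x<δ) (y<δ , -y<δ) = ℝ.<⇒≤ 0<ε , (begin
      ∣ u n - (lr +i li) ∣²               ≤⟨ ℝ.+-mono-≤ (square≤ x<δ (flip -x<δ)) (square≤ y<δ (flip -y<δ)) ⟩
      δ ℝ.* δ ℝ.+ δ ℝ.* δ                 ≤⟨ ℝ.≤-by-diff (ℝ.2# ℝ.* (δ ℝ.* δ)) (ℝ.*-nonneg (ℝ.<⇒≤ ℝ.0<2) (ℝ.0≤x² δ))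
        (solve 1 (λ d → (d :+ d) :* (d :+ d) := (d :* d :+ d :* d) :+ con (+ 2) :* (d :* d)) ℝ.refl δ) ⟩
      (δ ℝ.+ δ) ℝ.* (δ ℝ.+ δ)             ≈⟨ ℝ.*-cong (ℝ.half+half ε) (ℝ.half+half ε) ⟩
      ε ℝ.* ε                             ∎)
      where δ = half ℝ.* ε

  open SemiringMult (CommutativeRing.semiring ℂ-commutativeRing) using () renaming (_×_ to _·_)

  ι≈fromℕ : ∀ n → n · 1# ≈ fromℕ n
  ι≈fromℕ zero    = ℝ.refl , ℝ.refl
  ι≈fromℕ (suc n) = ℝ.+-congˡ (proj₁ (ι≈fromℕ n)) , ℝ.trans (ℝ.+-identityˡ _) (proj₂ (ι≈fromℕ n))

  ∣1/∣≤κ : ∀ k → ∣ 1/ suc k ∣≤ ℝ.κ k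
  ∣1/∣≤κ k = ℝ.0≤κ k , ℝ.≤-reflexive (begin-equality
    ∣ v ∣²                                         ≈⟨ ℝ.*-identityʳ _ ⟨
    ∣ v ∣² ℝ.* ℝ.1#                                ≈⟨ ℝ.*-congˡ (ℝ.trans (ℝ.*-cong nκ≈1 nκ≈1) (ℝ.*-identityˡ ℝ.1#)) ⟨
    ∣ v ∣² ℝ.* ((n ℝ.* κ) ℝ.* (n ℝ.* κ))           ≈⟨ solve 3 (λ v n k → v :* ((n :* k) :* (n :* k))
                                                        := ((n :* n :+ con (+ 0) :* con (+ 0)) :* v) :* (k :* k)) ℝ.refl ∣ v ∣² n κ ⟩
    (∣ fromℕ (suc k) ∣² ℝ.* ∣ v ∣²) ℝ.* (κ ℝ.* κ)  ≈⟨ ℝ.*-congʳ (∣∣²-* (fromℕ (suc k)) v) ⟨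
    ∣ fromℕ (suc k) * v ∣² ℝ.* (κ ℝ.* κ)           ≈⟨ ℝ.*-congʳ (∣∣²-cong (⁻¹-inverse (fromℕ (suc k)) (fromℕ≠0 (suc k)))) ⟩
    ∣ 1# ∣² ℝ.* (κ ℝ.* κ)                          ≈⟨ ℝ.*-congʳ (ℝ.trans ∣1∣²≈1 (ℝ.*-identityˡ ℝ.1#)) ⟩
    ℝ.1# ℝ.* (κ ℝ.* κ)                             ≈⟨ ℝ.*-identityˡ _ ⟩
    κ ℝ.* κ                                        ∎)
    where
    v = 1/ suc k
    n = ℝ.fromℕ (suc k)
    κ = ℝ.κ k
    nκ≈1 : n ℝ.* κ ℝ.≈ ℝ.1#
    nκ≈1 = ℝ.recip-inverse (ℝ.0<fromℕ-suc k)

  ℂ-field : ValuedField R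
  ℂ-field = record
    { commutativeRing = ℂ-commutativeRing
    ; ∣_∣≤_      = ∣_∣≤_
    ; ∣∣-resp    = λ {z} {w} → ∣∣≤-resp {z} {w}
    ; ∣∣-mono    = λ {z} → ∣∣≤-mono {z}
    ; ∣∣-nonneg  = proj₁
    ; ∣∣-+       = λ {z} {w} → ∣∣≤-+ {z} {w}
    ; ∣∣-*       = λ {z} {w} → ∣∣≤-* {z} {w}
    ; ∣∣-neg     = λ {z} (0≤r , z≤r) → 0≤r , ℝ.≤-trans (ℝ.≤-reflexive (∣∣²-neg z)) z≤r
    ; ∣0∣        = ℝ.≤-refl , ℝ.≤-reflexive (ℝ.trans (ℝ.+-cong (ℝ.zeroˡ ℝ.0#) (ℝ.zeroˡ ℝ.0#))
                     (ℝ.trans (ℝ.+-identityˡ ℝ.0#) (ℝ.sym (ℝ.zeroˡ ℝ.0#))))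
    ; ∣1∣        = ℝ.0≤1 , ℝ.≤-reflexive ∣1∣²≈1
    ; 1≤∣1∣      = λ (0≤r , 1≤r²) → ℝ.x²≤y²⇒x≤y 0≤r (ℝ.≤-trans (ℝ.≤-reflexive (ℝ.sym ∣1∣²≈1)) 1≤r²)
    ; ∣∣-bound   = ∣∣≤-bound
    ; separated  = λ {z} small →
        x²≤ε²⇒x≈0 (λ ε 0<ε → ℝ.≤-trans (re²≤∣∣² z) (proj₂ (small ε 0<ε))) ,
        x²≤ε²⇒x≈0 (λ ε 0<ε → ℝ.≤-trans (im²≤∣∣² z) (proj₂ (small ε 0<ε)))
    ; ∣∣-inverse = λ {w} {q} → ∣∣≤-inverse {w} {q}
    ; ν          = λ k → 1/ suc k
    ; ν-inverse  = λ k → CommutativeRing.trans ℂ-commutativeRing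
        (CommutativeRing.*-congʳ ℂ-commutativeRing {1/ suc k} {suc k · 1#} {fromℕ (suc k)} (ι≈fromℕ (suc k)))
        (⁻¹-inverse (fromℕ (suc k)) (fromℕ≠0 (suc k)))
    ; ∣ν∣        = ∣1/∣≤κ
    ; complete   = ℂ-complete
    }

  ∣∣≤half⇒∣∣< : ∀ {z ε} → ℝ.0# ℝ.< ε → ∣ z ∣≤ half ℝ.* ε → ∣ z ∣< ε
  ∣∣≤half⇒∣∣< {z} {ε} 0<ε (0≤hε , z≤hε) = 0<ε , ℝ.≤-<-trans z≤hε (ℝ.*-mono-< 0≤hε 0≤hε (ℝ.half*< 0<ε) (ℝ.half*< 0<ε))

  ∣∣<⇒∣∣≤ : ∀ {z r} → ∣ z ∣< r → ∣ z ∣≤ r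
  ∣∣<⇒∣∣≤ (0<r , z<r) = ℝ.<⇒≤ 0<r , ℝ.<⇒≤ z<r

  -- (1 + |z|²)/2 dominates |z| by the inequality of the means.
  ∣∣<1⇒∣∣≤θ : ∀ {z} → ∣ z ∣< ℝ.1# → ∃[ θ ] (ℝ.0# ℝ.≤ θ) × (θ ℝ.< ℝ.1#) × ∣ z ∣≤ θ
  ∣∣<1⇒∣∣≤θ {z} (_ , z<1) = θ , 0≤θ , θ<1 , 0≤θ , (begin
      N                                ≈⟨ ℝ.*-identityˡ N ⟨
      ℝ.1# ℝ.* N                       ≈⟨ ℝ.*-congʳ (ℝ.trans (ℝ.*-cong 2h≈1 2h≈1) (ℝ.*-identityˡ ℝ.1#)) ⟨
      ((ℝ.2# ℝ.* half) ℝ.* (ℝ.2# ℝ.* half)) ℝ.* N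
        ≤⟨ ℝ.≤-by-diff ((half ℝ.* (ℝ.1# ℝ.- N)) ℝ.* (half ℝ.* (ℝ.1# ℝ.- N))) (ℝ.0≤x² _)
             (solve 2 (λ h n → (h :* (con (+ 1) :+ n)) :* (h :* (con (+ 1) :+ n))
               := ((con (+ 2) :* h) :* (con (+ 2) :* h)) :* n :+ (h :* (con (+ 1) :- n)) :* (h :* (con (+ 1) :- n))) ℝ.refl half N) ⟩
      θ ℝ.* θ                          ∎)
    where
    N = ∣ z ∣²
    θ = half ℝ.* (ℝ.1# ℝ.+ N)
    2h≈1 : ℝ.2# ℝ.* half ℝ.≈ ℝ.1#
    2h≈1 = ℝ.recip-inverse ℝ.0<2
    0≤θ : ℝ.0# ℝ.≤ θ
    0≤θ = ℝ.*-nonneg (ℝ.<⇒≤ ℝ.0<half) (ℝ.0≤-+ ℝ.0≤1 (0≤∣∣² z))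
    θ<1 : θ ℝ.< ℝ.1#
    θ<1 = begin-strict
      half ℝ.* (ℝ.1# ℝ.+ N)            <⟨ ℝ.*-monoʳ-< ℝ.0<half (ℝ.+-monoʳ-< ℝ.1# (ℝ.<-respʳ-≈ (ℝ.*-identityˡ ℝ.1#) z<1)) ⟩
      half ℝ.* (ℝ.1# ℝ.+ ℝ.1#)         ≈⟨ ℝ.trans (ℝ.*-comm _ _) 2h≈1 ⟩
      ℝ.1#                             ∎

  fromℕ-* : ∀ m n → fromℕ (m ℕ.* n) ≈ fromℕ m * fromℕ n
  fromℕ-* m n =
    ℝ.trans (ℝ.fromℕ-* m n) (solve 2 (λ a b → a :* b := a :* b :- con (+ 0) :* con (+ 0)) ℝ.refl _ _) ,
    solve 2 (λ a b → con (+ 0) := a :* con (+ 0) :+ con (+ 0) :* b) ℝ.refl _ _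

  ∣∣<1⇒∣re∣<1 : ∀ s n → ∣ s - fromℕ n ∣² ℝ.< ℝ.1# ℝ.* ℝ.1# →
    (re s ℝ.- ℝ.fromℕ n ℝ.< ℝ.1#) × (ℝ.- (re s ℝ.- ℝ.fromℕ n) ℝ.< ℝ.1#)
  ∣∣<1⇒∣re∣<1 s n lt = ℝ.≤-<-trans (proj₁ bounds) (proj₁ (proj₂ (proj₂ Θ))) , ℝ.≤-<-trans (proj₂ bounds) (proj₁ (proj₂ (proj₂ Θ)))
    where
    Θ = ∣∣<1⇒∣∣≤θ {s - fromℕ n} (ℝ.0<1 , lt)
    bounds = ∣re∣≤ {s - fromℕ n} (proj₂ (proj₂ (proj₂ Θ)))

  -- Distinct natural numbers differ by at least 1, and |Re (s - n)| < 1.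
  near⇒notNatural : ∀ {s n} → ∣ s - fromℕ n ∣< ℝ.1# → (s - fromℕ n) ≠0 → ∀ k → (fromℕ k - s) ≠0
  near⇒notNatural {s} {n} (_ , s-n<1) s≠n k with ℕ.<-cmp k n
  ... | tri≈ _ ≡.refl _ = ℝ.<-respʳ-≈
    (solve 4 (λ a b n o → (a :- n) :* (a :- n) :+ (b :- o) :* (b :- o) := (n :- a) :* (n :- a) :+ (o :- b) :* (o :- b)) ℝ.refl
      (re s) (im s) (ℝ.fromℕ n) ℝ.0#) s≠n
  ... | tri< k<n _ _ = ℝ.<-≤-trans (ℝ.0<x² (ℝ.#-sym (ℝ.<⇒# 0<s-k))) (ℝ.≤-trans (ℝ.≤-reflexive
        (solve 2 (λ a k → (a :- k) :* (a :- k) := (k :- a) :* (k :- a)) ℝ.refl (re s) (ℝ.fromℕ k))) (re²≤∣∣² (fromℕ k - s)))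
    where
    0<s-k : ℝ.0# ℝ.< re s ℝ.- ℝ.fromℕ k
    0<s-k = begin-strict
      ℝ.0#                                               <⟨ ℝ.0<y-x (proj₂ (∣∣<1⇒∣re∣<1 s n s-n<1)) ⟩
      ℝ.1# ℝ.- (ℝ.- (re s ℝ.- ℝ.fromℕ n))                ≈⟨ solve 3 (λ s n k → con (+ 1) :- (:- (s :- n)) := (s :- n) :+ (con (+ 1) :+ k) :- k) ℝ.refl (re s) (ℝ.fromℕ n) (ℝ.fromℕ k) ⟩
      (re s ℝ.- ℝ.fromℕ n) ℝ.+ ℝ.fromℕ (suc k) ℝ.- ℝ.fromℕ k  ≤⟨ ℝ.+-monoˡ-≤ _ (ℝ.+-monoʳ-≤ _ (ℝ.fromℕ-mono-≤ k<n)) ⟩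
      (re s ℝ.- ℝ.fromℕ n) ℝ.+ ℝ.fromℕ n ℝ.- ℝ.fromℕ k   ≈⟨ solve 3 (λ s n k → (s :- n) :+ n :- k := s :- k) ℝ.refl (re s) (ℝ.fromℕ n) (ℝ.fromℕ k) ⟩
      re s ℝ.- ℝ.fromℕ k                                 ∎
  ... | tri> _ _ n<k = ℝ.<-≤-trans (ℝ.0<x² (ℝ.#-sym (ℝ.<⇒# 0<k-s))) (re²≤∣∣² (fromℕ k - s))
    where
    0<k-s : ℝ.0# ℝ.< ℝ.fromℕ k ℝ.- re s
    0<k-s = begin-strict
      ℝ.0#                                               <⟨ ℝ.0<y-x (proj₁ (∣∣<1⇒∣re∣<1 s n s-n<1)) ⟩
      ℝ.1# ℝ.- (re s ℝ.- ℝ.fromℕ n)                      ≈⟨ solve 2 (λ s n → con (+ 1) :- (s :- n) := (con (+ 1) :+ n) :- s) ℝ.refl (re s) (ℝ.fromℕ n) ⟩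
      ℝ.fromℕ (suc n) ℝ.- re s                           ≤⟨ ℝ.+-monoˡ-≤ _ (ℝ.fromℕ-mono-≤ n<k) ⟩
      ℝ.fromℕ k ℝ.- re s                                 ∎

-- Algebraic identities of the digamma series, over any commutative ring.

module ResolventIdentities (A : CommutativeRing 0ℓ 0ℓ) where
  open CommutativeRing A
  open IntegerCoefficients A
  open PowersOfOne A
  open SemiringExp semiring using (_^_; ^-congˡ)
  open CommutativeExp commutativeSemiring using (^-distrib-*)

  negated-inverse : ∀ {z s i} → z ≈ 0# → s * i ≈ 1# → (z - s) * (- i) ≈ 1#
  negated-inverse {z} {s} {i} z≈0 si≈1 = trans (*-congʳ (+-congʳ z≈0))
    (trans (solve 2 (λ s i → (con (+ 0) :- s) :* (:- i) := s :* i) refl s i) si≈1)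

  cancel-factorial : ∀ {σ t i y} → t * i ≈ 1# → ((σ * t) * y) * i ≈ σ * y
  cancel-factorial {σ} {t} {i} {y} ti≈1 = trans
    (solve 4 (λ σ t i y → ((σ :* t) :* y) :* i := (t :* i) :* (σ :* y)) refl σ t i y)
    (trans (*-congʳ ti≈1) (*-identityˡ _))

  cancel-power : ∀ {x x′ i} p → x′ * i ≈ 1# → x′ ≈ x → ∀ A v → v ≈ i ^ p * (A - (A - x ^ p * v))
  cancel-power {x} {x′} {i} p x′i≈1 x′≈x A v = sym (trans
    (solve 4 (λ I A X v → I :* (A :- (A :- X :* v)) := (X :* I) :* v) refl (i ^ p) A (x ^ p) v)
    (trans (*-congʳ (trans (*-congʳ (^-congˡ p (sym x′≈x))) (trans (sym (^-distrib-* x′ i p)) (trans (^-congˡ p x′i≈1) (1^n≈1 p)))))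
      (*-identityˡ v)))

  derivative-coefficient : ∀ {σ t₊ n t} → t₊ ≈ n * t → (- 1# * σ) * t₊ ≈ - (n * (σ * t))
  derivative-coefficient {σ} {t₊} {n} {t} t₊≈nt = trans (*-congˡ t₊≈nt)
    (solve 3 (λ σ n t → (:- con (+ 1) :* σ) :* (n :* t) := :- (n :* (σ :* t))) refl σ n t)

  neg-neg : ∀ z → - (- z) ≈ z
  neg-neg = solve 1 (λ z → :- (:- z) := z) refl

  harmonic-term : ∀ b c v → b * (v * 1#) - c * v ≈ (b - c) * v
  harmonic-term = solve 3 (λ b c v → b :* (v :* con (+ 1)) :- c :* v := (b :- c) :* v) refl

  power-term : ∀ b c v → b * v - c * 0# ≈ b * v
  power-term = solve 3 (λ b c v → b :* v :- c :* con (+ 0) := b :* v) refl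

  negated-difference : ∀ z z′ → - z - (- z′) ≈ z′ - z
  negated-difference = solve 2 (λ z z′ → :- z :- (:- z′) := z′ :- z) refl

  -- As `q_0 = - 1 / s` and there is no correction at index 0, the zeroth term of `- Y_0` is
  -- `a_0 / s`; splitting it off leaves the series that starts at 1.
  digamma-value : ∀ {o y b i} → o ≈ 1# → ((- 1# * 1#) * o) * y ≈ b * i + - (y - b * (- i * 1# - 0#))
  digamma-value {o} {y} {b} {i} o≈1 = trans (*-congʳ (*-congˡ o≈1))
    (solve 3 (λ y b i → ((:- con (+ 1) :* con (+ 1)) :* con (+ 1)) :* y
        := b :* i :+ :- (y :- b :* ((:- i) :* con (+ 1) :- con (+ 0)))) refl y b i)

  digamma-term : ∀ b q v → - (b * (q * 1# - v)) ≈ b * v - b * q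
  digamma-term = solve 3 (λ b q v → :- (b :* (q :* con (+ 1) :- v)) := b :* v :- b :* q) refl

-- The parametric digamma function, its derivatives and its expansion.

module DigammaSeries (R : Reals) (a : ℤ → Complex.ℂ R) {α : Reals.Carrier R}
  (α<1 : Reals._<_ R α (Reals.1# R)) (a=o : Complex.IsLittleO R a α) where
  open Complex R
  open Digamma R a
  open ComplexNumbers R public
  module ℂR = CommutativeRing ℂ-commutativeRing
  open ResolventIdentities ℂ-commutativeRing
  open ℝ using (half)
  open ℝ.≤-Reasoning

  private
    module Wt = ℝ.Weight (ℝ.weight α<1)

    -- The little-o condition at `ε = 1` gives `|a k| ≤ W k` for `k > K₀`.
    K₀ : ℕ
    K₀ = proj₁ (a=o ℝ.1# ℝ.0<1)

    large : ∀ k → suc K₀ ℕ.≤ k → ∣ a (+ k) ∣≤ (ℝ.1# ℝ.* Wt.W k)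
    large (suc j) K₀<k = ∣∣≤-mono {a (+ suc j)} (ℝ.*-monoʳ-≤ ℝ.0≤1 (Wt.power≤W j (proj₁ (proj₂ bound)))) (proj₂ (proj₂ bound))
      where bound = proj₂ (a=o ℝ.1# ℝ.0<1) (+ suc j) K₀<k

    -- The weight is positive everywhere, so the finitely many earlier coefficients are absorbed in
    -- a constant multiple of it.
    constant = Analysis.uniform R ℂ-field (λ k r → ∣ a (+ k) ∣≤ (r ℝ.* Wt.W k))
      (λ {k} r≤s → ∣∣≤-mono {a (+ k)} (ℝ.*-monoˡ-≤ (ℝ.<⇒≤ (Wt.0<W k)) r≤s))
      (λ {k} {r} (0≤rW , _) → ℝ.*-cancelˡ-≤ (Wt.0<W k)
        (ℝ.≤-trans (ℝ.≤-reflexive (ℝ.zeroʳ (Wt.W k))) (ℝ.≤-trans 0≤rW (ℝ.≤-reflexive (ℝ.*-comm r (Wt.W k))))))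
      (λ k → let b = ∣∣≤-bound (a (+ k)) in proj₁ b ℝ.* ℝ.recip (Wt.0<W k) ,
        ∣∣≤-mono {a (+ k)} (ℝ.≤-reflexive (ℝ.sym (ℝ.trans (ℝ.*-assoc _ _ _)
          (ℝ.trans (ℝ.*-congˡ (ℝ.trans (ℝ.*-comm _ _) (ℝ.recip-inverse (Wt.0<W k)))) (ℝ.*-identityʳ _))))) (proj₂ b))
      (suc K₀) large

    0≤constant : ℝ.0# ℝ.≤ proj₁ constant
    0≤constant = ℝ.*-cancelˡ-≤ (Wt.0<W 0) (ℝ.≤-trans (ℝ.≤-reflexive (ℝ.zeroʳ (Wt.W 0)))
      (ℝ.≤-trans (proj₁ (proj₂ constant 0)) (ℝ.≤-reflexive (ℝ.*-comm _ (Wt.W 0)))))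

  coefficients : Coefficients R ℂ-field
  coefficients = record
    { a            = λ k → a (+ k)
    ; W            = λ k → proj₁ constant ℝ.* Wt.W k
    ; ∣a∣          = proj₂ constant
    ; Null-κW      = ℝ.Null-≤ (λ k → ℝ.≤-reflexive (swap _ _ _)) (ℝ.Null-* (proj₁ constant) 0≤constant Wt.Null-κW)
    ; Summable-κκW = ℝ.Summable-cong (λ k → ℝ.trans (ℝ.sym (swap _ _ _)) (ℝ.*-congˡ (ℝ.sym (swap _ _ _))))
                       (ℝ.Summable-* (proj₁ constant) 0≤constant Wt.Summable-κκW)
    }
    where
    swap : ∀ k c w → k ℝ.* (c ℝ.* w) ℝ.≈ c ℝ.* (k ℝ.* w)
    swap = ℝ.solve 3 (λ k c w → k ℝ.:* (c ℝ.:* w) ℝ.:= c ℝ.:* (k ℝ.:* w)) ℝ.refl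

  module S = Series R ℂ-field coefficients

  sum≈ : ∀ n (g : ℕ → ℂ) → S.∑ n g ≈ sum {n} (λ i → g (toℕ i))
  sum≈ zero    g = ℂR.refl {0#}
  sum≈ (suc n) g = ℂR.trans {S.∑ (suc n) g} {g 0 + S.∑ n (g ∘ suc)} (S.∑-first n g) (ℂR.+-congˡ {g 0} (sum≈ n (g ∘ suc)))

  ∑₁≈ : ∀ n (f : Seq₁) (g : ℕ → ℂ) → (∀ k → g k ≈ f (suc k)) → S.∑ n g ≈ ∑₁ n f
  ∑₁≈ n f g g≈f = ℂR.trans {S.∑ n g} {S.∑ n (λ k → f (suc k))} {∑₁ n f} (S.∑-cong n g≈f) (sum≈ n (λ k → f (suc k)))

  Lim⇒HasSum : ∀ (f : Seq₁) (g : ℕ → ℂ) {l} → (∀ k → g k ≈ f (suc k)) → S.Lim (λ n → S.∑ n g) l → HasSum f l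
  Lim⇒HasSum f g {l} g≈f →l ε 0<ε = proj₁ T , λ n N≤n → ∣∣≤half⇒∣∣< {∑₁ n f - l} 0<ε
      (∣∣≤-resp {S.∑ n g - l} {∑₁ n f - l} (ℂR.+-congʳ { - l} {S.∑ n g} {∑₁ n f} (∑₁≈ n f g g≈f)) (proj₂ T n N≤n))
    where T = →l (half ℝ.* ε) (ℝ.0<half* 0<ε)

  -- The domain grants `s ≠ 0` rather than `0 - s ≠ 0`, where `s = - z`; hence the separate clause
  -- at index 0.
  q : ∀ z → ΨDomain z → ℕ → ℂ
  q z z∈U zero    = - ((- z) ⁻¹[ proj₁ z∈U ])
  q z z∈U (suc k) = (fromℕ (suc k) - (- z)) ⁻¹[ proj₂ z∈U (suc k) ]

  q-inverse : ∀ z (z∈U : ΨDomain z) → S.IsResolvent (- z) (q z z∈U)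
  q-inverse z z∈U zero = negated-inverse {S.ι 0} { - z} {(- z) ⁻¹[ proj₁ z∈U ]} (ℂR.refl {0#}) (⁻¹-inverse (- z) (proj₁ z∈U))
  q-inverse z z∈U (suc k) = ℂR.trans
    {(S.ι (suc k) - (- z)) * q z z∈U (suc k)} {(fromℕ (suc k) - (- z)) * q z z∈U (suc k)} {1#}
    (ℂR.*-congʳ {q z z∈U (suc k)} {S.ι (suc k) - (- z)} {fromℕ (suc k) - (- z)}
      (ℂR.+-congʳ { - (- z)} {S.ι (suc k)} {fromℕ (suc k)} (ι≈fromℕ (suc k))))
    (⁻¹-inverse (fromℕ (suc k) - (- z)) (proj₂ z∈U (suc k)))

  -- Abstract because comparing unfolded limits is infeasible.
  abstract
    Yᶻ : ℕ → Fun ΨDomain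
    Yᶻ m z z∈U = proj₁ (S.Y { - z} {q z z∈U} (q-inverse z z∈U) m)

    Yᶻ-limit : ∀ m z z∈U → S.IsY m (q z z∈U) (Yᶻ m z z∈U)
    Yᶻ-limit m z z∈U = proj₂ (S.Y { - z} {q z z∈U} (q-inverse z z∈U) m)

  factor : ℕ → ℂ
  factor m = (- 1#) ^ suc m * fromℕ (m !)

  Ψ⁽_⁾ : ℕ → Fun ΨDomain
  Ψ⁽ m ⁾ z z∈U = factor m * Yᶻ m z z∈U

  factor-suc : ∀ m → factor (suc m) ≈ - (S.ι (suc m) * factor m)
  factor-suc m = derivative-coefficient {(- 1#) ^ suc m} {fromℕ (suc m !)} {S.ι (suc m)} {fromℕ (m !)}
    (ℂR.trans {fromℕ (suc m !)} {fromℕ (suc m) * fromℕ (m !)} {S.ι (suc m) * fromℕ (m !)} (fromℕ-* (suc m) (m !))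
      (ℂR.*-congʳ {fromℕ (m !)} {fromℕ (suc m)} {S.ι (suc m)} (ℂR.sym {S.ι (suc m)} {fromℕ (suc m)} (ι≈fromℕ (suc m)))))

  Ψ⁽0⁾-isΨ : IsΨ Ψ⁽ 0 ⁾
  Ψ⁽0⁾-isΨ z z∈U = S′ , Lim⇒HasSum (ΨTerm (- z) z∈U) (λ k → - f (suc k)) term≈ limit ,
      digamma-value {fromℕ 1} {y} {a (+ 0)} {(- z) ⁻¹[ proj₁ z∈U ]} (ℝ.+-identityʳ ℝ.1# , ℝ.refl)
    where
    y = Yᶻ 0 z z∈U
    f : ℕ → ℂ
    f k = a (+ k) * (q z z∈U k ^ 1 - S.reg 0 k)
    S′ : ℂ
    S′ = - (y - f 0)
    term≈ : ∀ k → - f (suc k) ≈ ΨTerm (- z) z∈U (suc k)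
    term≈ k = digamma-term (a (+ suc k)) (q z z∈U (suc k)) (1/ suc k)
    limit : S.Lim (λ n → S.∑ n (λ k → - f (suc k))) S′
    limit = S.Lim-cong
      {λ n → - (S.∑ (suc n) f - f 0)}
      {λ n → S.∑ n (λ k → - f (suc k))} {S′}
      (λ n → ℂR.sym {S.∑ n (λ k → - f (suc k))} { - (S.∑ (suc n) f - f 0)} (S.∑-drop-first n f))
      (S.Lim-neg {λ n → S.∑ (suc n) f - f 0} {y - f 0} (S.Lim-- {λ n → S.∑ (suc n) f} {λ _ → f 0} {y} {f 0} (S.Lim-shift {λ n → S.∑ n f} {y} 1 (Yᶻ-limit 0 z z∈U)) (S.Lim-const (f 0))))

  Ψ⁽⁾-derivative : ∀ m z z∈U → HasDerivative Ψ⁽ m ⁾ z z∈U (Ψ⁽ suc m ⁾ z z∈U)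
  Ψ⁽⁾-derivative m z z∈U ε 0<ε = proj₁ D , proj₁ (proj₂ D) , λ z′ z′∈U z′≠z z′-z<δ →
      ∣∣≤half⇒∣∣< {(Ψ⁽ m ⁾ z′ z′∈U - Ψ⁽ m ⁾ z z∈U) ÷ (z′ - z) [ z′≠z ] - Ψ⁽ suc m ⁾ z z∈U} 0<ε
        (proj₂ (proj₂ D) { - z′} {q z′ z′∈U} {z′ - z} {(z′ - z) ⁻¹[ z′≠z ]}
          {Yᶻ m z z∈U} {Yᶻ m z′ z′∈U} {Yᶻ (suc m) z z∈U}
          (q-inverse z′ z′∈U) (⁻¹-inverse (z′ - z) z′≠z) (negated-difference z z′) (∣∣<⇒∣∣≤ {z′ - z} z′-z<δ)
          (Yᶻ-limit m z z∈U) (Yᶻ-limit m z′ z′∈U) (Yᶻ-limit (suc m) z z∈U))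
    where
    D = S.Y-derivative { - z} {q z z∈U} {factor m} {factor (suc m)} m (q-inverse z z∈U) (factor-suc m)
      (half ℝ.* ε) (ℝ.0<half* 0<ε)

  Ψ⁽⁾-isDerivative : ∀ m → IsDerivative {ΨDomain} m Ψ⁽ 0 ⁾ Ψ⁽ m ⁾
  Ψ⁽⁾-isDerivative zero    = λ z z∈U → ℂR.refl {Ψ⁽ 0 ⁾ z z∈U}
  Ψ⁽⁾-isDerivative (suc m) = Ψ⁽ m ⁾ , Ψ⁽⁾-isDerivative m , Ψ⁽⁾-derivative m

  module _ (P n : ℕ) (s : ℂ) (near : ∣ s - fromℕ n ∣< 1ᴿ) (s≠n : (s - fromℕ n) ≠0) where
    private
      notNatural : ∀ k → (fromℕ k - s) ≠0
      notNatural = near⇒notNatural {s} {n} near s≠n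

    -- Membership speaks of `- (- s)`, which is merely `≈` to `s`; being nonzero is a statement
    -- about `∣_∣²` and is transported along it.
    -s∈U : ΨDomain (- s)
    -s∈U = ℝ.<-respʳ-≈ (ℝ.solve 2 (λ x y → (ℝ.con (+ 0) ℝ.:- x) ℝ.:* (ℝ.con (+ 0) ℝ.:- x) ℝ.:+ (ℝ.con (+ 0) ℝ.:- y) ℝ.:* (ℝ.con (+ 0) ℝ.:- y)
               ℝ.:= (ℝ.:- (ℝ.:- x)) ℝ.:* (ℝ.:- (ℝ.:- x)) ℝ.:+ (ℝ.:- (ℝ.:- y)) ℝ.:* (ℝ.:- (ℝ.:- y))) ℝ.refl (re s) (im s)) (notNatural 0) ,
      λ k → ℝ.<-respʳ-≈ (∣∣²-cong {fromℕ k - s} {fromℕ k - (- (- s))}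
        (ℂR.+-congˡ {fromℕ k} { - s} { - (- (- s))} (ℂR.sym { - (- (- s))} { - s} (neg-neg (- s))))) (notNatural k)

    private
      q-inverseˢ : S.IsResolvent s (q (- s) -s∈U)
      q-inverseˢ k = ℂR.trans {(S.ι k - s) * q (- s) -s∈U k} {(S.ι k - (- (- s))) * q (- s) -s∈U k} {1#}
        (ℂR.*-congʳ {q (- s) -s∈U k} {S.ι k - s} {S.ι k - (- (- s))}
          (ℂR.+-congˡ {S.ι k} { - s} { - (- (- s))} (ℂR.sym { - (- (- s))} { - s} (neg-neg (- s)))))
        (q-inverse (- s) -s∈U k)

      module X = Expansion R ℂ-field coefficients {s} {q (- s) -s∈U} q-inverseˢ n

      x≈ : s - fromℕ n ≈ X.x
      x≈ = ℂR.+-congˡ {s} { - fromℕ n} { - S.ι n} (ℂR.-‿cong {fromℕ n} {S.ι n} (ℂR.sym {S.ι n} {fromℕ n} (ι≈fromℕ n)))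

      Θ = ∣∣<1⇒∣∣≤θ {s - fromℕ n} near
      θ : ℝ
      θ = proj₁ Θ
      0≤θ : ℝ.0# ℝ.≤ θ
      0≤θ = proj₁ (proj₂ Θ)
      ∣x∣ : ∣ X.x ∣≤ θ
      ∣x∣ = ∣∣≤-resp {s - fromℕ n} {X.x} x≈ (proj₂ (proj₂ (proj₂ Θ)))

      y : ℂ
      y = Yᶻ P (- s) -s∈U

    total : ℂ
    total = a (+ n) - X.x ^ suc P * ((- 1#) ^ suc P * y)

    abstract
      F : ℕ → ℂ
      F j = proj₁ (X.F {θ} 0≤θ ∣x∣ j)

      F-limit : ∀ j → S.Lim (λ N → S.∑ N (X.FTerm j)) (F j)
      F-limit j = proj₂ (X.F {θ} 0≤θ ∣x∣ j)

      expansion-limit : S.Lim (λ J → S.∑ J λ i →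
        (((- 1#) ^ suc i * S.ι (binomial P i)) * (X.E (i ℕ.+ P) + (- 1#) ^ suc (i ℕ.+ P) * F (i ℕ.+ P))) * X.x ^ suc (i ℕ.+ P)) total
      expansion-limit = X.expansion {θ} 0≤θ ∣x∣ P {y} (Yᶻ-limit P (- s) -s∈U) (proj₁ (proj₂ (proj₂ Θ)))

    -- The value at 0 is a default, `M` of index `j` being defined for `j ≥ 1`.
    M : ℕ → ℂ
    M zero    = 0#
    M (suc j) = E n (suc j) + (- 1#) ^ suc j * F j

    M-isM : ∀ j → 1 ℕ.≤ j → IsM n j (M j)
    M-isM (suc j) _ = F j , Lim⇒HasSum (FTerm n (suc j)) (X.FTerm j) {F j} (term≈ j) (F-limit j) , ℂR.refl {M (suc j)}
      where
      index : ∀ k → a (+ suc (n ℕ.+ k)) ≡ a (+ (suc k ℕ.+ n))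
      index k = ≡.cong (λ m → a (+ suc m)) (ℕ.+-comm n k)
      term≈ : ∀ j k → X.FTerm j k ≈ FTerm n (suc j) (suc k)
      term≈ zero k = ℂR.trans {X.FTerm 0 k} {(a (+ suc (n ℕ.+ k)) - a (+ suc k)) * 1/ suc k} {FTerm n 1 (suc k)}
        (harmonic-term (a (+ suc (n ℕ.+ k))) (a (+ suc k)) (1/ suc k))
        (ℂR.reflexive (≡.cong (λ b → (b - a (+ suc k)) * 1/ suc k) (index k)))
      term≈ (suc i) k = ℂR.trans {X.FTerm (suc i) k} {a (+ suc (n ℕ.+ k)) * 1/ suc k ^ suc (suc i)} {FTerm n (suc (suc i)) (suc k)}
        (power-term (a (+ suc (n ℕ.+ k))) (a (+ suc k)) (1/ suc k ^ suc (suc i)))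
        (ℂR.reflexive (≡.cong (λ b → b * 1/ suc k ^ suc (suc i)) (index k)))

    private
      E≈ : ∀ p → X.E p ≈ E n (suc p)
      E≈ p = ℂR.trans {X.E p} {S.∑ n (λ k → a (+ n ℤ.- + suc k) * 1/ suc k ^ suc p)} {E n (suc p)}
        (S.∑-cong-< n (λ k k<n → ℂR.reflexive (≡.cong (λ m → a m * 1/ suc k ^ suc p) (≡.sym (≡.trans (ℤ.m-n≡m⊖n n (suc k)) (ℤ.⊖-≥ k<n))))))
        (sum≈ n (λ k → a (+ n ℤ.- + suc k) * 1/ suc k ^ suc p))

    expansion-sum : HasSum
      (λ j → (- 1#) ^ j * fromℕ ((j ℕ.+ suc P ∸ 2) C P) * M (j ℕ.+ suc P ∸ 1) * (s - fromℕ n) ^ (j ℕ.+ suc P ∸ 1)) total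
    expansion-sum = Lim⇒HasSum
      (λ j → (- 1#) ^ j * fromℕ ((j ℕ.+ suc P ∸ 2) C P) * M (j ℕ.+ suc P ∸ 1) * (s - fromℕ n) ^ (j ℕ.+ suc P ∸ 1))
      g {total} term≈ expansion-limit
      where
      g : ℕ → ℂ
      g i = (((- 1#) ^ suc i * S.ι (binomial P i)) * (X.E (i ℕ.+ P) + (- 1#) ^ suc (i ℕ.+ P) * F (i ℕ.+ P))) * X.x ^ suc (i ℕ.+ P)
      -- With the exponent as an argument `m`, the equation between `i + suc P` and `suc (i + P)` is
      -- applied in all places at once; at `m = i + suc P` this computes to the summand with
      -- `j = suc i`.
      t : ℕ → ℕ → ℂ
      t i m = (- 1#) ^ suc i * fromℕ ((m ∸ 1) C P) * M m * (s - fromℕ n) ^ m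
      term≈ : ∀ i → g i ≈ t i (i ℕ.+ suc P)
      term≈ i = ℂR.trans {g i} {t i (suc (i ℕ.+ P))} {t i (i ℕ.+ suc P)}
        (ℂR.*-cong {((- 1#) ^ suc i * S.ι (binomial P i)) * M′} {((- 1#) ^ suc i * fromℕ (binomial P i)) * M (suc (i ℕ.+ P))}
                   {X.x ^ suc (i ℕ.+ P)} {(s - fromℕ n) ^ suc (i ℕ.+ P)}
          (ℂR.*-cong {(- 1#) ^ suc i * S.ι (binomial P i)} {(- 1#) ^ suc i * fromℕ (binomial P i)} {M′} {M (suc (i ℕ.+ P))}
            (ℂR.*-congˡ {(- 1#) ^ suc i} {S.ι (binomial P i)} {fromℕ (binomial P i)} (ι≈fromℕ (binomial P i)))
            (ℂR.+-congʳ {(- 1#) ^ suc (i ℕ.+ P) * F (i ℕ.+ P)} {X.E (i ℕ.+ P)} {E n (suc (i ℕ.+ P))} (E≈ (i ℕ.+ P))))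
          (S.^-congˡ (suc (i ℕ.+ P)) {X.x} {s - fromℕ n} (ℂR.sym {s - fromℕ n} {X.x} x≈)))
        (ℂR.reflexive (≡.cong (t i) (≡.sym (ℕ.+-suc i P))))
        where
        M′ : ℂ
        M′ = X.E (i ℕ.+ P) + (- 1#) ^ suc (i ℕ.+ P) * F (i ℕ.+ P)

    -- The factorial in `factor` cancels, and what remains is the definition of `total` solved by
    -- means of the inverse power of `s - n`.
    value : Ψ⁽ P ⁾ (- s) -s∈U ÷ fromℕ (P !) [ fromℕ≠0 (P !) {{P !≢0}} ]
      ≈ (s - fromℕ n) ⁻¹[ s≠n ] ^ suc P * (a (+ n) - total)
    value = ℂR.trans {Ψ⁽ P ⁾ (- s) -s∈U ÷ fromℕ (P !) [ fromℕ≠0 (P !) {{P !≢0}} ]} {(- 1#) ^ suc P * y}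
        {(s - fromℕ n) ⁻¹[ s≠n ] ^ suc P * (a (+ n) - total)}
      (cancel-factorial {(- 1#) ^ suc P} {fromℕ (P !)} {fromℕ (P !) ⁻¹[ fromℕ≠0 (P !) {{P !≢0}} ]} {y}
        (⁻¹-inverse (fromℕ (P !)) (fromℕ≠0 (P !) {{P !≢0}})))
      (cancel-power {X.x} {s - fromℕ n} {(s - fromℕ n) ⁻¹[ s≠n ]} (suc P) (⁻¹-inverse (s - fromℕ n) s≠n) x≈
        (a (+ n)) ((- 1#) ^ suc P * y))

theorem2p1 :
    (R : Reals) → let open Complex R in
    (a : ℤ → ℂ) → let open Digamma R a in
    (α : ℝ) → α <ᴿ 1ᴿ → IsLittleO a α →
    (p : ℕ) → 1 ℕ.≤ p → (n : ℕ) →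
    (s : ℂ) → ∣ s - fromℕ n ∣< 1ᴿ → (s≠n : (s - fromℕ n) ≠0) →
    Σ[ w ∈ ℂ ] Σ[ M ∈ (ℕ → ℂ) ] Σ[ S ∈ ℂ ]
      (Ψ⁽ p ∸ 1 ⁾⟨ - s ⟩≈ w) ×
      ((j : ℕ) → 1 ℕ.≤ j → IsM n j (M j)) ×
      HasSum
        (λ j → (- 1#) ^ j * fromℕ ((j ℕ.+ p ∸ 2) C (p ∸ 1))
             * M (j ℕ.+ p ∸ 1) * (s - fromℕ n) ^ (j ℕ.+ p ∸ 1))
        S ×
      w ÷ fromℕ ((p ∸ 1) !) [ fromℕ≠0 ((p ∸ 1) !) {{ (p ∸ 1) !≢0 }} ]
        ≈ (s - fromℕ n) ⁻¹[ s≠n ] ^ p * (a (+ n) - S)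
theorem2p1 R a α α<1 a=o (suc P) _ n s near s≠n =
  Ψ⁽ P ⁾ (- s) U , M P n s near s≠n , total P n s near s≠n ,
  (Ψ⁽ 0 ⁾ , Ψ⁽ P ⁾ , U , Ψ⁽0⁾-isΨ , Ψ⁽⁾-isDerivative P , ℂR.refl {Ψ⁽ P ⁾ (- s) U}) ,
  M-isM P n s near s≠n , expansion-sum P n s near s≠n , value P n s near s≠n
  where
  open Complex R using (-_)
  open DigammaSeries R a α<1 a=o
  U = -s∈U P n s near s≠n
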